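{- There is an absolute constant $c>0$ and an algorithm with the following guarantee. Let $G=(V,E)$ be a planar graph with $\Delta(G)\le 8$, let $W\subseteq E$ be a set of butterfly-like edges that are pairwise 4-independent, and let $\pi$ be a partial 8-edge-coloring of $G$ with $\pi^{ -1}([8])=E\setminus W$. Then the algorithm finds, in time $O(|V|)$, a partial 8-edge-coloring $\sigma$ of $G$ such that $\sigma^{ -1}([8])=(E\setminus W)\cup W'$ for some $W'\subseteq W$ with $|W'|\ge c|W|$.
   Context: Graphs are finite and simple; $d_G(v)$ is the degree of $v$. $[8]=\{1,\dots,8\}$. A partial 8-edge-coloring of $G$ is a map $\pi:E\to[8]\cup\{\bot\}$ ($\bot$ meaning uncolored) such that any two distinct edges sharing an endpoint and both colored receive different colors. The distance between two vertices is the number of edges of a shortest path between them; the distance between two edges is the minimum distance between an endpoint of one and an endpoint of the other; two edges are $k$-independent if their distance is greater than $k$. A butterfly in $G$ is a subgraph $B$ of $G$ of one of two forms: (B1) six distinct vertices $x,y,z,v_1,v_2,v_3$ and edges $xy,xz,yv_1,yv_3,zv_1,zv_2,xv_1,xv_2,xv_3$, with $d_G(y)=d_G(z)=3$, $d_G(x)=8$, $d_G(v_i)=8$ for $i\in\{1,2,3\}$; or (B2) seven distinct vertices $x,y,z,v_1,\dots,v_4$ and edges $xy,xz,yv_1,yv_4,zv_2,zv_3,xv_1,\dots,xv_4$, with $d_G(y)=d_G(z)=3$, $d_G(x)=8$, $d_G(v_i)=8$ for $i\in\{1,\dots,4\}$. For such a butterfly the edge $xy$ is called butterfly-like. -}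

module Defs where

open import Data.Bool using (if_then_else_)
open import Data.Fin using (Fin; zero; suc; toℕ; inject₁; fromℕ)
import Data.Fin as Fin
open import Data.Fin.Subset using (Subset; _∈_; ∣_∣)
import Data.Integer as ℤ
open import Data.List using (List; []; _∷_; concatMap; allFin; foldr; map)
open import Data.List.Relation.Unary.Unique.Propositional using (Unique)
open import Data.Maybe using (Maybe; just; nothing; is-just)
open import Data.Nat using (ℕ; zero; suc; _+_; _*_; _^_; _∸_; _⊔_; _≤_; _<_; _≟_)
open import Data.Product using (_×_; _,_; Σ-syntax; ∃-syntax)
open import Data.Rational using (ℚ; 0ℚ; 1ℚ)
import Data.Rational as ℚ
open import Data.Sum using (_⊎_)
import Data.Vec as Vec
open import Relation.Binary.PropositionalEquality using (_≡_; _≢_)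
open import Relation.Nullary using (does)
open import Relation.Nullary.Decidable using (_⊎-dec_)

-- A finite simple graph, presented by an edge list.  The edge e is the
-- unordered pair {src e , tgt e}: every notion below is invariant under
-- exchanging src e and tgt e.

record Graph : Set where
  field
    ∣V∣ ∣E∣ : ℕ

  V : Set
  V = Fin ∣V∣

  E : Set
  E = Fin ∣E∣

  field
    src tgt : E → V

  Joins : E → V → V → Set
  Joins e u v = (src e ≡ u × tgt e ≡ v) ⊎ (src e ≡ v × tgt e ≡ u)

  field
    loopless     : ∀ e → src e ≢ tgt e
    noMultiEdges : ∀ {e f u v} → Joins e u v → Joins f u v → e ≡ f

  Adj : V → V → Set
  Adj u v = ∃[ e ] Joins e u v

  Incident : E → V → Set
  Incident e v = src e ≡ v ⊎ tgt e ≡ v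

  degree : V → ℕ
  degree v = ∣ Vec.tabulate (λ e → does ((src e Fin.≟ v) ⊎-dec (tgt e Fin.≟ v))) ∣

  Δ : ℕ
  Δ = foldr _⊔_ 0 (map degree (allFin ∣V∣))

-- A graph is planar if it can be drawn in the plane with edges drawn as
-- simple polygonal arcs that meet only in common endpoints.  Rational
-- coordinates lose nothing: the corners of a polygonal drawing can be perturbed
-- to rational points, and if two segments with rational ends share a real
-- point other than some given rational points, they also share such a
-- rational point.

Point : Set
Point = ℚ × ℚ

ℕ→ℚ : ℕ → ℚ
ℕ→ℚ n = ℤ.+ n ℚ./ 1

InUnit : ℚ → Set
InUnit t = 0ℚ ℚ.≤ t × t ℚ.≤ 1ℚ

lerp : Point → Point → ℚ → Point
lerp (x , y) (x′ , y′) t =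
  (1ℚ ℚ.- t) ℚ.* x ℚ.+ t ℚ.* x′ , (1ℚ ℚ.- t) ℚ.* y ℚ.+ t ℚ.* y′

record PolygonalArc (a b : Point) : Set where
  field
    bends  : ℕ
    corner : Fin (suc (suc bends)) → Point
    starts : corner zero ≡ a
    ends   : corner (fromℕ (suc bends)) ≡ b

  at : Fin (suc bends) → ℚ → Point
  at i t = lerp (corner (inject₁ i)) (corner (suc i)) t

  -- Injectivity of the piecewise linear parametrisation by [0 , bends + 1].
  field
    simple : ∀ i j {s t} → InUnit s → InUnit t → at i s ≡ at j t →
             ℕ→ℚ (toℕ i) ℚ.+ s ≡ ℕ→ℚ (toℕ j) ℚ.+ t

  Through : Point → Set
  Through p = ∃[ i ] ∃[ t ] (InUnit t × at i t ≡ p)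

record Planar (G : Graph) : Set where
  open Graph G
  open PolygonalArc using (Through)
  field
    pos          : V → Point
    pos-distinct : ∀ {u v} → pos u ≡ pos v → u ≡ v
    arc          : ∀ e → PolygonalArc (pos (src e)) (pos (tgt e))
    avoids       : ∀ {e v} → Through (arc e) (pos v) → Incident e v
    nonCrossing  : ∀ {e f p} → e ≢ f → Through (arc e) p → Through (arc f) p →
                   ∃[ v ] (Incident e v × Incident f v × pos v ≡ p)

module _ (G : Graph) where
  open Graph G

  data Walk : V → V → ℕ → Set where
    stop : ∀ {v} → Walk v v 0
    step : ∀ {u v w ℓ} → Adj u v → Walk v w ℓ → Walk u w (suc ℓ)

  Minimum : (ℕ → Set) → ℕ → Set
  Minimum P d = P d × (∀ {d′} → P d′ → d ≤ d′)

  -- Distances are relations, so that an infinite distance (different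
  -- components) is one which is related to no number.
  VertexDistance : V → V → ℕ → Set
  VertexDistance u v = Minimum (Walk u v)

  EdgeDistance : E → E → ℕ → Set
  EdgeDistance e f = Minimum λ d →
    ∃[ u ] ∃[ v ] (Incident e u × Incident f v × VertexDistance u v d)

  Independent : ℕ → E → E → Set
  Independent k e f = ∀ {d} → EdgeDistance e f d → k < d

  PairwiseIndependent : ℕ → Subset ∣E∣ → Set
  PairwiseIndependent k W = ∀ {e f} → e ∈ W → f ∈ W → e ≢ f → Independent k e f

  record ButterflyB1 (x y : V) : Set where
    field
      z v₁ v₂ v₃ : V
      distinct   : Unique (x ∷ y ∷ z ∷ v₁ ∷ v₂ ∷ v₃ ∷ [])
      xy         : Adj x y
      xz         : Adj x z
      yv₁        : Adj y v₁
      yv₃        : Adj y v₃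
      zv₁        : Adj z v₁
      zv₂        : Adj z v₂
      xv₁        : Adj x v₁
      xv₂        : Adj x v₂
      xv₃        : Adj x v₃
      deg-y      : degree y ≡ 3
      deg-z      : degree z ≡ 3
      deg-x      : degree x ≡ 8
      deg-v₁     : degree v₁ ≡ 8
      deg-v₂     : degree v₂ ≡ 8
      deg-v₃     : degree v₃ ≡ 8

  record ButterflyB2 (x y : V) : Set where
    field
      z v₁ v₂ v₃ v₄ : V
      distinct      : Unique (x ∷ y ∷ z ∷ v₁ ∷ v₂ ∷ v₃ ∷ v₄ ∷ [])
      xy            : Adj x y
      xz            : Adj x z
      yv₁           : Adj y v₁
      yv₄           : Adj y v₄
      zv₂           : Adj z v₂
      zv₃           : Adj z v₃
      xv₁           : Adj x v₁
      xv₂           : Adj x v₂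
      xv₃           : Adj x v₃
      xv₄           : Adj x v₄
      deg-y         : degree y ≡ 3
      deg-z         : degree z ≡ 3
      deg-x         : degree x ≡ 8
      deg-v₁        : degree v₁ ≡ 8
      deg-v₂        : degree v₂ ≡ 8
      deg-v₃        : degree v₃ ≡ 8
      deg-v₄        : degree v₄ ≡ 8

  ButterflyLike : E → Set
  ButterflyLike e = ∃[ x ] ∃[ y ] (Joins e x y × (ButterflyB1 x y ⊎ ButterflyB2 x y))

record PartialColoring (G : Graph) (k : ℕ) : Set where
  open Graph G
  field
    color  : E → Maybe (Fin k)
    proper : ∀ {e f v a b} → e ≢ f → Incident e v → Incident f v →
             color e ≡ just a → color f ≡ just b → a ≢ b

  colored : Subset ∣E∣
  colored = Vec.tabulate (λ e → is-just (color e))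

-- The machine model: a word RAM with registers and a memory, both initially
-- zero apart from the input, programmed in a structured language.

infixl 6 _⊕_ _⊖_
infix  4 _≔_
infixr 3 _⨾_

data Expr : Set where
  lit     : ℕ → Expr
  reg     : ℕ → Expr
  load    : Expr → Expr
  _⊕_ _⊖_ : Expr → Expr → Expr

data Program : Set where
  skip         : Program
  _≔_          : ℕ → Expr → Program
  store        : Expr → Expr → Program
  _⨾_          : Program → Program → Program
  ifNonzero    : Expr → Program → Program → Program
  whileNonzero : Expr → Program → Program

record State : Set where
  constructor state
  field
    regs mem : ℕ → ℕ

open State public

eval : State → Expr → ℕ
eval s (lit n)  = n
eval s (reg r)  = regs s r
eval s (load a) = mem s (eval s a)
eval s (a ⊕ b)  = eval s a + eval s b
eval s (a ⊖ b)  = eval s a ∸ eval s b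

update : (ℕ → ℕ) → ℕ → ℕ → ℕ → ℕ
update f a n b = if does (a ≟ b) then n else f b

-- Run w p s s′ t: started in s, the program p halts in s′ after t steps, and
-- every address and value it writes is at most w.  A fixed program contains
-- finitely many expressions, each of fixed size, so evaluating one is charged
-- as a single step, and if all words in s are at most w, its value and
-- intermediate results are at most a constant multiple of w + 1.

data Run (w : ℕ) : Program → State → State → ℕ → Set where
  skip   : ∀ {s} → Run w skip s s 1
  assign : ∀ {s r a} → eval s a ≤ w →
           Run w (r ≔ a) s (state (update (regs s) r (eval s a)) (mem s)) 1
  store  : ∀ {s a b} → eval s a ≤ w → eval s b ≤ w →
           Run w (store a b) s (state (regs s) (update (mem s) (eval s a) (eval s b))) 1
  seq    : ∀ {p q s s′ s″ t u} → Run w p s s′ t → Run w q s′ s″ u →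
           Run w (p ⨾ q) s s″ (t + u)
  then′  : ∀ {a p q s s′ t} → eval s a ≢ 0 → Run w p s s′ t →
           Run w (ifNonzero a p q) s s′ (suc t)
  else′  : ∀ {a p q s s′ t} → eval s a ≡ 0 → Run w q s s′ t →
           Run w (ifNonzero a p q) s s′ (suc t)
  exit   : ∀ {a p s} → eval s a ≡ 0 → Run w (whileNonzero a p) s s 1
  loop   : ∀ {a p s s′ s″ t u} → eval s a ≢ 0 → Run w p s s′ t →
           Run w (whileNonzero a p) s′ s″ u →
           Run w (whileNonzero a p) s s″ (suc (t + u))

code : ∀ {k} → Maybe (Fin k) → ℕ
code nothing  = 0
code (just a) = suc (toℕ a)

cells : List ℕ → ℕ → ℕ
cells []       _       = 0
cells (n ∷ ns) zero    = n
cells (n ∷ ns) (suc a) = cells ns a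

-- The input is |V|, |E|, and then, for each edge in turn, its two ends, its
-- membership in W and its color.

encode : (G : Graph) → Subset (Graph.∣E∣ G) → ∀ {k} → PartialColoring G k → List ℕ
encode G W π = ∣V∣ ∷ ∣E∣ ∷ concatMap entry (allFin ∣E∣)
  where
  open Graph G
  open PartialColoring π
  entry : E → List ℕ
  entry e = toℕ (src e) ∷ toℕ (tgt e) ∷ (if Vec.lookup W e then 1 else 0) ∷ code (color e) ∷ []

initial : List ℕ → State
initial ns = state (λ _ → 0) (cells ns)

-- From the input (G , W , π), p produces the output σ, stored in the memory
-- cells 0, …, |E| - 1, in at most C (|V| + 1) steps and using words of
-- O(log |V|) bits.  (The "+ 1" and "2 +" matter only for tiny graphs.)

Finds : (p : Program) (C D : ℕ) (G : Graph) (W : Subset (Graph.∣E∣ G)) →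
        ∀ {k} → PartialColoring G k → PartialColoring G k → Set
Finds p C D G W π σ =
  Σ[ t ∈ ℕ ] Σ[ s ∈ State ]
    ( Run ((2 + ∣V∣) ^ D) p (initial (encode G W π)) s t
    × t ≤ C * suc ∣V∣
    × (∀ e → mem s (toℕ e) ≡ code (PartialColoring.color σ e)) )
  where open Graph G

{-# OPTIONS --safe #-}

-- Let xy be an uncoloured butterfly-like edge, a the colour missing at x, z the
-- other neighbour of x of degree 3, and s a common neighbour of x and z.  If no
-- colour is missing at both x and y, then there is a colour b, read off from the
-- colours at y and z and of xz, xs and zs, such that x, y and z are ends of chains
-- in the colours a and b.  At least one of y and z is not on the chain of x.
-- Exchanging a and b on the chain of such a y makes a missing at x and y, and xy
-- can be coloured; exchanging them on the chain of such a z brings the colours at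
-- z nearer to a position in which x and z are on the same chain for the next b.
-- Such a position is reached after at most four exchanges at z, so five stages
-- colour xy.
--
-- In a stage the pair (a , b) that most edges ask for is treated, and requests
-- for it are granted greedily.  As a chain has only two ends, this keeps a
-- constant fraction of the edges.  Chains are never traversed: their ends are
-- found by inserting the edges of colours a and b one at a time, and the chains
-- to be exchanged are marked by undoing the insertions, so that the whole
-- program consists of loops over V or E whose bodies have constant length.

module Submission where

open import Defs
open import Data.Bool using (Bool; true; false; if_then_else_; T; T?; _∨_; not)
open import Data.Empty using (⊥; ⊥-elim)
open import Data.Fin using (Fin; toℕ; fromℕ<)
open import Data.Fin.Patterns using (0F; 1F; 2F; 3F)
import Data.Fin as Fin
import Data.Fin.Properties as Fin
open import Data.List using (List; []; _∷_; _++_)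
open import Data.List.Membership.Propositional using () renaming (_∈_ to _∈ₗ_)
open import Data.List.Relation.Unary.Any using (here; there)
open import Data.Maybe using (Maybe; just; nothing; is-just)
open import Data.Nat using (ℕ; zero; suc; _+_; _*_; _∸_; _^_; _≤_; _<_; _≟_; _≤?_; _<?_; z≤n; s≤s; _≡ᵇ_; _<ᵇ_; _⊔_)
open import Data.Nat.Properties
open import Data.Product using (_×_; _,_; proj₁; proj₂; Σ-syntax; ∃-syntax)
open import Data.Sum using (_⊎_; inj₁; inj₂)
open import Data.Unit using (⊤; tt)
open import Function using (_∘_; id; case_of_)
open import Relation.Binary.PropositionalEquality using (_≡_; _≢_; refl; sym; trans; cong; cong₂; subst; subst₂; module ≡-Reasoning)
open import Relation.Nullary using (¬_; Dec; yes; no; does)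
open import Relation.Nullary.Decidable using (_⊎-dec_; dec-true)
open import Data.Nat.Induction using (<-rec)
open import Data.Fin.Subset using (Subset; _∈_; _⊆_; _∪_; ∁; ∣_∣)
import Data.Integer as ℤ
import Data.Integer.Properties as ℤ
import Data.List as List
open import Data.List.Relation.Unary.All using (_∷_)
open import Data.List.Relation.Unary.AllPairs using (_∷_)
open import Data.Rational using (ℚ; 0ℚ) renaming (_<_ to _<ℚ_; _≤_ to _≤ℚ_; _*_ to _*ℚ_)
import Data.Rational as ℚ
import Data.Rational.Properties as ℚ
import Data.Rational.Unnormalised as ℚᵘ
import Data.Rational.Unnormalised.Properties as ℚᵘ
import Data.Vec as Vec
import Data.Vec.Properties as Vec
open Graph using (∣E∣; Δ)
open PartialColoring using (colored)

-- A language of array programs and its compilation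

-- The fate of an uncoloured edge depends only on the colours at x, y and z. Exchanging any set of
-- (a , b)-chains acts at each vertex as a whole: either nothing happens there, or a and b trade
-- places. This is why a stage is confined to one pair: its chains are disjoint and can be exchanged
-- all at once, while chains of different pairs may share edges.
--
-- In the good positions the chain of x is known without looking further: it is the edge xz, for b
-- the colour of xz, or the path x s z, for b the colour of xs. The first is out of reach when the
-- colour of xz occurs at y, for then y, which has a as well, is inside its chain. In that case zs
-- has to get the colour a and z has to lack the colour of xs, which the longer sequences of
-- exchanges at z arrange.
--
-- An edge of W that is passed over in a stage stays uncoloured for good. What is estimated is
-- therefore the number of solved and active edges together, which shrinks by at most a constant
-- factor per stage.

data Arr : Set where
  Src Tgt InW Col Act Deg Edg Nbr Vx Vy Vz Exz Exs Ezs Miss Want : Arr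
  Cnt Best BestA BestB Pair F1 F2 Far Mate Lock Bit : Arr

slot : Arr → ℕ
slot Src = 0
slot Tgt = 1
slot InW = 2
slot Col = 3
slot Act = 4
slot Deg = 5
slot Edg = 6
slot Nbr = 7
slot Vx = 8
slot Vy = 9
slot Vz = 10
slot Exz = 11
slot Exs = 12
slot Ezs = 13
slot Miss = 14
slot Want = 15
slot Cnt = 16
slot Best = 17
slot BestA = 18
slot BestB = 19
slot Pair = 20
slot F1 = 21
slot F2 = 22
slot Far = 23
slot Mate = 24
slot Lock = 25
slot Bit = 26

abstract
  -- Abstract, so that `scale slots` and products with it stay folded; outside this block it is
  -- known only through `slot<`.
  slots : ℕ
  slots = 27

  slot< : ∀ k → slot k < slots
  slot< k = <ᵇ⇒< (slot k) slots (go k)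
    where
    go : ∀ k → T (slot k <ᵇ slots)
    go Src = tt
    go Tgt = tt
    go InW = tt
    go Col = tt
    go Act = tt
    go Deg = tt
    go Edg = tt
    go Nbr = tt
    go Vx = tt
    go Vy = tt
    go Vz = tt
    go Exz = tt
    go Exs = tt
    go Ezs = tt
    go Miss = tt
    go Want = tt
    go Cnt = tt
    go Best = tt
    go BestA = tt
    go BestB = tt
    go Pair = tt
    go F1 = tt
    go F2 = tt
    go Far = tt
    go Mate = tt
    go Lock = tt
    go Bit = tt

infixl 6 _⊞_ _⊟_
infix  8 _⟨_⟩ _⟨_⟩+_ _⟨_⟩-1
infixr 4 _⟪_∣_⟫
infix  3 _[_]≔_
infixr 2 _▷_

-- A loop body is a list of assignments to array cells, each of a value
-- computed by a decision tree; a tree tests whether an expression is zero, and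
-- its first branch is the nonzero one.  Since the leaves only copy words or
-- change them by constants, the size of the words grows at most linearly with the running time.

data Ex : Set where
  ix ∣E∣ₓ : Ex
  con     : ℕ → Ex
  _⟨_⟩    : Arr → Ex → Ex
  _⊞_ _⊟_ : Ex → Ex → Ex

data Tree : Set where
  num     : ℕ → Tree
  index+  : ℕ → Tree
  _⟨_⟩+_  : Arr → Ex → ℕ → Tree
  _⟨_⟩-1  : Arr → Ex → Tree
  input   : Fin 4 → Tree
  _⟪_∣_⟫  : Ex → Tree → Tree → Tree

data Assign : Set where
  _[_]≔_ : Arr → Ex → Tree → Assign

Body : Set
Body = List Assign

data Phase : Set where
  eachV eachE : Body → Phase
  _▷_         : Phase → Phase → Phase

St : Set
St = Arr → ℕ → ℕ

-- Arrays are compared through their slots, so for two named arrays the test computes. A cell read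
-- after a list of assignments then reduces to nested `upd`s on that array alone; the loop
-- specifications rely on this reduction.
put : Arr → ℕ → ℕ → St → St
put k j v st k′ j′ = if slot k ≡ᵇ slot k′ then (if j ≡ᵇ j′ then v else st k′ j′) else st k′ j′

branch : ∀ {A : Set} → ℕ → A → A → A
branch zero    a b = b
branch (suc _) a b = a

module Meaning (n m : ℕ) (inp : ℕ → ℕ) where

  ev : ℕ → St → Ex → ℕ
  ev i st ix        = i
  ev i st ∣E∣ₓ      = m
  ev i st (con c)   = c
  ev i st (k ⟨ e ⟩) = st k (ev i st e)
  ev i st (e ⊞ f)   = ev i st e + ev i st f
  ev i st (e ⊟ f)   = ev i st e ∸ ev i st f

  evT : ℕ → St → Tree → ℕ
  evT i st (num c)         = c
  evT i st (index+ c)      = c + i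
  evT i st (k ⟨ e ⟩+ c)    = c + st k (ev i st e)
  evT i st (k ⟨ e ⟩-1)     = st k (ev i st e) ∸ 1
  evT i st (input j)       = inp (2 + 4 * i + toℕ j)
  evT i st (e ⟪ t ∣ u ⟫)   = branch (ev i st e) (evT i st t) (evT i st u)

  exec₁ : ℕ → Assign → St → St
  exec₁ i (k [ e ]≔ t) st = put k (ev i st e) (evT i st t) st

  exec : ℕ → Body → St → St
  exec i []      st = st
  exec i (s ∷ b) st = exec i b (exec₁ i s st)

  iter : ℕ → Body → St → St
  iter zero    b st = st
  iter (suc i) b st = exec i b (iter i b st)

  run : Phase → St → St
  run (eachV b) = iter n b
  run (eachE b) = iter m b
  run (p ▷ q)   = run q ∘ run p

scale : ℕ → Expr → Expr
scale zero    e = lit 0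
scale (suc k) e = e ⊕ scale k e

-- Registers: 0 the loop index, 1 the number of vertices, 2 the number of edges,
-- 3 the first address beyond the input, where the arrays are interleaved.

⌜_⌝  : Ex → Expr
cell : Arr → Ex → Expr
⌜ ix ⌝      = reg 0
⌜ ∣E∣ₓ ⌝    = reg 2
⌜ con c ⌝   = lit c
⌜ k ⟨ e ⟩ ⌝ = load (cell k e)
⌜ e ⊞ f ⌝   = ⌜ e ⌝ ⊕ ⌜ f ⌝
⌜ e ⊟ f ⌝   = ⌜ e ⌝ ⊖ ⌜ f ⌝
cell k e = reg 3 ⊕ (scale slots ⌜ e ⌝ ⊕ lit (slot k))

compileT : Expr → Tree → Program
compileT a (num c)         = store a (lit c)
compileT a (index+ c)      = store a (lit c ⊕ reg 0)
compileT a (k ⟨ e ⟩+ c)    = store a (lit c ⊕ load (cell k e))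
compileT a (k ⟨ e ⟩-1)     = store a (load (cell k e) ⊖ lit 1)
compileT a (input j)       = store a (load (lit 2 ⊕ scale 4 (reg 0) ⊕ lit (toℕ j)))
compileT a (e ⟪ t ∣ u ⟫)   = ifNonzero ⌜ e ⌝ (compileT a t) (compileT a u)

compileB : Body → Program
compileB []                = skip
compileB ((k [ e ]≔ t) ∷ b) = compileT (cell k e) t ⨾ compileB b

forEach : ℕ → Program → Program
forEach r p = (0 ≔ lit 0) ⨾ whileNonzero (reg r ⊖ reg 0) (p ⨾ (0 ≔ lit 1 ⊕ reg 0))

compile : Phase → Program
compile (eachV b) = forEach 1 (compileB b)
compile (eachE b) = forEach 2 (compileB b)
compile (p ▷ q)   = compile p ⨾ compile q

setup output : Program
setup  = (1 ≔ load (lit 0)) ⨾ (2 ≔ load (lit 1)) ⨾ (3 ≔ lit 6 ⊕ scale 4 (reg 1 ⊕ reg 2))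
output = forEach 2 (store (reg 0) (load (cell Col ix)))

whole : Phase → Program
whole p = setup ⨾ compile p ⨾ output

-- A test is charged for both of its branches, so that sums replace maxima in all estimates.
costT growT : Tree → ℕ
costT (e ⟪ t ∣ u ⟫) = suc (costT t + costT u)
costT _             = 1
growT (num c)       = c
growT (index+ c)    = c
growT (k ⟨ e ⟩+ c)  = c
growT (k ⟨ e ⟩-1)   = 0
growT (input j)     = 0
growT (e ⟪ t ∣ u ⟫) = growT t + growT u

-- A factor by which the value can exceed the largest word. A load has size 1 however large its
-- address, because its value is itself a word.
sizeEx : Ex → ℕ
sizeEx (con c) = c
sizeEx (e ⊞ f) = sizeEx e + sizeEx f
sizeEx (e ⊟ f) = sizeEx e
sizeEx _       = 1

costB growB sizeB : Body → ℕ
costB []                 = 1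
costB ((k [ e ]≔ t) ∷ b) = costT t + costB b
growB []                 = 0
growB ((k [ e ]≔ t) ∷ b) = growT t + growB b
sizeB []                 = 0
sizeB ((k [ e ]≔ t) ∷ b) = sizeEx e + sizeB b

costP growP sizeP : Phase → ℕ
costP (eachV b) = 4 + costB b
costP (eachE b) = 4 + costB b
costP (p ▷ q)   = costP p + costP q
growP (eachV b) = growB b
growP (eachE b) = growB b
growP (p ▷ q)   = growP p + growP q
sizeP (eachV b) = sizeB b
sizeP (eachE b) = sizeB b
sizeP (p ▷ q)   = sizeP p + sizeP q

-- Correctness, running time and word size of compiled programs

*+-injective : ∀ K {v v′ c c′} → c < K → c′ < K → K * v + c ≡ K * v′ + c′ → v ≡ v′ × c ≡ c′
*+-injective K {zero} {zero} p q eq rewrite *-zeroʳ K = refl , eq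
*+-injective K {zero} {suc v′} {c} {c′} p q eq = ⊥-elim (<⇒≱ p (≤-trans (≤-trans (m≤m*n K (suc v′)) (m≤m+n _ c′))
  (≤-reflexive (trans (sym eq) (cong (_+ c) (*-zeroʳ K))))))
*+-injective K {suc v} {zero} {c} {c′} p q eq = ⊥-elim (<⇒≱ q (≤-trans (≤-trans (m≤m*n K (suc v)) (m≤m+n _ c))
  (≤-reflexive (trans eq (cong (_+ c′) (*-zeroʳ K))))))
*+-injective K {suc v} {suc v′} {c} {c′} p q eq
  with *+-injective K {v} {v′} p q (+-cancelˡ-≡ K _ _ (trans (lemma v c) (trans eq (sym (lemma v′ c′)))))
  where
  lemma : ∀ v c → K + (K * v + c) ≡ K * suc v + c
  lemma v c = trans (sym (+-assoc K _ c)) (cong (_+ c) (sym (*-suc K v)))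
... | refl , refl = refl , refl

module Simulation (n m : ℕ) (inp : ℕ → ℕ) where
  open Meaning n m inp

  abstract
    -- The input has 2 + 4 * m cells. The larger offset also covers loops over vertices: an `input`
    -- leaf reads at 2 + 4 * i + j, and of the index i only i < n + m is known.
    base : ℕ
    base = 6 + 4 * (n + m)

    base-def : base ≡ 6 + 4 * (n + m)
    base-def = refl

  record Sim (i : ℕ) (s : State) (st : St) : Set where
    field
      r0   : regs s 0 ≡ i
      r1   : regs s 1 ≡ n
      r2   : regs s 2 ≡ m
      r3   : regs s 3 ≡ base
      -- The input stays intact until the output loop, so an `input` leaf may be read at any time.
      low  : ∀ {a} → a < base → mem s a ≡ inp a
      high : ∀ k j → mem s (base + (slots * j + slot k)) ≡ st k j
  open Sim

  Bounded : ℕ → St → Set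
  Bounded M st = ∀ k j → st k j ≤ M

  eval-scale : ∀ K s e → eval s (scale K e) ≡ K * eval s e
  eval-scale zero    s e = refl
  eval-scale (suc K) s e = cong (eval s e +_) (eval-scale K s e)

  module _ {i : ℕ} {s : State} {st : St} (sim : Sim i s st) where
    eval-ev   : ∀ e → eval s ⌜ e ⌝ ≡ ev i st e
    eval-cell : ∀ k e → eval s (cell k e) ≡ base + (slots * ev i st e + slot k)
    eval-ev ix        = r0 sim
    eval-ev ∣E∣ₓ      = r2 sim
    eval-ev (con c)   = refl
    eval-ev (k ⟨ e ⟩) = trans (cong (mem s) (eval-cell k e)) (high sim k _)
    eval-ev (e ⊞ f)   = cong₂ _+_ (eval-ev e) (eval-ev f)
    eval-ev (e ⊟ f)   = cong₂ _∸_ (eval-ev e) (eval-ev f)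
    eval-cell k e = cong₂ _+_ (r3 sim)
      (cong (_+ slot k) (trans (eval-scale slots s ⌜ e ⌝) (cong (slots *_) (eval-ev e))))

  module _ {M i : ℕ} {st : St} (1≤M : 1 ≤ M) (i≤M : i ≤ M) (m≤M : m ≤ M) (bd : Bounded M st) where
    private
      one : ∀ {x} → x ≤ M → x ≤ 1 * M
      one p = ≤-trans p (≤-reflexive (sym (*-identityˡ M)))
    ev≤ : ∀ e → ev i st e ≤ sizeEx e * M
    ev≤ ix        = one i≤M
    ev≤ ∣E∣ₓ      = one m≤M
    ev≤ (con c)   = ≤-trans (≤-reflexive (sym (*-identityʳ c))) (*-monoʳ-≤ c 1≤M)
    ev≤ (k ⟨ e ⟩) = one (bd k _)
    ev≤ (e ⊞ f)   = ≤-trans (+-mono-≤ (ev≤ e) (ev≤ f)) (≤-reflexive (sym (*-distribʳ-+ M (sizeEx e) (sizeEx f))))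
    ev≤ (e ⊟ f)   = ≤-trans (m∸n≤m _ (ev i st f)) (ev≤ e)

    -- A leaf copies a word or changes it by a constant, so stored words grow additively. The
    -- multiples of M in `ev≤` occur only in addresses and tests and do not accumulate.
    evT≤ : (∀ a → inp a ≤ M) → ∀ t → evT i st t ≤ M + growT t
    evT≤ ib (num c)       = m≤n+m c M
    evT≤ ib (index+ c)    = ≤-trans (+-monoʳ-≤ c i≤M) (≤-reflexive (+-comm c M))
    evT≤ ib (k ⟨ e ⟩+ c)  = ≤-trans (+-monoʳ-≤ c (bd k _)) (≤-reflexive (+-comm c M))
    evT≤ ib (k ⟨ e ⟩-1)     = ≤-trans (m∸n≤m _ 1) (≤-trans (bd k _) (m≤m+n M 0))
    evT≤ ib (input j)     = ≤-trans (ib _) (m≤m+n M 0)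
    evT≤ ib (e ⟪ t ∣ u ⟫) with ev i st e
    ... | zero  = ≤-trans (evT≤ ib u) (+-monoʳ-≤ M (m≤n+m (growT u) (growT t)))
    ... | suc _ = ≤-trans (evT≤ ib t) (+-monoʳ-≤ M (m≤m+n (growT t) (growT u)))

  module Running (w M₀ : ℕ) (1≤M₀ : 1 ≤ M₀) (n≤M₀ : n ≤ M₀) (m≤M₀ : m ≤ M₀) (inp≤ : ∀ a → inp a ≤ M₀) where

    put-same : ∀ {a b v} (f : ℕ → ℕ) → a ≡ b → update f a v b ≡ v
    put-same {a} {b} f e with a ≡ᵇ b in eq
    ... | true  = refl
    ... | false = ⊥-elim (subst T eq (≡⇒≡ᵇ a b e))

    put-other : ∀ {a b v} (f : ℕ → ℕ) → a ≢ b → update f a v b ≡ f b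
    put-other {a} {b} f ne with a ≡ᵇ b in eq
    ... | true  = ⊥-elim (ne (≡ᵇ⇒≡ a b (subst T (sym eq) tt)))
    ... | false = refl

    sim-put : ∀ {i s st} (k : Arr) (j v : ℕ) → Sim i s st →
              Sim i (state (regs s) (update (mem s) (base + (slots * j + slot k)) v)) (put k j v st)
    sim-put {i} {s} {st} k j v sim = record
      { r0 = r0 sim ; r1 = r1 sim ; r2 = r2 sim ; r3 = r3 sim
      ; low = λ {a} lt → trans (put-other (mem s) (λ e → <⇒≱ lt (≤-trans (m≤m+n base _) (≤-reflexive e)))) (low sim lt)
      ; high = hi }
      where
      a₀ = base + (slots * j + slot k)
      hi : ∀ k′ j′ → update (mem s) a₀ v (base + (slots * j′ + slot k′)) ≡ put k j v st k′ j′
      hi k′ j′ with slot k ≡ᵇ slot k′ in eq | j ≡ᵇ j′ in eq′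
      ... | true | true = put-same {a₀} (mem s) (cong₂ (λ p q → base + (slots * p + q)) (≡ᵇ⇒≡ j j′ (subst T (sym eq′) tt)) (≡ᵇ⇒≡ _ _ (subst T (sym eq) tt)))
      ... | true | false = trans (put-other {a₀} (mem s) λ e → subst T eq′ (≡⇒≡ᵇ _ _ (proj₁ (*+-injective slots {j} {j′} (slot< k) (slot< k′) (+-cancelˡ-≡ base _ _ e))))) (high sim k′ j′)
      ... | false | _ = trans (put-other {a₀} (mem s) λ e → subst T eq (≡⇒≡ᵇ _ _ (proj₂ (*+-injective slots {j} {j′} (slot< k) (slot< k′) (+-cancelˡ-≡ base _ _ e))))) (high sim k′ j′)

    Reaches : Program → ℕ → ℕ → State → St → Set
    Reaches p i c s st = Σ[ s′ ∈ State ] Σ[ t ∈ ℕ ] (Run w p s s′ t × Sim i s′ st × t ≤ c)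

    storeTree : ∀ {i s st} (k : Arr) (e : Ex) (t : Tree) → i < n + m → Sim i s st →
                base + (slots * ev i st e + slot k) ≤ w → evT i st t ≤ w →
                Reaches (compileT (cell k e) t) i (costT t) s (put k (ev i st e) (evT i st t) st)
    storeTree {i} {s} {st} k e t i< sim aw vw = go t vw
      where
      leaf : ∀ {x v} → eval s x ≡ v → v ≤ w →
             Reaches (store (cell k e) x) i 1 s (put k (ev i st e) v st)
      leaf {x} {v} eq le = _ , 1 , store (≤-trans (≤-reflexive (eval-cell sim k e)) aw) (≤-trans (≤-reflexive eq) le)
        , subst₂ (λ p q → Sim i (state (regs s) (update (mem s) p q)) (put k (ev i st e) v st)) (sym (eval-cell sim k e)) (sym eq) (sim-put k (ev i st e) v sim)
        , ≤-refl
      inp< : (j : Fin 4) → 2 + 4 * i + toℕ j < base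
      inp< j = ≤-trans (+-mono-≤ (+-monoʳ-≤ 3 (*-monoʳ-≤ 4 (<⇒≤ i<))) (≤-pred (Fin.toℕ<n j)))
        (≤-reflexive (trans (+-comm (3 + 4 * (n + m)) 3) (sym base-def)))
      go : ∀ t → evT i st t ≤ w → Reaches (compileT (cell k e) t) i (costT t) s (put k (ev i st e) (evT i st t) st)
      go (num c) le = leaf refl le
      go (index+ c) le = leaf (cong (c +_) (r0 sim)) le
      go (k′ ⟨ e′ ⟩+ c) le = leaf (cong (c +_) (eval-ev sim (k′ ⟨ e′ ⟩))) le
      go (k′ ⟨ e′ ⟩-1) le = leaf (cong (_∸ 1) (eval-ev sim (k′ ⟨ e′ ⟩))) le
      go (input j) le = leaf (trans (cong (λ x → mem s (2 + x + toℕ j)) (trans (eval-scale 4 s (reg 0)) (cong (4 *_) (r0 sim)))) (low sim (inp< j))) le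
      go (e′ ⟪ t ∣ u ⟫) le with ev i st e′ in eq
      ... | zero with go u le
      ...   | s′ , τ , r , sim′ , q = s′ , suc τ , else′ (trans (eval-ev sim e′) eq) r , sim′ , s≤s (≤-trans q (m≤n+m _ (costT t)))
      go (e′ ⟪ t ∣ u ⟫) le | suc x with go t le
      ...   | s′ , τ , r , sim′ , q = s′ , suc τ , then′ (λ z → 1+n≢0 (trans (sym eq) (trans (sym (eval-ev sim e′)) z))) r , sim′ , s≤s (≤-trans q (m≤m+n _ (costT u)))

    abstract
      -- A bound on addresses in units of M: 14 for `base`, which is 6 + 4 * (n + m), then
      -- `slots * k` for an index of size k, and `slots` for the slot.
      need : ℕ → ℕ
      need k = 14 + slots * k + slots

      need-def : ∀ k → need k ≡ 14 + slots * k + slots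
      need-def k = refl

      need-pos : ∀ k → 1 ≤ need k
      need-pos k = s≤s z≤n

      need-mono : ∀ {a b} → a ≤ b → need a ≤ need b
      need-mono ab = +-monoˡ-≤ slots (+-monoʳ-≤ 14 (*-monoʳ-≤ slots ab))

    1≤⇒≤* : ∀ {k} → 1 ≤ k → ∀ x → x ≤ k * x
    1≤⇒≤* p x = ≤-trans (≤-reflexive (sym (*-identityˡ x))) (*-monoˡ-≤ x p)

    address≤ : ∀ {M k x} → M₀ ≤ M → x ≤ k * M → ∀ a → base + (slots * x + slot a) ≤ need k * M
    address≤ {M} {k} {x} M₀≤ x≤ a = begin
      base + (slots * x + slot a)
        ≤⟨ +-mono-≤ base≤ (+-mono-≤ (*-monoʳ-≤ slots x≤) (≤-trans (<⇒≤ (slot< a)) (six slots))) ⟩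
      14 * M + (slots * (k * M) + slots * M)
        ≡⟨ cong (λ z → 14 * M + (z + slots * M)) (*-assoc slots k M) ⟨
      14 * M + (slots * k * M + slots * M)
        ≡⟨ +-assoc (14 * M) _ _ ⟨
      14 * M + slots * k * M + slots * M
        ≡⟨ cong (_+ slots * M) (*-distribʳ-+ M 14 (slots * k)) ⟨
      (14 + slots * k) * M + slots * M
        ≡⟨ *-distribʳ-+ M (14 + slots * k) slots ⟨
      (14 + slots * k + slots) * M
        ≡⟨ cong (_* M) (need-def k) ⟨
      need k * M ∎
      where
      open ≤-Reasoning
      six : ∀ c → c ≤ c * M
      six c = ≤-trans (≤-reflexive (sym (*-identityʳ c))) (*-monoʳ-≤ c (≤-trans 1≤M₀ M₀≤))
      base≤ : base ≤ 14 * M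
      base≤ = ≤-trans (≤-reflexive base-def) (≤-trans (+-mono-≤ (six 6) (*-monoʳ-≤ 4 (+-mono-≤ (≤-trans n≤M₀ M₀≤) (≤-trans m≤M₀ M₀≤))))
        (≤-reflexive (trans (cong (6 * M +_) (trans (*-distribˡ-+ 4 M M) (sym (*-distribʳ-+ M 4 4)))) (sym (*-distribʳ-+ M 6 8)))))

    grow-mono : ∀ {M} {st : St} {k j v} → Bounded M st → v ≤ M → Bounded M (put k j v st)
    grow-mono {k = k} {j} bd v≤ k′ j′ with slot k ≡ᵇ slot k′ | j ≡ᵇ j′
    ... | true  | true  = v≤
    ... | true  | false = bd k′ j′
    ... | false | _     = bd k′ j′

    runBody : ∀ {i s st} M b → M₀ ≤ M → i < n + m → i ≤ M₀ → Sim i s st → Bounded M st →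
              need (sizeB b) * (M + growB b) ≤ w →
              Reaches (compileB b) i (costB b) s (exec i b st) × Bounded (M + growB b) (exec i b st)
    runBody M [] M₀≤ i< i≤ sim bd le = (_ , 1 , skip , sim , ≤-refl) , λ k j → ≤-trans (bd k j) (m≤m+n M 0)
    runBody {i} {s} {st} M ((k [ e ]≔ t) ∷ b) M₀≤ i< i≤ sim bd le =
      andThen (storeTree k e t i< sim
             (≤-trans (address≤ {M} {sizeEx e} M₀≤ (ev≤ (≤-trans 1≤M₀ M₀≤) (≤-trans i≤ M₀≤) (≤-trans m≤M₀ M₀≤) bd e) k)
               (≤-trans (*-mono-≤ (need-mono (m≤m+n (sizeEx e) (sizeB b))) (m≤m+n M _)) le))
             (≤-trans v≤ (≤-trans small le)))
      where
      v≤ : evT i st t ≤ M + growT t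
      v≤ = evT≤ (≤-trans 1≤M₀ M₀≤) (≤-trans i≤ M₀≤) (≤-trans m≤M₀ M₀≤) bd (λ a → ≤-trans (inp≤ a) M₀≤) t
      small : M + growT t ≤ need (sizeEx e + sizeB b) * (M + (growT t + growB b))
      small = ≤-trans (+-monoʳ-≤ M (m≤m+n _ (growB b))) (1≤⇒≤* (need-pos (sizeEx e + sizeB b)) _)
      andThen : Reaches (compileT (cell k e) t) i (costT t) s (put k (ev i st e) (evT i st t) st) →
                Reaches (compileB ((k [ e ]≔ t) ∷ b)) i (costB ((k [ e ]≔ t) ∷ b)) s (exec i ((k [ e ]≔ t) ∷ b) st)
                × Bounded (M + growB ((k [ e ]≔ t) ∷ b)) (exec i ((k [ e ]≔ t) ∷ b) st)
      andThen (s′ , τ , r , sim′ , q) = finish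
        (runBody (M + growT t) b (≤-trans M₀≤ (m≤m+n M _)) i< i≤ sim′
             (grow-mono {k = k} {ev i st e} (λ k′ j → ≤-trans (bd k′ j) (m≤m+n M _)) v≤)
             (≤-trans (*-mono-≤ (need-mono (m≤n+m (sizeB b) (sizeEx e))) (≤-reflexive (+-assoc M _ _))) le))
        where
        finish : Reaches (compileB b) i (costB b) s′ (exec i ((k [ e ]≔ t) ∷ b) st) × Bounded (M + growT t + growB b) (exec i ((k [ e ]≔ t) ∷ b) st) →
                 Reaches (compileB ((k [ e ]≔ t) ∷ b)) i (costB ((k [ e ]≔ t) ∷ b)) s (exec i ((k [ e ]≔ t) ∷ b) st)
                 × Bounded (M + growB ((k [ e ]≔ t) ∷ b)) (exec i ((k [ e ]≔ t) ∷ b) st)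
        finish ((s″ , τ′ , r′ , sim″ , q′) , bd′) =
          (s″ , τ + τ′ , seq r r′ , sim″ , +-mono-≤ q q′) , λ k′ j → ≤-trans (bd′ k′ j) (≤-reflexive (+-assoc M _ _))

    setIndex : ∀ {i s st} v a → eval s a ≡ v → v ≤ w → Sim i s st → Reaches (0 ≔ a) v 1 s st
    setIndex {s = s} v a refl v≤ sim = _ , 1 , assign v≤ , record { r0 = refl ; r1 = r1 sim ; r2 = r2 sim ; r3 = r3 sim ; low = low sim ; high = high sim } , ≤-refl

    module Loop (r N : ℕ) (N≤ : N ≤ M₀) (N≤′ : N ≤ n + m) (b : Body)
                (limit : ∀ {i s st} → Sim i s st → regs s r ≡ N) where

      -- Induction on the number d of rounds that are left. The memory at index i is always
      -- `iter i b st`, so the semantics of the loop is read off at i = N.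
      while : ∀ d {i s st M} → i + d ≡ N → M₀ ≤ M → Sim i s (iter i b st) → Bounded M (iter i b st) →
              need (sizeB b) * (M + d * growB b) ≤ w →
              Reaches (whileNonzero (reg r ⊖ reg 0) (compileB b ⨾ (0 ≔ lit 1 ⊕ reg 0))) N (1 + d * (2 + costB b)) s (iter N b st)
              × Bounded (M + d * growB b) (iter N b st)
      while zero {i} {s} {st} {M} eq M₀≤ sim bd le with trans (sym eq) (+-identityʳ i)
      ... | refl = (s , 1 , exit (trans (cong₂ _∸_ (limit sim) (r0 sim)) (n∸n≡0 N)) , sim , ≤-refl) , λ k j → ≤-trans (bd k j) (m≤m+n M 0)
      while (suc d) {i} {s} {st} {M} eq M₀≤ sim bd le
        with runBody M b M₀≤ (≤-trans i<N N≤′) (≤-trans (<⇒≤ i<N) N≤) sim bd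
               (≤-trans (*-monoʳ-≤ (need (sizeB b)) (+-monoʳ-≤ M (m≤m+n (growB b) _))) le)
        where
        i<N : i < N
        i<N = ≤-trans (s≤s (m≤m+n i d)) (≤-reflexive (trans (sym (+-suc i d)) eq))
      ... | (s₁ , τ₁ , r₁ , sim₁ , q₁) , bd₁
        with setIndex (suc i) (lit 1 ⊕ reg 0) (cong suc (r0 sim₁)) (≤-trans i<N (≤-trans N≤ (≤-trans M₀≤ (≤-trans (≤-trans (m≤m+n M _) (1≤⇒≤* (need-pos (sizeB b)) (M + suc d * growB b))) le)))) sim₁
        where
        i<N : i < N
        i<N = ≤-trans (s≤s (m≤m+n i d)) (≤-reflexive (trans (sym (+-suc i d)) eq))
      ... | s₂ , τ₂ , r₂ , sim₂ , q₂
        with while d {suc i} {s₂} {st} {M + growB b} (trans (sym (+-suc i d)) eq) (≤-trans M₀≤ (m≤m+n M _)) sim₂ bd₁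
               (≤-trans (*-monoʳ-≤ (need (sizeB b)) (≤-reflexive (+-assoc M _ _))) le)
      ... | (s₃ , τ₃ , r₃ , sim₃ , q₃) , bd₃ =
        (s₃ , _ , loop (λ z → <⇒≱ i<N (m∸n≡0⇒m≤n (trans (cong₂ _∸_ (sym (limit sim)) (sym (r0 sim))) z))) (seq r₁ r₂) r₃ , sim₃
          , bound) , λ k j → ≤-trans (bd₃ k j) (≤-reflexive (+-assoc M _ _))
        where
        i<N : i < N
        i<N = ≤-trans (s≤s (m≤m+n i d)) (≤-reflexive (trans (sym (+-suc i d)) eq))
        bound : suc (τ₁ + τ₂ + τ₃) ≤ 1 + (2 + costB b + d * (2 + costB b))
        bound = s≤s (≤-trans (+-mono-≤ (+-mono-≤ q₁ q₂) q₃)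
          (≤-reflexive (trans (cong (_+ (1 + d * (2 + costB b))) (+-comm (costB b) 1)) (+-suc (1 + costB b) _))))

      each : ∀ {i s st M} → M₀ ≤ M → Sim i s st → Bounded M st → need (sizeB b) * (M + N * growB b) ≤ w →
             Reaches (forEach r (compileB b)) N (suc N * (4 + costB b)) s (iter N b st) × Bounded (M + N * growB b) (iter N b st)
      each {M = M} M₀≤ sim bd le with setIndex 0 (lit 0) refl z≤n sim
      ... | s₁ , τ₁ , r₁ , sim₁ , q₁ with while N refl M₀≤ sim₁ bd le
      ... | (s₂ , τ₂ , r₂ , sim₂ , q₂) , bd₂ = (s₂ , τ₁ + τ₂ , seq r₁ r₂ , sim₂
        , ≤-trans (+-mono-≤ q₁ q₂) (+-mono-≤ {2} {4 + costB b} (s≤s (s≤s z≤n)) (*-monoʳ-≤ N (m≤n+m _ 2)))) , bd₂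

    runPhase : ∀ {i s st M} p → M₀ ≤ M → Sim i s st → Bounded M st → need (sizeP p) * (M + (n + m) * growP p) ≤ w →
               Σ[ i′ ∈ ℕ ] (Reaches (compile p) i′ (suc (n + m) * costP p) s (run p st) × Bounded (M + (n + m) * growP p) (run p st))
    runPhase {M = M} (eachV b) M₀≤ sim bd le
      with Loop.each 1 n n≤M₀ (m≤m+n n m) b r1 M₀≤ sim bd (≤-trans (*-monoʳ-≤ (need (sizeB b)) (+-monoʳ-≤ M (*-monoˡ-≤ (growB b) (m≤m+n n m)))) le)
    ... | (s₁ , τ₁ , r₁ , sim₁ , q₁) , bd₁ = _ , (s₁ , τ₁ , r₁ , sim₁ , ≤-trans q₁ (*-monoˡ-≤ (4 + costB b) (s≤s (m≤m+n n m))))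
      , λ k j → ≤-trans (bd₁ k j) (+-monoʳ-≤ M (*-monoˡ-≤ (growB b) (m≤m+n n m)))
    runPhase {M = M} (eachE b) M₀≤ sim bd le
      with Loop.each 2 m m≤M₀ (m≤n+m m n) b r2 M₀≤ sim bd (≤-trans (*-monoʳ-≤ (need (sizeB b)) (+-monoʳ-≤ M (*-monoˡ-≤ (growB b) (m≤n+m m n)))) le)
    ... | (s₁ , τ₁ , r₁ , sim₁ , q₁) , bd₁ = _ , (s₁ , τ₁ , r₁ , sim₁ , ≤-trans q₁ (*-monoˡ-≤ (4 + costB b) (s≤s (m≤n+m m n))))
      , λ k j → ≤-trans (bd₁ k j) (+-monoʳ-≤ M (*-monoˡ-≤ (growB b) (m≤n+m m n)))
    runPhase {M = M} (p ▷ q) M₀≤ sim bd le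
      with runPhase p M₀≤ sim bd (≤-trans (*-mono-≤ (need-mono (m≤m+n (sizeP p) (sizeP q))) (+-monoʳ-≤ M (*-monoʳ-≤ (n + m) (m≤m+n (growP p) (growP q))))) le)
    ... | _ , (s₁ , τ₁ , r₁ , sim₁ , q₁) , bd₁
      with runPhase q (≤-trans M₀≤ (m≤m+n M _)) sim₁ bd₁
             (≤-trans (*-mono-≤ (need-mono (m≤n+m (sizeP q) (sizeP p))) (≤-reflexive (regroup (growP p) (growP q)))) le)
      where
      regroup : ∀ a b → M + (n + m) * a + (n + m) * b ≡ M + (n + m) * (a + b)
      regroup a b = trans (+-assoc M _ _) (cong (M +_) (sym (*-distribˡ-+ (n + m) a b)))
    ... | i′ , (s₂ , τ₂ , r₂ , sim₂ , q₂) , bd₂ = i′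
      , (s₂ , τ₁ + τ₂ , seq r₁ r₂ , sim₂ , ≤-trans (+-mono-≤ q₁ q₂) (≤-reflexive (sym (*-distribˡ-+ (suc (n + m)) (costP p) (costP q)))))
      , λ k j → ≤-trans (bd₂ k j) (≤-reflexive (trans (+-assoc M _ _) (cong (M +_) (sym (*-distribˡ-+ (n + m) (growP p) (growP q))))))

    -- The output loop overwrites the input, so `Sim` fails from here on; what survives are the
    -- registers in use and the array of colours, which lies above all output cells.
    record Written (st : St) (i : ℕ) (s : State) : Set where
      field
        w0   : regs s 0 ≡ i
        w2   : regs s 2 ≡ m
        w3   : regs s 3 ≡ base
        kept : ∀ j → mem s (base + (slots * j + slot Col)) ≡ st Col j
        outs : ∀ {e} → e < i → mem s e ≡ st Col e
    open Written

    m<base : m < base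
    m<base = ≤-trans (s≤s (≤-trans (m≤n+m m n) (m≤n*m (n + m) 4))) (≤-trans (m≤n+m _ 5) (≤-reflexive (sym base-def)))

    write : ∀ d {i s st} → i + d ≡ m → Written st i s → m ≤ w → (∀ j → st Col j ≤ w) →
            Σ[ s′ ∈ State ] Σ[ t ∈ ℕ ] (Run w (whileNonzero (reg 2 ⊖ reg 0)
              (store (reg 0) (load (cell Col ix)) ⨾ (0 ≔ lit 1 ⊕ reg 0))) s s′ t × Written st m s′ × t ≤ 1 + d * 3)
    write zero {i} {s} eq wr m≤w st≤ with trans (sym eq) (+-identityʳ i)
    ... | refl = s , 1 , exit (trans (cong₂ _∸_ (w2 wr) (w0 wr)) (n∸n≡0 m)) , wr , ≤-refl
    write (suc d) {i} {s} {st} eq wr m≤w st≤ = again (write d {suc i} (trans (sym (+-suc i d)) eq) wr′ m≤w st≤)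
      where
      i<m : i < m
      i<m = ≤-trans (s≤s (m≤m+n i d)) (≤-reflexive (trans (sym (+-suc i d)) eq))
      address : eval s (cell Col ix) ≡ base + (slots * i + slot Col)
      address = cong₂ _+_ (w3 wr) (cong (_+ slot Col) (trans (eval-scale slots s (reg 0)) (cong (slots *_) (w0 wr))))
      value : mem s (eval s (cell Col ix)) ≡ st Col i
      value = trans (cong (mem s) address) (kept wr i)
      s₁ s₂ : State
      s₁ = state (regs s) (update (mem s) (regs s 0) (mem s (eval s (cell Col ix))))
      s₂ = state (update (regs s) 0 (suc (regs s 0))) (mem s₁)
      wr′ : Written st (suc i) s₂
      wr′ = record
        { w0 = cong suc (w0 wr) ; w2 = w2 wr ; w3 = w3 wr
        ; kept = λ j → trans (put-other (mem s) (λ e → <⇒≱ (<-trans i<m m<base) (≤-trans (m≤m+n base _) (≤-reflexive (trans (sym e) (w0 wr)))))) (kept wr j)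
        ; outs = done }
        where
        done : ∀ {e} → e < suc i → mem s₁ e ≡ st Col e
        done {e} lt with e ≟ i
        ... | yes refl = trans (put-same (mem s) (w0 wr)) value
        ... | no ne = trans (put-other (mem s) (λ eq → ne (sym (trans (sym (w0 wr)) eq)))) (outs wr (≤∧≢⇒< (≤-pred lt) ne))
      again : Σ[ s′ ∈ State ] Σ[ t ∈ ℕ ] (Run w (whileNonzero (reg 2 ⊖ reg 0)
                (store (reg 0) (load (cell Col ix)) ⨾ (0 ≔ lit 1 ⊕ reg 0))) s₂ s′ t × Written st m s′ × t ≤ 1 + d * 3) →
              Σ[ s′ ∈ State ] Σ[ t ∈ ℕ ] (Run w (whileNonzero (reg 2 ⊖ reg 0)
                (store (reg 0) (load (cell Col ix)) ⨾ (0 ≔ lit 1 ⊕ reg 0))) s s′ t × Written st m s′ × t ≤ 1 + suc d * 3)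
      again (s′ , t , r , wr″ , q) = s′ , _
        , loop (λ z → <⇒≱ i<m (m∸n≡0⇒m≤n (trans (cong₂ _∸_ (sym (w2 wr)) (sym (w0 wr))) z)))
               (seq (store (≤-trans (≤-reflexive (w0 wr)) (≤-trans (<⇒≤ i<m) m≤w)) (≤-trans (≤-reflexive value) (st≤ i)))
                    (assign (≤-trans (≤-reflexive (cong suc (w0 wr))) (≤-trans i<m m≤w)))) r
        , wr″ , s≤s (s≤s (s≤s q))

    empty : St
    empty _ _ = 0

    runWhole : inp 0 ≡ n → inp 1 ≡ m → (∀ {a} → base ≤ a → inp a ≡ 0) → ∀ p →
               need (sizeP p) * (M₀ + (n + m) * growP p) ≤ w →
               Σ[ t ∈ ℕ ] Σ[ s ∈ State ] (Run w (whole p) (state (λ _ → 0) inp) s t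
                 × t ≤ 5 + suc (n + m) * (costP p + 3) × (∀ {e} → e < m → mem s e ≡ run p empty Col e))
    runWhole inp0 inp1 beyond p le = after (runPhase p ≤-refl sim₀ (λ _ _ → z≤n) le)
      where
      s₀ s₃ : State
      s₀ = state (λ _ → 0) inp
      s₃ = state (update (update (update (λ _ → 0) 1 (inp 0)) 2 (inp 1)) 3 (6 + (inp 0 + inp 1 + (inp 0 + inp 1 + (inp 0 + inp 1 + (inp 0 + inp 1 + 0)))))) inp
      base≡ : 6 + (inp 0 + inp 1 + (inp 0 + inp 1 + (inp 0 + inp 1 + (inp 0 + inp 1 + 0)))) ≡ base
      base≡ = trans (cong₂ (λ a b → 6 + 4 * (a + b)) inp0 inp1) (sym base-def)
      sim₀ : Sim 0 s₃ empty
      -- Memory beyond the input is zero, which is exactly the encoding of `empty`.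
      sim₀ = record { r0 = refl ; r1 = inp0 ; r2 = inp1 ; r3 = base≡ ; low = λ _ → refl ; high = λ k j → beyond (m≤m+n base _) }
      M≤w : M₀ + (n + m) * growP p ≤ w
      M≤w = ≤-trans (1≤⇒≤* (need-pos (sizeP p)) _) le
      M₀≤w : M₀ ≤ w
      M₀≤w = ≤-trans (m≤m+n M₀ _) M≤w
      base≤w : base ≤ w
      base≤w = ≤-trans (m≤m+n base _) (≤-trans (address≤ {M₀} {sizeP p} {0} ≤-refl z≤n Src)
        (≤-trans (*-monoʳ-≤ (need (sizeP p)) (m≤m+n M₀ _)) le))
      after : Σ[ i′ ∈ ℕ ] (Reaches (compile p) i′ (suc (n + m) * costP p) s₃ (run p empty) × Bounded (M₀ + (n + m) * growP p) (run p empty)) →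
              Σ[ t ∈ ℕ ] Σ[ s ∈ State ] (Run w (whole p) s₀ s t
                 × t ≤ 5 + suc (n + m) * (costP p + 3) × (∀ {e} → e < m → mem s e ≡ run p empty Col e))
      after (_ , (s₄ , τ , r , sim , q) , bd) = finish (write m refl wr₀ (≤-trans m≤M₀ M₀≤w) (λ j → ≤-trans (bd Col j) M≤w))
        where
        s₅ : State
        s₅ = state (update (regs s₄) 0 0) (mem s₄)
        wr₀ : Written (run p empty) 0 s₅
        wr₀ = record { w0 = refl ; w2 = r2 sim ; w3 = r3 sim ; kept = high sim Col ; outs = λ () }
        finish : Σ[ s′ ∈ State ] Σ[ t ∈ ℕ ] (Run w (whileNonzero (reg 2 ⊖ reg 0)
                (store (reg 0) (load (cell Col ix)) ⨾ (0 ≔ lit 1 ⊕ reg 0))) s₅ s′ t × Written (run p empty) m s′ × t ≤ 1 + m * 3) →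
              Σ[ t ∈ ℕ ] Σ[ s ∈ State ] (Run w (whole p) s₀ s t
                 × t ≤ 5 + suc (n + m) * (costP p + 3) × (∀ {e} → e < m → mem s e ≡ run p empty Col e))
        finish (s′ , t , r′ , wr , q′) = _ , s′
          , seq (seq (assign (≤-trans (≤-reflexive inp0) (≤-trans n≤M₀ M₀≤w)))
                     (seq (assign (≤-trans (≤-reflexive inp1) (≤-trans m≤M₀ M₀≤w)))
                          (assign (≤-trans (≤-reflexive base≡) base≤w))))
                (seq r (seq (assign z≤n) r′))
          , s≤s (s≤s (s≤s (≤-trans (+-mono-≤ q (s≤s q′)) total)))
          , outs wr
          where
          open ≤-Reasoning
          total : suc (n + m) * costP p + suc (1 + m * 3) ≤ 2 + suc (n + m) * (costP p + 3)
          total = begin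
            suc (n + m) * costP p + (2 + m * 3)
              ≤⟨ +-monoʳ-≤ (suc (n + m) * costP p) (+-monoʳ-≤ 2 (*-monoˡ-≤ 3 (≤-trans (m≤n+m m n) (n≤1+n _)))) ⟩
            suc (n + m) * costP p + (2 + suc (n + m) * 3)
              ≡⟨ +-comm (suc (n + m) * costP p) _ ⟩
            2 + suc (n + m) * 3 + suc (n + m) * costP p
              ≡⟨ cong (2 +_) (trans (+-comm (suc (n + m) * 3) _) (sym (*-distribˡ-+ (suc (n + m)) (costP p) 3))) ⟩
            2 + suc (n + m) * (costP p + 3) ∎

-- Counting

ind : Bool → ℕ
ind b = if b then 1 else 0

sum : (ℕ → ℕ) → ℕ → ℕ
sum f zero    = 0
sum f (suc i) = f i + sum f i

count : (ℕ → Bool) → ℕ → ℕ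
count P = sum (ind ∘ P)

ind-mono : ∀ {a b} → (T a → T b) → ind a ≤ ind b
ind-mono {false} p = z≤n
ind-mono {true} {true} p = ≤-refl
ind-mono {true} {false} p = ⊥-elim (p tt)

ind-true : ∀ {a} → T a → ind a ≡ 1
ind-true {true} p = refl

ind-false : ∀ {a} → ¬ T a → ind a ≡ 0
ind-false {false} p = refl
ind-false {true} p = ⊥-elim (p tt)

ind≤1 : ∀ a → ind a ≤ 1
ind≤1 false = z≤n
ind≤1 true  = ≤-refl

sum-mono : ∀ {f g} N → (∀ {i} → i < N → f i ≤ g i) → sum f N ≤ sum g N
sum-mono zero    p = z≤n
sum-mono (suc N) p = +-mono-≤ (p ≤-refl) (sum-mono N (λ lt → p (m≤n⇒m≤1+n lt)))

sum-cong : ∀ {f g} N → (∀ {i} → i < N → f i ≡ g i) → sum f N ≡ sum g N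
sum-cong zero    p = refl
sum-cong (suc N) p = cong₂ _+_ (p ≤-refl) (sum-cong N (λ lt → p (m≤n⇒m≤1+n lt)))

+-interchange : ∀ a b c d → a + b + (c + d) ≡ a + c + (b + d)
+-interchange a b c d = trans (+-assoc a b _) (trans (cong (a +_) (trans (sym (+-assoc b c d))
  (trans (cong (_+ d) (+-comm b c)) (+-assoc c b d)))) (sym (+-assoc a c _)))

sum-+ : ∀ f g N → sum (λ i → f i + g i) N ≡ sum f N + sum g N
sum-+ f g zero    = refl
sum-+ f g (suc N) = trans (cong (f N + g N +_) (sum-+ f g N)) (+-interchange (f N) (g N) _ _)

sum≤ : ∀ {f} b N → (∀ {i} → i < N → f i ≤ b) → sum f N ≤ N * b
sum≤ b zero    p = z≤n
sum≤ b (suc N) p = +-mono-≤ (p ≤-refl) (sum≤ b N (λ lt → p (m≤n⇒m≤1+n lt)))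

sum-index : ∀ f {N i} → i < N → f i ≤ sum f N
sum-index f {suc N} {i} lt with i ≟ N
... | yes refl = m≤m+n (f N) _
... | no ne = ≤-trans (sum-index f (≤∧≢⇒< (≤-pred lt) ne)) (m≤n+m _ (f N))

count-mono : ∀ {P Q} N → (∀ {i} → i < N → T (P i) → T (Q i)) → count P N ≤ count Q N
count-mono N p = sum-mono N (λ lt → ind-mono (p lt))

count-cover : ∀ {P Q R} N → (∀ {i} → i < N → T (P i) → T (Q i) ⊎ T (R i)) → count P N ≤ count Q N + count R N
count-cover {P} {Q} {R} N p = ≤-trans (sum-mono N (λ {i} lt → go (P i) (Q i) (R i) (p lt))) (≤-reflexive (sum-+ (ind ∘ Q) (ind ∘ R) N))
  where
  go : ∀ a b c → (T a → T b ⊎ T c) → ind a ≤ ind b + ind c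
  go false b     c     p = z≤n
  go true  true  c     p = s≤s z≤n
  go true  false true  p = ≤-refl
  go true  false false p = case p tt of λ { (inj₁ ()) ; (inj₂ ()) }

count-disjoint : ∀ {P Q R} N → (∀ {i} → i < N → T (P i) → T (R i)) → (∀ {i} → i < N → T (Q i) → T (R i)) →
                 (∀ {i} → i < N → T (P i) → ¬ T (Q i)) → count P N + count Q N ≤ count R N
count-disjoint {P} {Q} {R} N p q d = ≤-trans (≤-reflexive (sym (sum-+ (ind ∘ P) (ind ∘ Q) N)))
  (sum-mono N (λ {i} lt → go (P i) (Q i) (R i) (p lt) (q lt) (d lt)))
  where
  go : ∀ a b c → (T a → T c) → (T b → T c) → (T a → ¬ T b) → ind a + ind b ≤ ind c
  go false false c     p q d = z≤n
  go false true  true  p q d = ≤-refl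
  go false true  false p q d = ⊥-elim (q tt)
  go true  true  c     p q d = ⊥-elim (d tt tt)
  go true  false true  p q d = ≤-refl
  go true  false false p q d = ⊥-elim (p tt)

≡ᵇ-refl : ∀ i → (i ≡ᵇ i) ≡ true
≡ᵇ-refl zero    = refl
≡ᵇ-refl (suc i) = ≡ᵇ-refl i

≢⇒≡ᵇ : ∀ {i j} → i ≢ j → (i ≡ᵇ j) ≡ false
≢⇒≡ᵇ {i} {j} ne with i ≡ᵇ j in eq
... | true  = ⊥-elim (ne (≡ᵇ⇒≡ i j (subst T (sym eq) tt)))
... | false = refl

sum-except : ∀ f N x → x < N → sum f N ≡ f x + sum (λ i → if x ≡ᵇ i then 0 else f i) N
sum-except f (suc N) x lt with x ≟ N
... | yes refl rewrite ≡ᵇ-refl x = cong (f x +_) (sum-cong N λ {i} i< → sym (cong (λ b → if b then 0 else f i) (≢⇒≡ᵇ {x} (λ e → <⇒≢ i< (sym e)))))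
... | no ne rewrite ≢⇒≡ᵇ ne = trans (cong (f N +_) (sum-except f N x (≤∧≢⇒< (≤-pred lt) ne)))
  (trans (sym (+-assoc (f N) (f x) rest)) (trans (cong (_+ rest) (+-comm (f N) (f x))) (+-assoc (f x) (f N) rest)))
  where
  rest : ℕ
  rest = sum (λ i → if x ≡ᵇ i then 0 else f i) N

-- The image of the last index is struck out of Q before the induction continues; only the indices
-- satisfying P have to be treated injectively.
count-injection : ∀ {P Q} N M (f : ℕ → ℕ) → (∀ {i} → i < N → T (P i) → f i < M × T (Q (f i))) →
                  (∀ {i j} → i < N → j < N → T (P i) → T (P j) → f i ≡ f j → i ≡ j) → count P N ≤ count Q M
count-injection zero M f into inj = z≤n
count-injection {P} {Q} (suc N) M f into inj with P N in eq
... | false = count-injection N M f (λ lt → into (m≤n⇒m≤1+n lt)) (λ lt lt′ → inj (m≤n⇒m≤1+n lt) (m≤n⇒m≤1+n lt′))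
... | true = ≤-trans (+-mono-≤ (≤-reflexive (sym (ind-true (proj₂ fN)))) rest) (≤-reflexive (sym (sum-except (ind ∘ Q) M (f N) (proj₁ fN))))
  where
  pN : T (P N)
  pN = subst T (sym eq) tt
  fN : f N < M × T (Q (f N))
  fN = into ≤-refl pN
  Q′ : ℕ → Bool
  Q′ i = if f N ≡ᵇ i then false else Q i
  same : ∀ b c → ind (if b then false else c) ≡ (if b then 0 else ind c)
  same false c = refl
  same true  c = refl
  rest : count P N ≤ sum (λ i → if f N ≡ᵇ i then 0 else ind (Q i)) M
  rest = ≤-trans (count-injection {P} {Q′} N M f
    (λ {i} lt p → proj₁ (into (m≤n⇒m≤1+n lt) p) ,
       subst (λ b → T (if b then false else Q (f i))) (sym (≢⇒≡ᵇ {f N} λ e → <⇒≢ lt (sym (inj ≤-refl (m≤n⇒m≤1+n lt) pN p e))))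
         (proj₂ (into (m≤n⇒m≤1+n lt) p)))
    (λ lt lt′ → inj (m≤n⇒m≤1+n lt) (m≤n⇒m≤1+n lt′)))
    (≤-reflexive (sum-cong M (λ {i} _ → same (f N ≡ᵇ i) (Q i))))

count-missing : ∀ {P} N → count P N < N → ∃[ i ] (i < N × ¬ T (P i))
count-missing {P} (suc N) lt with P N in eq
... | false = N , ≤-refl , subst T eq
... | true with count-missing {P} N (≤-pred lt)
...   | i , i< , np = i , m≤n⇒m≤1+n i< , np

-- Definitionally what `put` does to the array it writes.
upd : (ℕ → ℕ) → ℕ → ℕ → ℕ → ℕ
upd f j v j′ = if j ≡ᵇ j′ then v else f j′

upd-same : ∀ f {j v j′} → j ≡ j′ → upd f j v j′ ≡ v
upd-same f {j} refl rewrite ≡ᵇ-refl j = refl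

upd-other : ∀ f {j v j′} → j ≢ j′ → upd f j v j′ ≡ f j′
upd-other f ne rewrite ≢⇒≡ᵇ ne = refl

upd-cong : ∀ {f g} j {v w} → (∀ i → f i ≡ g i) → v ≡ w → ∀ i → upd f j v i ≡ upd g j w i
upd-cong j p refl i with j ≡ᵇ i
... | true  = refl
... | false = p i

sum-upd : ∀ f {N} j v → j < N → sum (upd f j v) N + f j ≡ sum f N + v
sum-upd f {N} j v lt = begin
  sum (upd f j v) N + f j
    ≡⟨ cong (_+ f j) (trans (sum-except (upd f j v) N j lt) (cong₂ _+_ (upd-same f refl) (sum-cong N λ {i} _ → lem (j ≡ᵇ i)))) ⟩
  v + rest + f j
    ≡⟨ trans (+-comm (v + rest) (f j)) (trans (cong (f j +_) (+-comm v rest)) (sym (+-assoc (f j) rest v))) ⟩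
  f j + rest + v
    ≡⟨ cong (_+ v) (sum-except f N j lt) ⟨
  sum f N + v ∎
  where
  open ≡-Reasoning
  rest : ℕ
  rest = sum (λ i → if j ≡ᵇ i then 0 else f i) N
  lem : ∀ {x} b → (if b then 0 else (if b then v else x)) ≡ (if b then 0 else x)
  lem true  = refl
  lem false = refl

branch-zero : ∀ {A : Set} {c} {a b : A} → c ≡ 0 → branch c a b ≡ b
branch-zero refl = refl

branch-nonzero : ∀ {A : Set} {c} {a b : A} → c ≢ 0 → branch c a b ≡ a
branch-nonzero {c = zero}  ne = ⊥-elim (ne refl)
branch-nonzero {c = suc _} ne = refl

branch-elim : ∀ {A : Set} (P : A → Set) c {a b : A} → (c ≢ 0 → P a) → (c ≡ 0 → P b) → P (branch c a b)
branch-elim P zero    p q = q refl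
branch-elim P (suc c) p q = p (λ ())

-- The chains of a set of edges (those with a nonzero mark) of maximum degree
-- two.  Inserting the edges in order, far maps each end of a path to its other
-- end, and an isolated vertex to itself; undoing the insertions in reverse
-- order spreads bits that agree on the two ends of each path along the path.

module Chains (m : ℕ) (s t mark : ℕ → ℕ) (loopless : ∀ {e} → e < m → s e ≢ t e) where

  hit : ℕ → ℕ → ℕ
  hit e v = ind (s e ≡ᵇ v) + ind (t e ≡ᵇ v)

  marked : ℕ → ℕ → ℕ
  marked e v = branch (mark e) (hit e v) 0

  -- The degree of v in the graph of the marked edges with index below i.
  valency : ℕ → ℕ → ℕ
  valency i v = sum (λ e → marked e v) i

  -- A new edge uv joins the path from u to f u with the path from v to f v, so f u and f v become
  -- partners. Unless u or v was isolated, it is now interior and its entry may become outdated.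
  link : (ℕ → ℕ) → ℕ → ℕ → ℕ → ℕ
  link f u v = upd (upd f (f u) (f v)) (f v) (f u)

  far : ℕ → ℕ → ℕ
  far zero    v = v
  far (suc i) v = branch (mark i) (link (far i) (s i) (t i) v) (far i v)

  -- Without the edge e its ends are ends of paths again, with other ends `far e (s e)` and
  -- `far e (t e)`; each takes over the bit found there. The second copy reads the result of the
  -- first, so that the two ends also agree when e had closed a cycle.
  spread : ℕ → (ℕ → ℕ) → ℕ → ℕ
  spread e b = upd (upd b (s e) (b (far e (s e)))) (t e) (upd b (s e) (b (far e (s e))) (far e (t e)))

  -- After i steps the last i insertions are undone, the latest first.
  bits : (ℕ → ℕ) → ℕ → ℕ → ℕ
  bits b zero    v = b v
  bits b (suc i) v = branch (mark (m ∸ suc i)) (spread (m ∸ suc i) (bits b i) v) (bits b i v)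

  module _ (degree≤2 : ∀ v → valency m v ≤ 2) where

    valency-mono : ∀ {i j} v → i ≤ j → valency i v ≤ valency j v
    valency-mono {i} {zero} v z≤n = ≤-refl
    valency-mono {i} {suc j} v le with i ≟ suc j
    ... | yes refl = ≤-refl
    ... | no ne = ≤-trans (valency-mono v (≤-pred (≤∧≢⇒< le ne))) (m≤n+m _ (marked j v))

    marked-s : ∀ {e} → e < m → mark e ≢ 0 → marked e (s e) ≡ 1
    marked-s {e} e< me = trans (branch-nonzero me) (cong₂ _+_ (cong ind (≡ᵇ-refl (s e))) (cong ind (≢⇒≡ᵇ (loopless e< ∘ sym))))

    marked-t : ∀ {e} → e < m → mark e ≢ 0 → marked e (t e) ≡ 1
    marked-t {e} e< me = trans (branch-nonzero me) (cong₂ _+_ (cong ind (≢⇒≡ᵇ (loopless e<))) (cong ind (≡ᵇ-refl (t e))))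

    marked-other : ∀ e {v} → s e ≢ v → t e ≢ v → marked e v ≡ 0
    marked-other e {v} p q = branch-elim (_≡ 0) (mark e) (λ _ → cong₂ (λ a b → ind a + ind b) (≢⇒≡ᵇ p) (≢⇒≡ᵇ q)) (λ _ → refl)

    -- Claimed only where the valency is at most 1: at interior vertices, and on paths closed to
    -- cycles, `far` holds leftovers.
    record Paths (i : ℕ) (v : ℕ) : Set where
      field
        end  : valency i (far i v) ≤ 1
        back : far i (far i v) ≡ v
        iso  : valency i v ≡ 0 → far i v ≡ v
        iso′ : far i v ≡ v → valency i v ≡ 0
    open Paths

    module Insert (i : ℕ) (i<m : i < m) (mi : mark i ≢ 0) (ih : ∀ v → valency i v ≤ 1 → Paths i v) where
      u v f g : ℕ
      u = s i
      v = t i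
      f = far i u
      g = far i v
      u≢v : u ≢ v
      u≢v = loopless i<m
      vu : valency (suc i) u ≡ suc (valency i u)
      vu = cong (_+ valency i u) (marked-s i<m mi)
      vv : valency (suc i) v ≡ suc (valency i v)
      vv = cong (_+ valency i v) (marked-t i<m mi)
      vo : ∀ {w} → u ≢ w → v ≢ w → valency (suc i) w ≡ valency i w
      vo {w} p q = cong (_+ valency i w) (marked-other i p q)
      u1 : valency i u ≤ 1
      u1 = ≤-pred (≤-trans (≤-reflexive (sym vu)) (≤-trans (valency-mono u i<m) (degree≤2 u)))
      v1 : valency i v ≤ 1
      v1 = ≤-pred (≤-trans (≤-reflexive (sym vv)) (≤-trans (valency-mono v i<m) (degree≤2 v)))
      f≢g : f ≢ g
      f≢g e = u≢v (trans (sym (back (ih u u1))) (trans (cong (far i) e) (back (ih v v1))))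
      far′ : ∀ w → far (suc i) w ≡ link (far i) u v w
      far′ w = branch-nonzero mi
      far-f : far (suc i) f ≡ g
      far-f = trans (far′ f) (trans (upd-other (upd (far i) f g) (f≢g ∘ sym)) (upd-same (far i) {f} refl))
      far-g : far (suc i) g ≡ f
      far-g = trans (far′ g) (upd-same (upd (far i) f g) {g} refl)
      far-other : ∀ {w} → f ≢ w → g ≢ w → far (suc i) w ≡ far i w
      far-other {w} p q = trans (far′ w) (trans (upd-other (upd (far i) f g) q) (upd-other (far i) p))
      smaller : ∀ {w} → valency (suc i) w ≤ 1 → valency i w ≤ 1
      smaller {w} p = ≤-trans (m≤n+m _ (marked i w)) p
      u-new : valency (suc i) u ≤ 1 → f ≡ u
      u-new p = iso (ih u u1) (n≤0⇒n≡0 (≤-pred (≤-trans (≤-reflexive (sym vu)) p)))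
      v-new : valency (suc i) v ≤ 1 → g ≡ v
      v-new p = iso (ih v v1) (n≤0⇒n≡0 (≤-pred (≤-trans (≤-reflexive (sym vv)) p)))

      -- f = v means that the new edge closes a cycle, with v inside. Otherwise f gains an edge only
      -- if f = u, and then u was isolated.
      f-end : f ≢ v → valency (suc i) f ≤ 1
      f-end ne with u ≟ f
      ... | yes e = ≤-trans (≤-reflexive (trans (cong (valency (suc i)) (sym e)) (trans vu (cong suc (iso′ (ih u u1) (sym e)))))) ≤-refl
      ... | no ne′ = ≤-trans (≤-reflexive (vo ne′ (ne ∘ sym))) (end (ih u u1))
      g-end : g ≢ u → valency (suc i) g ≤ 1
      g-end ne with v ≟ g
      ... | yes e = ≤-trans (≤-reflexive (trans (cong (valency (suc i)) (sym e)) (trans vv (cong suc (iso′ (ih v v1) (sym e)))))) ≤-refl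
      ... | no ne′ = ≤-trans (≤-reflexive (vo (ne ∘ sym) ne′)) (end (ih v v1))
      g≡u⇒f≡v : g ≡ u → f ≡ v
      g≡u⇒f≡v e = trans (cong (far i) (sym e)) (back (ih v v1))
      f≡v⇒g≡u : f ≡ v → g ≡ u
      f≡v⇒g≡u e = trans (cong (far i) (sym e)) (back (ih u u1))
      f-busy : valency (suc i) f ≢ 0
      f-busy z = 1+n≢0 (trans (sym vu) (trans (cong (valency (suc i)) u≡f) z))
        where
        u≡f : u ≡ f
        u≡f = trans (sym (back (ih u u1))) (iso (ih f (end (ih u u1))) (m+n≡0⇒n≡0 (marked i f) z))
      g-busy : valency (suc i) g ≢ 0
      g-busy z = 1+n≢0 (trans (sym vv) (trans (cong (valency (suc i)) v≡g) z))
        where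
        v≡g : v ≡ g
        v≡g = trans (sym (back (ih v v1))) (iso (ih g (end (ih v v1))) (m+n≡0⇒n≡0 (marked i g) z))

      module Other {w : ℕ} (w1 : valency (suc i) w ≤ 1) (f≢w : f ≢ w) (g≢w : g ≢ w) where
        p : Paths i w
        p = ih w (smaller w1)
        w′ : ℕ
        w′ = far i w
        u≢w : u ≢ w
        u≢w e = f≢w (trans (u-new (subst (λ x → valency (suc i) x ≤ 1) (sym e) w1)) e)
        v≢w : v ≢ w
        v≢w e = g≢w (trans (v-new (subst (λ x → valency (suc i) x ≤ 1) (sym e) w1)) e)
        f≢w′ : f ≢ w′
        f≢w′ e = u≢w (trans (sym (back (ih u u1))) (trans (cong (far i) e) (back p)))
        g≢w′ : g ≢ w′
        g≢w′ e = v≢w (trans (sym (back (ih v v1))) (trans (cong (far i) e) (back p)))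
        u≢w′ : u ≢ w′
        u≢w′ e = f≢w (trans (cong (far i) e) (back p))
        v≢w′ : v ≢ w′
        v≢w′ e = g≢w (trans (cong (far i) e) (back p))
        far-w : far (suc i) w ≡ w′
        far-w = far-other f≢w g≢w
        paths : Paths (suc i) w
        paths = record
          { end  = subst (λ x → valency (suc i) x ≤ 1) (sym far-w) (≤-trans (≤-reflexive (vo u≢w′ v≢w′)) (end p))
          ; back = trans (cong (far (suc i)) far-w) (trans (far-other f≢w′ g≢w′) (back p))
          ; iso  = λ z → trans far-w (iso p (trans (sym (vo u≢w v≢w)) z))
          ; iso′ = λ e → trans (vo u≢w v≢w) (iso′ p (trans (sym far-w) e)) }

      inserted : ∀ w → valency (suc i) w ≤ 1 → Paths (suc i) w
      inserted w w1 with f ≟ w | g ≟ w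
      ... | no ne | no ne′ = Other.paths w1 ne ne′
      ... | yes refl | _ = record
        -- g = u would mean a closed cycle and w = f = v; but v is still an end, so it was isolated
        -- and g = v.
        { end = subst (λ x → valency (suc i) x ≤ 1) (sym far-f) (g-end λ e → u≢v (trans (sym e) (v-new (subst (λ x → valency (suc i) x ≤ 1) (g≡u⇒f≡v e) w1))))
        ; back = trans (cong (far (suc i)) far-f) far-g
        ; iso = λ z → ⊥-elim (f-busy z)
        ; iso′ = λ e → ⊥-elim (f≢g (sym (trans (sym far-f) e))) }
      ... | no _ | yes refl = record
        { end = subst (λ x → valency (suc i) x ≤ 1) (sym far-g) (f-end λ e → u≢v (trans (sym (u-new (subst (λ x → valency (suc i) x ≤ 1) (f≡v⇒g≡u e) w1))) e))
        ; back = trans (cong (far (suc i)) far-g) far-f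
        ; iso = λ z → ⊥-elim (g-busy z)
        ; iso′ = λ e → ⊥-elim (f≢g (trans (sym far-g) e)) }

    skip-valency : ∀ {i} v → mark i ≡ 0 → valency (suc i) v ≡ valency i v
    skip-valency {i} v mi = cong (_+ valency i v) (branch-zero mi)

    skip-far : ∀ {i} v → mark i ≡ 0 → far (suc i) v ≡ far i v
    skip-far v mi = branch-zero mi

    paths : ∀ i → i ≤ m → ∀ v → valency i v ≤ 1 → Paths i v
    paths zero    _  v _ = record { end = z≤n ; back = refl ; iso = λ _ → refl ; iso′ = λ _ → refl }
    paths (suc i) le v v1 with mark i ≟ 0
    ... | no mi = Insert.inserted i le mi (paths i (<⇒≤ le)) v v1
    ... | yes mi = record
      { end = subst (λ x → valency (suc i) x ≤ 1) (sym (skip-far v mi)) (≤-trans (≤-reflexive (skip-valency _ mi)) (end p))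
      ; back = trans (skip-far _ mi) (trans (cong (far i) (skip-far v mi)) (back p))
      ; iso = λ z → trans (skip-far v mi) (iso p (trans (sym (skip-valency v mi)) z))
      ; iso′ = λ e → trans (skip-valency v mi) (iso′ p (trans (sym (skip-far v mi)) e)) }
      where
      p : Paths i v
      p = paths i (<⇒≤ le) v (≤-trans (≤-reflexive (sym (skip-valency v mi))) v1)

    far-involutive : ∀ {v} → valency m v ≤ 1 → far m (far m v) ≡ v
    far-involutive v1 = back (paths m ≤-refl _ v1)

    far-end : ∀ {v} → valency m v ≤ 1 → valency m (far m v) ≤ 1
    far-end v1 = end (paths m ≤-refl _ v1)

    module _ (b₀ : ℕ → ℕ) where

      -- The invariant of undoing. It interpolates between i = m, where `joined` is empty and `ends`
      -- is the hypothesis on the initial bits, and i = 0, where `joined` covers every marked edge.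
      record Agree (i : ℕ) (B : ℕ → ℕ) : Set where
        field
          ends   : ∀ v → valency i v ≤ 1 → B (far i v) ≡ B v
          joined : ∀ {e} → i ≤ e → e < m → mark e ≢ 0 → B (s e) ≡ B (t e)
          fixed  : ∀ {v} → valency m v ≤ 1 → B v ≡ b₀ v
      open Agree

      -- The later edge e accounts for one of the at most two marked edges at v, so at most one is
      -- left up to i. Hence undoing i does not change the bit at v.
      later : ∀ {i e v} → i < e → e < m → marked e v ≡ 1 → valency (suc i) v ≤ 1
      later {i} {e} {v} lt e< one = ≤-trans (valency-mono v lt)
        (≤-pred (≤-trans (≤-reflexive (cong (_+ valency e v) (sym one))) (≤-trans (valency-mono v e<) (degree≤2 v))))

      module Undo (i : ℕ) (i<m : i < m) (mi : mark i ≢ 0) (B : ℕ → ℕ) (ag : Agree (suc i) B) where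
        open Insert i i<m mi (paths i (<⇒≤ i<m))

        B₁ : ℕ → ℕ
        B₁ = upd B u (B f)

        at-u : spread i B u ≡ B f
        at-u = trans (upd-other B₁ (u≢v ∘ sym)) (upd-same B refl)
        at-v : spread i B v ≡ B₁ g
        at-v = upd-same B₁ {v} refl
        at-other : ∀ {w} → u ≢ w → v ≢ w → spread i B w ≡ B w
        at-other p q = trans (upd-other B₁ q) (upd-other B p)

        -- If u is an end even with its new edge, it was isolated before; then f = u, and the bit of
        -- u is copied to itself. The same holds for v.
        persists : ∀ {w} → valency (suc i) w ≤ 1 → spread i B w ≡ B w
        persists {w} w1 with u ≟ w
        ... | yes refl = trans at-u (cong B (u-new w1))
        ... | no u≢w with v ≟ w
        ...   | yes refl = trans at-v (trans (cong B₁ (v-new w1)) (upd-other B u≢v))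
        ...   | no v≢w = at-other u≢w v≢w

        at-f : spread i B f ≡ B f
        at-f with u ≟ f
        ... | yes e = trans (cong (spread i B) (sym e)) at-u
        ... | no u≢f with v ≟ f
        ...   | no v≢f = at-other u≢f v≢f
        ...   | yes e = trans (cong (spread i B) (sym e)) (trans at-v (upd-same B (sym (f≡v⇒g≡u (sym e)))))

        at-g : spread i B g ≡ spread i B v
        at-g with v ≟ g
        ... | yes e = cong (spread i B) (sym e)
        ... | no v≢g with u ≟ g
        ...   | no u≢g = trans (at-other u≢g v≢g) (sym (trans at-v (upd-other B u≢g)))
        ...   | yes e = trans (cong (spread i B) (sym e)) (trans at-u (sym (trans at-v (upd-same B e))))

        -- If the edge closed a cycle, then g = u and v has just copied the bit of u. If not, u and
        -- v receive the bits of f and g, which are the two ends of one path while the edge is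
        -- present.
        at-ends : spread i B u ≡ spread i B v
        at-ends with u ≟ g
        ... | yes e = trans at-u (sym (trans at-v (upd-same B e)))
        ... | no u≢g = trans at-u (trans (trans (sym (ends ag f (f-end λ e → u≢g (sym (f≡v⇒g≡u e))))) (cong B far-f))
                         (sym (trans at-v (upd-other B u≢g))))

        agree : Agree i (spread i B)
        agree = record
          { ends = both
          ; joined = joins
          ; fixed = λ {v} v1 → trans (persists (≤-trans (valency-mono v i<m) v1)) (fixed ag v1) }
          where
          joins : ∀ {e} → i ≤ e → e < m → mark e ≢ 0 → spread i B (s e) ≡ spread i B (t e)
          joins {e} le e< me with i ≟ e
          ... | yes refl = at-ends
          ... | no ne = trans (persists (later lt e< (marked-s e< me)))
              (trans (joined ag lt e< me) (sym (persists (later lt e< (marked-t e< me)))))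
            where
            lt : i < e
            lt = ≤∧≢⇒< le ne
          both : ∀ w → valency i w ≤ 1 → spread i B (far i w) ≡ spread i B w
          both w w1 with u ≟ w
          ... | yes refl = trans at-f (sym at-u)
          ... | no u≢w with v ≟ w
          ...   | yes refl = at-g
          ...   | no v≢w with f ≟ w
          ...     | yes refl = trans (cong (spread i B) (back (paths i (<⇒≤ i<m) u u1))) (trans at-u (sym at-f))
          ...     | no f≢w with g ≟ w
          ...       | yes refl = trans (cong (spread i B) (back (paths i (<⇒≤ i<m) v v1))) (sym at-g)
          ...       | no g≢w = trans (cong (spread i B) (sym far-w)) (trans (persists (subst (λ x → valency (suc i) x ≤ 1) (sym far-w) (≤-trans (≤-reflexive (vo u≢w′ v≢w′)) (end p))))
                        (trans (ends ag w w1′) (sym (persists w1′))))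
            where
            w1′ : valency (suc i) w ≤ 1
            w1′ = ≤-trans (≤-reflexive (vo u≢w v≢w)) w1
            open Other w1′ f≢w g≢w using (p; far-w; u≢w′; v≢w′)

      agree-cong : ∀ {i B B′} → (∀ v → B′ v ≡ B v) → Agree i B → Agree i B′
      agree-cong eq ag = record
        { ends = λ v v1 → trans (eq _) (trans (ends ag v v1) (sym (eq v)))
        ; joined = λ le e< me → trans (eq _) (trans (joined ag le e< me) (sym (eq _)))
        ; fixed = λ v1 → trans (eq _) (fixed ag v1) }

      undo : ∀ i B → i < m → Agree (suc i) B → Agree i (λ v → branch (mark i) (spread i B v) (B v))
      undo i B i<m ag with mark i ≟ 0
      ... | no mi = agree-cong (λ v → branch-nonzero mi) (Undo.agree i i<m mi B ag)
      ... | yes mi = agree-cong (λ v → branch-zero mi) (record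
        { ends = λ v v1 → trans (cong B (sym (skip-far v mi))) (ends ag v (≤-trans (≤-reflexive (skip-valency v mi)) v1))
        ; joined = λ {e} le e< me → joined ag (≤∧≢⇒< le λ { refl → me mi }) e< me
        ; fixed = fixed ag })

      bits-agree : (∀ {v} → valency m v ≤ 1 → b₀ (far m v) ≡ b₀ v) → ∀ i → i ≤ m → Agree (m ∸ i) (bits b₀ i)
      bits-agree h zero le = record { ends = λ v v1 → h v1 ; joined = λ le e< _ → ⊥-elim (<⇒≱ e< le) ; fixed = λ _ → refl }
      bits-agree h (suc i) le = undo (m ∸ suc i) (bits b₀ i) (∸-monoʳ-< {m} {suc i} {0} (s≤s z≤n) le)
        (subst (λ x → Agree x (bits b₀ i)) (sym (trans (sym (+-∸-assoc 1 le)) refl)) (bits-agree h i (<⇒≤ le)))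

      bits-joined : (∀ {v} → valency m v ≤ 1 → b₀ (far m v) ≡ b₀ v) → ∀ {e} → e < m → mark e ≢ 0 →
                    bits b₀ m (s e) ≡ bits b₀ m (t e)
      bits-joined h {e} = joined (bits-agree h m ≤-refl) (≤-trans (≤-reflexive (n∸n≡0 m)) z≤n)

      bits-end : (∀ {v} → valency m v ≤ 1 → b₀ (far m v) ≡ b₀ v) → ∀ {v} → valency m v ≤ 1 → bits b₀ m v ≡ b₀ v
      bits-end h = fixed (bits-agree h m ≤-refl)

-- Colourings and their local structure

-- Vertices and edges are plain numbers and `src`, `tgt` total maps, as in the arrays; the axioms on
-- edges are restricted to indices below m.
record Net : Set where
  field
    n m     : ℕ
    src tgt : ℕ → ℕ

  Joins : ℕ → ℕ → ℕ → Set
  Joins e u v = (src e ≡ u × tgt e ≡ v) ⊎ (src e ≡ v × tgt e ≡ u)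

  inc : ℕ → ℕ → Set
  inc e v = src e ≡ v ⊎ tgt e ≡ v

  deg : ℕ → ℕ
  deg v = sum (λ e → ind (src e ≡ᵇ v) + ind (tgt e ≡ᵇ v)) m

  field
    src<     : ∀ {e} → e < m → src e < n
    tgt<     : ∀ {e} → e < m → tgt e < n
    loopless : ∀ {e} → e < m → src e ≢ tgt e
    simple   : ∀ {e f u v} → e < m → f < m → Joins e u v → Joins f u v → e ≡ f

-- A colouring assigns to each edge 0 (uncoloured) or one of the colours 1, …, 8.

swap : ℕ → ℕ → ℕ → ℕ
swap a b c = if a ≡ᵇ c then b else (if b ≡ᵇ c then a else c)

swap-left : ∀ a b → swap a b a ≡ b
swap-left a b rewrite ≡ᵇ-refl a = refl

swap-right : ∀ a b → swap a b b ≡ a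
swap-right a b with a ≟ b
... | yes refl rewrite ≡ᵇ-refl a = refl
... | no ne rewrite ≢⇒≡ᵇ ne | ≡ᵇ-refl b = refl

swap-other : ∀ {a b c} → c ≢ a → c ≢ b → swap a b c ≡ c
swap-other p q rewrite ≢⇒≡ᵇ (p ∘ sym) | ≢⇒≡ᵇ (q ∘ sym) = refl

swap-involutive : ∀ a b c → swap a b (swap a b c) ≡ c
swap-involutive a b c with c ≟ a | c ≟ b
... | yes refl | _ = trans (cong (swap a b) (swap-left a b)) (swap-right a b)
... | no _ | yes refl = trans (cong (swap a b) (swap-right a b)) (swap-left a b)
... | no p | no q = trans (cong (swap a b) (swap-other p q)) (swap-other p q)

lookup₄ : ℕ → ℕ → ℕ → ℕ → ℕ → ℕ
lookup₄ a b c d 0 = a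
lookup₄ a b c d 1 = b
lookup₄ a b c d 2 = c
lookup₄ a b c d _ = d

module Colourings (N : Net) where
  open Net N

  inc? : ∀ e v → Dec (inc e v)
  inc? e v with src e ≟ v | tgt e ≟ v
  ... | yes p | _     = yes (inj₁ p)
  ... | no  _ | yes q = yes (inj₂ q)
  ... | no  p | no  q = no λ { (inj₁ x) → p x ; (inj₂ y) → q y }

  joins-left : ∀ {e u v} → Joins e u v → inc e u
  joins-left (inj₁ (p , q)) = inj₁ p
  joins-left (inj₂ (p , q)) = inj₂ q

  joins-right : ∀ {e u v} → Joins e u v → inc e v
  joins-right (inj₁ (p , q)) = inj₂ q
  joins-right (inj₂ (p , q)) = inj₁ p

  joins-≢ : ∀ {e u v} → e < m → Joins e u v → u ≢ v
  joins-≢ e< (inj₁ (p , q)) eq = loopless e< (trans p (trans eq (sym q)))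
  joins-≢ e< (inj₂ (p , q)) eq = loopless e< (trans p (trans (sym eq) (sym q)))

  joins-two : ∀ {e u v w} → Joins e u v → inc e w → w ≡ u ⊎ w ≡ v
  joins-two (inj₁ (p , q)) (inj₁ x) = inj₁ (trans (sym x) p)
  joins-two (inj₁ (p , q)) (inj₂ x) = inj₂ (trans (sym x) q)
  joins-two (inj₂ (p , q)) (inj₁ x) = inj₂ (trans (sym x) p)
  joins-two (inj₂ (p , q)) (inj₂ x) = inj₁ (trans (sym x) q)

  -- For c = 0 it says that v has an uncoloured edge. With 0 as a ninth value, one pigeonhole
  -- argument treats coloured and uncoloured edges alike.
  Has : (ℕ → ℕ) → ℕ → ℕ → Set
  Has C v c = ∃[ e ] (e < m × inc e v × C e ≡ c)

  has? : ∀ C v c → Dec (Has C v c)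
  has? C v c = anyUpTo? (λ e → dec× (inc? e v) (C e ≟ c)) m
    where
    dec× : ∀ {A B : Set} → Dec A → Dec B → Dec (A × B)
    dec× (yes a) (yes b) = yes (a , b)
    dec× (no ¬a) _       = no (¬a ∘ proj₁)
    dec× (yes _) (no ¬b) = no (¬b ∘ proj₂)

  hasᵇ : (ℕ → ℕ) → ℕ → ℕ → Bool
  hasᵇ C v c = does (has? C v c)

  hasᵇ⁺ : ∀ {C v c} → Has C v c → T (hasᵇ C v c)
  hasᵇ⁺ {C} {v} {c} h with has? C v c
  ... | yes _ = tt
  ... | no ¬h = ⊥-elim (¬h h)

  Proper : (ℕ → ℕ) → Set
  Proper C = ∀ {e f v} → e < m → f < m → e ≢ f → inc e v → inc f v → C e ≡ C f → C e ≡ 0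

  incᵇ : ℕ → ℕ → Bool
  incᵇ e v = does (inc? e v)

  palette≤deg : ∀ C v → count (hasᵇ C v) 9 ≤ deg v
  palette≤deg C v = ≤-trans
    (count-injection {hasᵇ C v} {λ e → incᵇ e v} 9 m edge
      (λ {c} _ t → proj₁ (edge-spec c t) , inc-true (proj₁ (proj₂ (edge-spec c t))))
      (λ {c} {c′} _ _ t t′ eq → trans (sym (proj₂ (proj₂ (edge-spec c t)))) (trans (cong C eq) (proj₂ (proj₂ (edge-spec c′ t′))))))
    (sum-mono m (λ {e} _ → inc≤ e))
    where
    edge : ℕ → ℕ
    edge c with has? C v c
    ... | yes (e , _) = e
    ... | no _ = 0
    edge-spec : ∀ c → T (hasᵇ C v c) → edge c < m × inc (edge c) v × C (edge c) ≡ c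
    edge-spec c t with has? C v c
    ... | yes (e , p) = p
    inc-true : ∀ {e} → inc e v → T (incᵇ e v)
    inc-true {e} i with inc? e v
    ... | yes _ = tt
    ... | no ¬i = ⊥-elim (¬i i)
    inc≤ : ∀ e → ind (incᵇ e v) ≤ ind (src e ≡ᵇ v) + ind (tgt e ≡ᵇ v)
    inc≤ e with inc? e v
    ... | no _ = z≤n
    ... | yes (inj₁ p) = ≤-trans (≤-reflexive (sym (ind-true (≡⇒≡ᵇ _ _ p)))) (m≤m+n _ _)
    ... | yes (inj₂ p) = ≤-trans (≤-reflexive (sym (ind-true (≡⇒≡ᵇ _ _ p)))) (m≤n+m _ (ind (src e ≡ᵇ v)))

  abstract
    -- Nine values compete for at most eight edges. At a vertex with an uncoloured edge the value 0
    -- is taken, so there the result is a true colour.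
    fresh : ∀ C x → deg x ≤ 8 → ∃[ c ] (c < 9 × ¬ Has C x c)
    fresh C x d with count-missing {hasᵇ C x} 9 (s≤s (≤-trans (palette≤deg C x) d))
    ... | c , c< , nt = c , c< , nt ∘ hasᵇ⁺

    -- At most 3 + 3 + 1 of the nine values are excluded.
    fresh₂ : ∀ C y z k → deg y ≤ 3 → deg z ≤ 3 → ∃[ c ] (c < 9 × ¬ Has C y c × ¬ Has C z c × c ≢ k)
    fresh₂ C y z k dy dz with count-missing {used} 9 (s≤s (≤-trans few (s≤s (s≤s (s≤s (s≤s (s≤s (s≤s (s≤s z≤n)))))))))
      where
      used : ℕ → Bool
      used c = if hasᵇ C y c then true else (if hasᵇ C z c then true else (k ≡ᵇ c))
      zk : ℕ → Bool
      zk c = if hasᵇ C z c then true else (k ≡ᵇ c)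
      either : ∀ {N} {P Q : ℕ → Bool} → count (λ c → if P c then true else Q c) N ≤ count P N + count Q N
      either {N} {P} {Q} = count-cover N (λ {c} _ → go (P c))
        where
        go : ∀ {b} a → T (if a then true else b) → T a ⊎ T b
        go true  t = inj₁ t
        go false t = inj₂ t
      single : ∀ N → count (λ c → k ≡ᵇ c) N ≤ 1
      single N = count-injection {λ c → k ≡ᵇ c} {λ _ → true} N 1 (λ _ → 0) (λ _ _ → s≤s z≤n , tt)
        (λ {i} {j} _ _ p q _ → trans (sym (≡ᵇ⇒≡ k i p)) (≡ᵇ⇒≡ k j q))
      few : count used 9 ≤ 7
      few = ≤-trans (either {9} {hasᵇ C y} {zk}) (+-mono-≤ (≤-trans (palette≤deg C y) dy)
        (≤-trans (either {9} {hasᵇ C z} {k ≡ᵇ_}) (+-mono-≤ (≤-trans (palette≤deg C z) dz) (single 9))))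
    ... | c , c< , nt = c , c< , (λ h → nt (left h)) , (λ h → nt (middle h)) , λ { refl → nt right }
      where
      left : Has C y c → T (if hasᵇ C y c then true else (if hasᵇ C z c then true else (k ≡ᵇ c)))
      left h with hasᵇ C y c | hasᵇ⁺ {C} {y} {c} h
      ... | true | _ = tt
      middle : Has C z c → T (if hasᵇ C y c then true else (if hasᵇ C z c then true else (k ≡ᵇ c)))
      middle h with hasᵇ C y c | hasᵇ C z c | hasᵇ⁺ {C} {z} {c} h
      ... | true  | _    | _ = tt
      ... | false | true | _ = tt
      right : T (if hasᵇ C y k then true else (if hasᵇ C z k then true else (k ≡ᵇ k)))
      right with hasᵇ C y k | hasᵇ C z k
      ... | true  | _     = tt
      ... | false | true  = tt
      ... | false | false = ≡⇒≡ᵇ k k refl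

  -- Used at y, where 0, a and the colour of xz exclude a fourth value, and at z, where the colours
  -- of xz and zs together with a do.
  four-colours : ∀ {C v a b c d} → deg v ≤ 3 → (∀ {e} → e < m → C e < 9) → Has C v a → Has C v b → Has C v c → Has C v d →
                 a ≢ b → a ≢ c → a ≢ d → b ≢ c → b ≢ d → c ≢ d → ⊥
  four-colours {C} {v} {a} {b} {c} {d} d3 C< ha hb hc hd ab ac ad bc bd cd =
    <⇒≱ {3} {4} ≤-refl (≤-trans (count-injection {λ _ → true} {hasᵇ C v} 4 9 f (λ {i} lt _ → into i lt) inj) (≤-trans (palette≤deg C v) d3))
    where
    f : ℕ → ℕ
    f = lookup₄ a b c d
    ok : ∀ {c} → Has C v c → c < 9 × T (hasᵇ C v c)
    ok h@(e , e< , _ , eq) = subst (_< 9) eq (C< e<) , hasᵇ⁺ h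
    into : ∀ i → i < 4 → f i < 9 × T (hasᵇ C v (f i))
    into 0 _ = ok ha
    into 1 _ = ok hb
    into 2 _ = ok hc
    into 3 _ = ok hd
    into (suc (suc (suc (suc i)))) (s≤s (s≤s (s≤s (s≤s ()))))
    big : ∀ {A : Set} {i} → suc (suc (suc (suc i))) < 4 → A
    big (s≤s (s≤s (s≤s (s≤s ()))))
    inj : ∀ {i j} → i < 4 → j < 4 → T true → T true → f i ≡ f j → i ≡ j
    inj {0} {0} _ _ _ _ _ = refl
    inj {0} {1} _ _ _ _ e = ⊥-elim (ab e)
    inj {0} {2} _ _ _ _ e = ⊥-elim (ac e)
    inj {0} {3} _ _ _ _ e = ⊥-elim (ad e)
    inj {1} {0} _ _ _ _ e = ⊥-elim (ab (sym e))
    inj {1} {1} _ _ _ _ _ = refl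
    inj {1} {2} _ _ _ _ e = ⊥-elim (bc e)
    inj {1} {3} _ _ _ _ e = ⊥-elim (bd e)
    inj {2} {0} _ _ _ _ e = ⊥-elim (ac (sym e))
    inj {2} {1} _ _ _ _ e = ⊥-elim (bc (sym e))
    inj {2} {2} _ _ _ _ _ = refl
    inj {2} {3} _ _ _ _ e = ⊥-elim (cd e)
    inj {3} {0} _ _ _ _ e = ⊥-elim (ad (sym e))
    inj {3} {1} _ _ _ _ e = ⊥-elim (bd (sym e))
    inj {3} {2} _ _ _ _ e = ⊥-elim (cd (sym e))
    inj {3} {3} _ _ _ _ _ = refl
    inj {suc (suc (suc (suc i)))} lt _ _ _ _ = big lt
    inj {_} {suc (suc (suc (suc i)))} _ lt _ _ _ = big lt

-- The edges e, xz, xs and zs join x y, x z, x s and z s, and a is a colour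
-- missing at x.

record Site (N : Net) : Set where
  constructor site
  field
    e x y z xz xs zs a : ℕ

module Sites (N : Net) where
  open Net N
  open Colourings N public
  open Site

  record Geometry (σ : Site N) : Set where
    field
      e<  : e σ < m
      xz< : xz σ < m
      xs< : xs σ < m
      zs< : zs σ < m
      s   : ℕ
      je  : Joins (e σ) (x σ) (y σ)
      jxz : Joins (xz σ) (x σ) (z σ)
      jxs : Joins (xs σ) (x σ) s
      jzs : Joins (zs σ) (z σ) s
      dy  : deg (y σ) ≤ 3
      dz  : deg (z σ) ≤ 3

  record Waiting (σ : Site N) (C : ℕ → ℕ) : Set where
    field
      open-e   : C (e σ) ≡ 0
      xz≢0     : C (xz σ) ≢ 0
      xs≢0     : C (xs σ) ≢ 0
      zs≢0     : C (zs σ) ≢ 0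
      a-absent : ¬ Has C (x σ) (a σ)
      a<9      : a σ < 9

  -- While the edge is uncoloured, 0 is present at x, so c is a true colour.
  Free : Site N → (ℕ → ℕ) → Set
  Free σ C = ∃[ c ] (c < 9 × ¬ Has C (x σ) c × ¬ Has C (y σ) c)

  -- The last condition ensures that exchanging a and b at z neither brings the colour of xs to z
  -- nor takes it away.
  Fresh : Site N → (ℕ → ℕ) → ℕ → Set
  Fresh σ C b = b < 9 × ¬ Has C (y σ) b × ¬ Has C (z σ) b × b ≢ C (xs σ)

  -- The number of exchanges of chains after which xy can be coloured at the latest.
  data Rank (σ : Site N) (C : ℕ → ℕ) : ℕ → Set where
    α₁ : ¬ Has C (y σ) (C (xz σ)) → ¬ Has C (z σ) (a σ) → Rank σ C 1
    α₂ : ¬ Has C (y σ) (C (xz σ)) → Has C (z σ) (a σ) → Rank σ C 2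
    β₁ : Has C (y σ) (C (xz σ)) → C (zs σ) ≡ a σ → ¬ Has C (z σ) (C (xs σ)) → Rank σ C 1
    β₂ : Has C (y σ) (C (xz σ)) → ¬ Has C (z σ) (a σ) → ¬ Has C (z σ) (C (xs σ)) → Rank σ C 2
    β₃ : Has C (y σ) (C (xz σ)) → Has C (z σ) (a σ) → C (zs σ) ≢ a σ → Rank σ C 3
    β₄ : Has C (y σ) (C (xz σ)) → ¬ Has C (z σ) (a σ) → Has C (z σ) (C (xs σ)) → Rank σ C 4
    β₅ : Has C (y σ) (C (xz σ)) → C (zs σ) ≡ a σ → Has C (z σ) (C (xs σ)) → Rank σ C 5

  -- The colours b such that the exchange of a and b lowers the rank or frees a at y.
  Partner : ∀ {σ C ρ} → Rank σ C ρ → ℕ → Set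
  Partner {σ} {C} (α₁ _ _)   b = b ≡ C (xz σ)
  Partner {σ} {C} (α₂ _ _)   b = Fresh σ C b
  Partner {σ} {C} (β₁ _ _ _) b = b ≡ C (xs σ)
  Partner {σ} {C} (β₂ _ _ _) b = b ≡ C (zs σ)
  Partner {σ} {C} (β₃ _ _ _) b = Fresh σ C b
  Partner {σ} {C} (β₄ _ _ _) b = b ≡ C (xs σ)
  Partner {σ} {C} (β₅ _ _ _) b = Fresh σ C b

  -- The α cases aim at the chain xz, the β cases at the path x s z. Exchanges at z lead from α₂ to
  -- α₁, or down from β₅ to β₁ one case at a time; an edge may start in any case.
  rank : ∀ σ C → ∃[ ρ ] (ρ ≤ 5 × Rank σ C ρ)
  rank σ C with has? C (y σ) (C (xz σ)) | has? C (z σ) (a σ) | has? C (z σ) (C (xs σ)) | C (zs σ) ≟ a σ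
  ... | no hy  | no hz  | _     | _     = 1 , s≤s z≤n , α₁ hy hz
  ... | no hy  | yes hz | _     | _     = 2 , s≤s (s≤s z≤n) , α₂ hy hz
  ... | yes hy | _      | no k  | yes d = 1 , s≤s z≤n , β₁ hy d k
  ... | yes hy | _      | yes k | yes d = 5 , ≤-refl , β₅ hy d k
  ... | yes hy | yes hz | _     | no d  = 3 , s≤s (s≤s (s≤s z≤n)) , β₃ hy hz d
  ... | yes hy | no hz  | no k  | no d  = 2 , s≤s (s≤s z≤n) , β₂ hy hz k
  ... | yes hy | no hz  | yes k | no d  = 4 , s≤s (s≤s (s≤s (s≤s z≤n))) , β₄ hy hz k

  -- The vertex s is left out: of its edges only xs and zs matter, and these are also edges at x and
  -- z.
  Near : Site N → ℕ → Set
  Near σ f = inc f (x σ) ⊎ inc f (y σ) ⊎ inc f (z σ)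

  module _ {σ : Site N} (g : Geometry σ) where
    open Geometry g

    e-y : inc (e σ) (y σ)
    e-y = joins-right je
    e-x : inc (e σ) (x σ)
    e-x = joins-left je
    xz-x : inc (xz σ) (x σ)
    xz-x = joins-left jxz
    xz-z : inc (xz σ) (z σ)
    xz-z = joins-right jxz
    xs-x : inc (xs σ) (x σ)
    xs-x = joins-left jxs
    zs-z : inc (zs σ) (z σ)
    zs-z = joins-left jzs

    x≢y : x σ ≢ y σ
    x≢y = joins-≢ e< je
    x≢z : x σ ≢ z σ
    x≢z = joins-≢ xz< jxz
    xs≢zs : xs σ ≢ zs σ
    xs≢zs eq with joins-two jzs (subst (λ f → inc f (x σ)) eq xs-x)
    ... | inj₁ p = x≢z p
    ... | inj₂ p = joins-≢ xs< jxs p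
    xz≢xs : xz σ ≢ xs σ
    xz≢xs eq with joins-two jxs (subst (λ f → inc f (z σ)) eq xz-z)
    ... | inj₁ p = x≢z (sym p)
    ... | inj₂ p = joins-≢ zs< jzs p
    xz≢zs : xz σ ≢ zs σ
    xz≢zs eq with joins-two jzs (subst (λ f → inc f (x σ)) eq xz-x)
    ... | inj₁ p = x≢z p
    ... | inj₂ p = joins-≢ xs< jxs p

    transfer : ∀ {C C′ v} → (∀ {f} → f < m → inc f v → C′ f ≡ C f) → ∀ {c} → Has C′ v c → Has C v c
    transfer same (f , f< , i , eq) = f , f< , i , trans (sym (same f< i)) eq

    module _ {C C′ : ℕ → ℕ} (same : ∀ {f} → f < m → Near σ f → C′ f ≡ C f) where
      private
        to-x : ∀ {c} → Has C′ (x σ) c → Has C (x σ) c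
        to-x = transfer (λ f< i → same f< (inj₁ i))
        to-y : ∀ {c} → Has C′ (y σ) c → Has C (y σ) c
        to-y = transfer (λ f< i → same f< (inj₂ (inj₁ i)))
        to-z : ∀ {c} → Has C′ (z σ) c → Has C (z σ) c
        to-z = transfer (λ f< i → same f< (inj₂ (inj₂ i)))
        from-y : ∀ {c} → Has C (y σ) c → Has C′ (y σ) c
        from-y = transfer (λ f< i → sym (same f< (inj₂ (inj₁ i))))
        from-z : ∀ {c} → Has C (z σ) c → Has C′ (z σ) c
        from-z = transfer (λ f< i → sym (same f< (inj₂ (inj₂ i))))
        exz : C′ (xz σ) ≡ C (xz σ)
        exz = same xz< (inj₁ xz-x)
        exs : C′ (xs σ) ≡ C (xs σ)
        exs = same xs< (inj₁ xs-x)
        ezs : C′ (zs σ) ≡ C (zs σ)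
        ezs = same zs< (inj₂ (inj₂ zs-z))
        ¬y : ¬ Has C (y σ) (C (xz σ)) → ¬ Has C′ (y σ) (C′ (xz σ))
        ¬y h h′ = h (to-y (subst (Has C′ (y σ)) exz h′))
        ⁺y : Has C (y σ) (C (xz σ)) → Has C′ (y σ) (C′ (xz σ))
        ⁺y h = subst (Has C′ (y σ)) (sym exz) (from-y h)
        ¬k : ¬ Has C (z σ) (C (xs σ)) → ¬ Has C′ (z σ) (C′ (xs σ))
        ¬k h h′ = h (to-z (subst (Has C′ (z σ)) exs h′))
        ⁺k : Has C (z σ) (C (xs σ)) → Has C′ (z σ) (C′ (xs σ))
        ⁺k h = subst (Has C′ (z σ)) (sym exs) (from-z h)

      Rank-local : ∀ {ρ} → Rank σ C ρ → Rank σ C′ ρ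
      Rank-local (α₁ p q)   = α₁ (¬y p) (q ∘ to-z)
      Rank-local (α₂ p q)   = α₂ (¬y p) (from-z q)
      Rank-local (β₁ p q r) = β₁ (⁺y p) (trans ezs q) (¬k r)
      Rank-local (β₂ p q r) = β₂ (⁺y p) (q ∘ to-z) (¬k r)
      Rank-local (β₃ p q r) = β₃ (⁺y p) (from-z q) (r ∘ trans (sym ezs))
      Rank-local (β₄ p q r) = β₄ (⁺y p) (q ∘ to-z) (⁺k r)
      Rank-local (β₅ p q r) = β₅ (⁺y p) (trans ezs q) (⁺k r)

      Waiting-local : Waiting σ C → Waiting σ C′
      Waiting-local w = record
        { open-e = trans (same e< (inj₁ e-x)) open-e
        ; xz≢0 = xz≢0 ∘ trans (sym exz) ; xs≢0 = xs≢0 ∘ trans (sym exs) ; zs≢0 = zs≢0 ∘ trans (sym ezs)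
        ; a-absent = a-absent ∘ to-x ; a<9 = a<9 }
        where open Waiting w

    module _ {C : ℕ → ℕ} (C< : ∀ {f} → f < m → C f < 9) (pr : Proper C) (w : Waiting σ C) where
      open Waiting w

      -- In a simple graph y = z would identify xz, which is coloured, with xy, which is not.
      y≢z : y σ ≢ z σ
      y≢z eq = xz≢0 (trans (cong C (sym (simple e< xz< je (subst (Joins (xz σ) (x σ)) (sym eq) jxz)))) open-e)

      r≢k : C (xz σ) ≢ C (xs σ)
      r≢k eq = xz≢0 (pr xz< xs< xz≢xs xz-x xs-x eq)
      r≢d : C (xz σ) ≢ C (zs σ)
      r≢d eq = xz≢0 (pr xz< zs< xz≢zs xz-z zs-z eq)
      k≢d : C (xs σ) ≢ C (zs σ)
      k≢d eq = xs≢0 (pr xs< zs< xs≢zs (joins-right jxs) (joins-right jzs) eq)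
      r≢a : C (xz σ) ≢ a σ
      r≢a eq = a-absent (xz σ , xz< , xz-x , eq)
      k≢a : C (xs σ) ≢ a σ
      k≢a eq = a-absent (xs σ , xs< , xs-x , eq)
      a≢0 : a σ ≢ 0
      a≢0 eq = a-absent (e σ , e< , e-x , trans open-e (sym eq))
      y-has-0 : Has C (y σ) 0
      y-has-0 = e σ , e< , e-y , open-e
      z-has-r : Has C (z σ) (C (xz σ))
      z-has-r = xz σ , xz< , xz-z , refl
      z-has-d : Has C (z σ) (C (zs σ))
      z-has-d = zs σ , zs< , zs-z , refl

      module Stuck (stuck : ¬ Free σ C) where
        y-has-a : Has C (y σ) (a σ)
        y-has-a with has? C (y σ) (a σ)
        ... | yes h = h
        ... | no ¬h = ⊥-elim (stuck (a σ , a<9 , a-absent , ¬h))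

        -- In a β case the three places at y are taken by 0, by a, since the edge is stuck, and by
        -- the colour of xz.
        y-only : ∀ {c} → Has C (y σ) (C (xz σ)) → c ≢ 0 → a σ ≢ c → C (xz σ) ≢ c → ¬ Has C (y σ) c
        y-only hr c≢0 a≢c r≢c hc = four-colours dy C< y-has-0 y-has-a hr hc (a≢0 ∘ sym) (xz≢0 ∘ sym) (c≢0 ∘ sym) (r≢a ∘ sym) a≢c r≢c

        -- The vertices x, y and z are ends of chains in the two colours a and b.
        record Ends (b : ℕ) : Set where
          field
            b<9 : b < 9
            b≢0 : b ≢ 0
            a≢b : a σ ≢ b
            y∌b : ¬ Has C (y σ) b
            z∌  : ¬ Has C (z σ) (a σ) ⊎ ¬ Has C (z σ) b

        fresh-ends : ∀ {b} → Fresh σ C b → Ends b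
        fresh-ends (b< , y∌ , z∌ , _) = record
          { b<9 = b< ; b≢0 = λ eq → y∌ (subst (Has C (y σ)) (sym eq) y-has-0) ; a≢b = λ eq → y∌ (subst (Has C (y σ)) eq y-has-a)
          ; y∌b = y∌ ; z∌ = inj₂ z∌ }

        partner-ends : ∀ {ρ b} (rk : Rank σ C ρ) → Partner rk b → Ends b
        partner-ends (α₁ p q) refl = record { b<9 = C< xz< ; b≢0 = xz≢0 ; a≢b = r≢a ∘ sym ; y∌b = p ; z∌ = inj₁ q }
        partner-ends (α₂ p q) fr = fresh-ends fr
        partner-ends (β₁ p q r) refl = record
          { b<9 = C< xs< ; b≢0 = xs≢0 ; a≢b = k≢a ∘ sym ; y∌b = y-only p xs≢0 (k≢a ∘ sym) r≢k ; z∌ = inj₂ r }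
        partner-ends (β₂ p q r) refl = record
          { b<9 = C< zs< ; b≢0 = zs≢0 ; a≢b = a≢d ; y∌b = y-only p zs≢0 a≢d r≢d ; z∌ = inj₁ q }
          where
          a≢d : a σ ≢ C (zs σ)
          a≢d eq = q (subst (Has C (z σ)) (sym eq) z-has-d)
        partner-ends (β₃ p q r) fr = fresh-ends fr
        partner-ends (β₄ p q r) refl = record
          { b<9 = C< xs< ; b≢0 = xs≢0 ; a≢b = k≢a ∘ sym ; y∌b = y-only p xs≢0 (k≢a ∘ sym) r≢k ; z∌ = inj₁ q }
        partner-ends (β₅ p q r) fr = fresh-ends fr

  module Swapping {C : ℕ → ℕ} (C< : ∀ {f} → f < m → C f < 9) (pr : Proper C) {a b : ℕ} (a<9 : a < 9) (b<9 : b < 9) (a≢0 : a ≢ 0) (b≢0 : b ≢ 0)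
                  (B : ℕ → ℕ) (even : ∀ {f} → f < m → C f ≡ a ⊎ C f ≡ b → B (src f) ≡ B (tgt f))
                  {C′ : ℕ → ℕ} (def : ∀ {f} → f < m → C′ f ≡ branch (B (src f)) (swap a b (C f)) (C f)) where

    -- An edge coloured a or b has equal bits at its ends, and any other colour is fixed by the
    -- swap, so either end may decide. Hence at each vertex the new colours are the old ones under a
    -- permutation that fixes 0, and properness survives.
    at : ∀ {f v} → f < m → inc f v → C′ f ≡ branch (B v) (swap a b (C f)) (C f)
    at f< (inj₁ refl) = def f<
    at {f} f< (inj₂ refl) with C f ≟ a | C f ≟ b
    ... | yes p | _ = trans (def f<) (cong (λ t → branch t (swap a b (C f)) (C f)) (even f< (inj₁ p)))
    ... | no _ | yes q = trans (def f<) (cong (λ t → branch t (swap a b (C f)) (C f)) (even f< (inj₂ q)))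
    ... | no p | no q = trans (def f<) (trans (stay (B (src f))) (sym (stay (B (tgt f)))))
      where
      stay : ∀ t → branch t (swap a b (C f)) (C f) ≡ C f
      stay t = branch-elim (_≡ C f) t (λ _ → swap-other p q) (λ _ → refl)

    swap<9 : ∀ {c} → c < 9 → swap a b c < 9
    swap<9 {c} c< with c ≟ a | c ≟ b
    ... | yes refl | _ = subst (_< 9) (sym (swap-left a b)) b<9
    ... | no _ | yes refl = subst (_< 9) (sym (swap-right a b)) a<9
    ... | no p | no q = subst (_< 9) (sym (swap-other p q)) c<

    C′< : ∀ {f} → f < m → C′ f < 9
    C′< {f} f< = subst (_< 9) (sym (def f<)) (branch-elim (_< 9) (B (src f)) (λ _ → swap<9 (C< f<)) (λ _ → C< f<))

    zero⁺ : ∀ {f} → f < m → C f ≡ 0 → C′ f ≡ 0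
    zero⁺ {f} f< eq = trans (def f<) (branch-elim (_≡ 0) (B (src f)) (λ _ → trans (cong (swap a b) eq) (swap-other (a≢0 ∘ sym) (b≢0 ∘ sym))) (λ _ → eq))

    back : ∀ {f c} t → c ≡ branch t (swap a b (C f)) (C f) → C f ≡ branch t (swap a b c) c
    back {f} zero refl = refl
    back {f} (suc t) refl = sym (swap-involutive a b (C f))

    zero⁻ : ∀ {f} → f < m → C′ f ≡ 0 → C f ≡ 0
    zero⁻ {f} f< eq = trans (back (B (src f)) (def f<)) (branch-elim (_≡ 0) (B (src f))
      (λ _ → trans (cong (swap a b) eq) (swap-other (a≢0 ∘ sym) (b≢0 ∘ sym))) (λ _ → eq))

    proper′ : Proper C′
    proper′ {f} {h} {v} f< h< ne i j eq = zero⁺ f< (pr f< h< ne i j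
      (trans (back (B v) (at f< i)) (trans (cong (λ c → branch (B v) (swap a b c) c) eq) (sym (back (B v) (at h< j))))))

    kept : ∀ {f v} → f < m → inc f v → B v ≡ 0 → C′ f ≡ C f
    kept f< i z = trans (at f< i) (branch-zero z)

    swapped : ∀ {f v} → f < m → inc f v → B v ≢ 0 → C′ f ≡ swap a b (C f)
    swapped f< i nz = trans (at f< i) (branch-nonzero nz)

    has-kept⁻ : ∀ {v c} → B v ≡ 0 → Has C′ v c → Has C v c
    has-kept⁻ z (f , f< , i , eq) = f , f< , i , trans (sym (kept f< i z)) eq
    has-kept⁺ : ∀ {v c} → B v ≡ 0 → Has C v c → Has C′ v c
    has-kept⁺ z (f , f< , i , eq) = f , f< , i , trans (kept f< i z) eq
    has-swapped⁻ : ∀ {v c c′} → B v ≢ 0 → swap a b c ≡ c′ → Has C′ v c → Has C v c′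
    has-swapped⁻ {c = c} nz e (f , f< , i , eq) = f , f< , i ,
      trans (sym (swap-involutive a b (C f))) (trans (cong (swap a b) (trans (sym (swapped f< i nz)) eq)) e)
    has-swapped⁺ : ∀ {v c c′} → B v ≢ 0 → swap a b c ≡ c′ → Has C v c′ → Has C′ v c
    has-swapped⁺ {c = c} nz e (f , f< , i , eq) = f , f< , i ,
      trans (swapped f< i nz) (trans (cong (swap a b) (trans eq (sym e))) (swap-involutive a b c))

  module Progress {σ : Site N} (g : Geometry σ) {C : ℕ → ℕ} (C< : ∀ {f} → f < m → C f < 9) (pr : Proper C) (w : Waiting σ C) (stuck : ¬ Free σ C)
                  {ρ b : ℕ} (rk : Rank σ C ρ) (partner : Partner rk b)
                  (B : ℕ → ℕ) (even : ∀ {f} → f < m → C f ≡ a σ ⊎ C f ≡ b → B (src f) ≡ B (tgt f))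
                  {C′ : ℕ → ℕ} (def : ∀ {f} → f < m → C′ f ≡ branch (B (src f)) (swap (a σ) b (C f)) (C f))
                  (Bx : B (x σ) ≡ 0) where
    open Geometry g
    open Waiting w
    open Stuck g C< pr w stuck
    open Ends (partner-ends rk partner)
    open Swapping C< pr a<9 b<9 (a≢0 g C< pr w) b≢0 B even def

    waiting′ : Waiting σ C′
    waiting′ = record
      { open-e = zero⁺ e< open-e
      ; xz≢0 = xz≢0 ∘ zero⁻ xz< ; xs≢0 = xs≢0 ∘ zero⁻ xs< ; zs≢0 = zs≢0 ∘ zero⁻ zs<
      ; a-absent = a-absent ∘ has-kept⁻ Bx ; a<9 = a<9 }

    -- y lacks b, so after the exchange it lacks a, which is still missing at x.
    free-y : B (y σ) ≢ 0 → Free σ C′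
    free-y By = a σ , a<9 , a-absent ∘ has-kept⁻ Bx , y∌b ∘ has-swapped⁻ By (swap-left (a σ) b)

    even′ : ∀ {f u v} → f < m → Joins f u v → C f ≡ a σ ⊎ C f ≡ b → B u ≡ B v
    even′ f< (inj₁ (refl , refl)) c = even f< c
    even′ f< (inj₂ (refl , refl)) c = sym (even f< c)

    -- Applied when y is the other end of the kept chain of x. The colours at x and y and of xz and
    -- xs then stay as they are, while at z the colours a and b trade places.
    lower : B (y σ) ≡ 0 → B (z σ) ≢ 0 → ∃[ ρ′ ] (ρ ≡ suc ρ′ × Rank σ C′ ρ′)
    lower By Bz = go rk partner refl
      where
      exz : C′ (xz σ) ≡ C (xz σ)
      exz = kept xz< (xz-x g) Bx
      exs : C′ (xs σ) ≡ C (xs σ)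
      exs = kept xs< (xs-x g) Bx
      ezs : C′ (zs σ) ≡ swap (a σ) b (C (zs σ))
      ezs = swapped zs< (zs-z g) Bz
      ¬y : ¬ Has C (y σ) (C (xz σ)) → ¬ Has C′ (y σ) (C′ (xz σ))
      ¬y h h′ = h (has-kept⁻ By (subst (Has C′ (y σ)) exz h′))
      ⁺y : Has C (y σ) (C (xz σ)) → Has C′ (y σ) (C′ (xz σ))
      ⁺y h = subst (Has C′ (y σ)) (sym exz) (has-kept⁺ By h)
      za⁻ : ¬ Has C (z σ) b → ¬ Has C′ (z σ) (a σ)
      za⁻ h h′ = h (has-swapped⁻ Bz (swap-left (a σ) b) h′)
      za⁺ : Has C (z σ) b → Has C′ (z σ) (a σ)
      za⁺ h = has-swapped⁺ Bz (swap-left (a σ) b) h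
      zk⁻ : C (xs σ) ≢ b → ¬ Has C (z σ) (C (xs σ)) → ¬ Has C′ (z σ) (C′ (xs σ))
      zk⁻ ne h h′ = h (has-swapped⁻ Bz (swap-other (k≢a g C< pr w) ne) (subst (Has C′ (z σ)) exs h′))
      zk⁺ : C (xs σ) ≢ b → Has C (z σ) (C (xs σ)) → Has C′ (z σ) (C′ (xs σ))
      zk⁺ ne h = subst (Has C′ (z σ)) (sym exs) (has-swapped⁺ Bz (swap-other (k≢a g C< pr w) ne) h)
      go : ∀ {ρ} (rk : Rank σ C ρ) → Partner rk b → ∀ {ρ₀} → ρ₀ ≡ ρ → ∃[ ρ′ ] (ρ₀ ≡ suc ρ′ × Rank σ C′ ρ′)
      -- In the cases α₁ and β₁ the chain of x is xz or xsz.
      go (α₁ p q) eq _ = ⊥-elim (Bz (trans (sym (even′ xz< jxz (inj₂ (sym eq)))) Bx))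
      go (α₂ p q) (_ , _ , z∌ , _) refl = 1 , refl , α₁ (¬y p) (za⁻ z∌)
      go (β₁ p q r) eq _ = ⊥-elim (Bz (trans (even′ zs< jzs (inj₁ q)) (trans (sym (even′ xs< jxs (inj₂ (sym eq)))) Bx)))
      go (β₂ p q r) eq refl = 1 , refl , β₁ (⁺y p)
        (trans ezs (trans (cong (swap (a σ) b) (sym eq)) (swap-right (a σ) b)))
        (zk⁻ (λ e → k≢d g C< pr w (trans e eq)) r)
      -- The three edges at z have the colour of xz, the colour of zs and a, so the colour of xs is
      -- absent from z before the exchange.
      go (β₃ p q r) (_ , _ , z∌ , b≢k) refl = 2 , refl , β₂ (⁺y p) (za⁻ z∌)
        (zk⁻ (b≢k ∘ sym) λ hk → four-colours dz C< (z-has-r g C< pr w) (z-has-d g C< pr w) q hk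
          (r≢d g C< pr w) (r≢a g C< pr w) (r≢k g C< pr w) r (k≢d g C< pr w ∘ sym) (k≢a g C< pr w ∘ sym))
      -- If zs now had the colour a, its colour before was b, the colour of xs; but xs and zs meet
      -- in s.
      go (β₄ p q r) eq refl = 3 , refl , β₃ (⁺y p) (za⁺ (subst (Has C (z σ)) (sym eq) r))
        (λ e → k≢d g C< pr w (trans (sym eq) (trans (sym (swap-left (a σ) b)) (trans (cong (swap (a σ) b) (trans (sym e) ezs)) (swap-involutive (a σ) b (C (zs σ)))))))
      go (β₅ p q r) (_ , _ , z∌ , b≢k) refl = 4 , refl , β₄ (⁺y p) (za⁻ z∌) (zk⁺ (b≢k ∘ sym) r)

-- The algorithm

times : ℕ → Ex → Ex
times zero    e = con 0
times (suc k) e = e ⊞ times k e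

infix 6 _≠ₓ_

-- Subtraction is truncated, so the sum of both differences vanishes exactly at equality; a tree can
-- test this.
_≠ₓ_ : Ex → Ex → Ex
e ≠ₓ f = (e ⊟ f) ⊞ (f ⊟ e)

-- Row v, column c of a table with nine columns, for the uncoloured state 0 and the colours 1 to 8.
entry : Ex → Ex → Ex
entry v c = times 9 v ⊞ c

upTo : ℕ → List ℕ
upTo zero    = []
upTo (suc k) = k ∷ upTo k

-- A test accepts by being zero; the answer 0 stands for failure.
firstOf : List ℕ → (ℕ → Ex) → Tree
firstOf []       test = num 0
firstOf (c ∷ cs) test = test c ⟪ firstOf cs test ∣ num c ⟫

abstract
  colours : List ℕ
  colours = upTo 9

zeros : Arr → (ℕ → Ex) → List ℕ → Body
zeros k f []       = []
zeros k f (c ∷ cs) = (k [ f c ]≔ num 0) ∷ zeros k f cs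

loadB degreesB resetB blankB untallyB fillB colourB requestB tallyB markB linkB mateB selectB spreadB recolourB : Body

loadB = (Src [ ix ]≔ input 0F) ∷ (Tgt [ ix ]≔ input 1F) ∷ (InW [ ix ]≔ input 2F) ∷ (Act [ ix ]≔ input 2F) ∷
  (Col [ ix ]≔ input 3F) ∷ []

degreesB = (Deg [ Src ⟨ ix ⟩ ]≔ Deg ⟨ Src ⟨ ix ⟩ ⟩+ 1) ∷ (Deg [ Tgt ⟨ ix ⟩ ]≔ Deg ⟨ Tgt ⟨ ix ⟩ ⟩+ 1) ∷ []

resetB = (Far [ ix ]≔ index+ 0) ∷ (Lock [ ix ]≔ num 0) ∷ (Bit [ ix ]≔ num 0) ∷ (Best [ con 0 ]≔ num 0) ∷
  -- Any two distinct nonzero colours would do: the pair has to be `Valid` even when no edge is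
  -- active.
  (BestA [ con 0 ]≔ num 1) ∷ (BestB [ con 0 ]≔ num 2) ∷ []

blankB = zeros Edg (λ c → entry ix (con c)) (upTo 9)

-- Every body runs inside a loop, so the 81 counters are cleared once for each vertex; this is why
-- `untally-spec` asks for 0 < n.
untallyB = zeros Cnt con (upTo 81)

fillB =
  (Edg [ entry (Src ⟨ ix ⟩) (Col ⟨ ix ⟩) ]≔ index+ 1) ∷ (Nbr [ entry (Src ⟨ ix ⟩) (Col ⟨ ix ⟩) ]≔ Tgt ⟨ ix ⟩+ 0) ∷
  (Edg [ entry (Tgt ⟨ ix ⟩) (Col ⟨ ix ⟩) ]≔ index+ 1) ∷ (Nbr [ entry (Tgt ⟨ ix ⟩) (Col ⟨ ix ⟩) ]≔ Src ⟨ ix ⟩+ 0) ∷ []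

-- The entry for an uncoloured edge is stored under 0, so 0 is never found here
-- when edge ix is uncoloured.
colourB =
  (Col [ ix ]≔ Act ⟨ ix ⟩ ⟪ firstOf colours (λ c → Edg ⟨ entry (Vx ⟨ ix ⟩) (con c) ⟩ ⊞ Edg ⟨ entry (Vy ⟨ ix ⟩) (con c) ⟩) ∣ Col ⟨ ix ⟩+ 0 ⟫) ∷
  (Act [ ix ]≔ Act ⟨ ix ⟩ ⟪ Col ⟨ ix ⟩ ⟪ num 0 ∣ num 1 ⟫ ∣ num 0 ⟫) ∷ []

-- The branches follow the cases of `Rank`, except that β₃ and β₅ share one: a occurs at z, and
-- either zs has another colour or the colour of xs occurs at z.
freshT wantT : Tree
freshT = firstOf colours λ c →
  Edg ⟨ entry (Vy ⟨ ix ⟩) (con c) ⟩ ⊞ Edg ⟨ entry (Vz ⟨ ix ⟩) (con c) ⟩ ⊞ (con 1 ⊟ (con c ≠ₓ Col ⟨ Exs ⟨ ix ⟩ ⟩))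
wantT = Edg ⟨ entry (Vy ⟨ ix ⟩) (Col ⟨ Exz ⟨ ix ⟩ ⟩) ⟩
  ⟪ Edg ⟨ entry (Vz ⟨ ix ⟩) (Miss ⟨ ix ⟩) ⟩
    ⟪ (Col ⟨ Ezs ⟨ ix ⟩ ⟩ ≠ₓ Miss ⟨ ix ⟩) ⊞ Edg ⟨ entry (Vz ⟨ ix ⟩) (Col ⟨ Exs ⟨ ix ⟩ ⟩) ⟩
      ⟪ freshT ∣ Col ⟨ Exs ⟨ ix ⟩ ⟩+ 0 ⟫
    ∣ Edg ⟨ entry (Vz ⟨ ix ⟩) (Col ⟨ Exs ⟨ ix ⟩ ⟩) ⟩ ⟪ Col ⟨ Exs ⟨ ix ⟩ ⟩+ 0 ∣ Col ⟨ Ezs ⟨ ix ⟩ ⟩+ 0 ⟫ ⟫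
  ∣ Edg ⟨ entry (Vz ⟨ ix ⟩) (Miss ⟨ ix ⟩) ⟩ ⟪ freshT ∣ Col ⟨ Exz ⟨ ix ⟩ ⟩+ 0 ⟫ ⟫

requestB = (Want [ ix ]≔ wantT) ∷ []

keyₓ : Ex
keyₓ = entry (Miss ⟨ ix ⟩) (Want ⟨ ix ⟩)

ifRecord : Tree → Tree → Tree
ifRecord t u = Act ⟨ ix ⟩ ⟪ Cnt ⟨ keyₓ ⟩ ⊟ Best ⟨ con 0 ⟩ ⟪ t ∣ u ⟫ ∣ u ⟫

tallyB =
  (Cnt [ keyₓ ]≔ Act ⟨ ix ⟩ ⟪ Cnt ⟨ keyₓ ⟩+ 1 ∣ Cnt ⟨ keyₓ ⟩+ 0 ⟫) ∷
  (BestA [ con 0 ]≔ ifRecord (Miss ⟨ ix ⟩+ 0) (BestA ⟨ con 0 ⟩+ 0)) ∷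
  (BestB [ con 0 ]≔ ifRecord (Want ⟨ ix ⟩+ 0) (BestB ⟨ con 0 ⟩+ 0)) ∷
  -- Overwritten last, since all three uses of `ifRecord` compare with the old value of `Best`.
  (Best [ con 0 ]≔ ifRecord (Cnt ⟨ keyₓ ⟩+ 0) (Best ⟨ con 0 ⟩+ 0)) ∷ []

markB = (Pair [ ix ]≔ Col ⟨ ix ⟩ ≠ₓ BestA ⟨ con 0 ⟩ ⟪ Col ⟨ ix ⟩ ≠ₓ BestB ⟨ con 0 ⟩ ⟪ num 0 ∣ num 1 ⟫ ∣ num 1 ⟫) ∷ []

-- The two ends are saved before `Far` changes. `spreadB` needs them again in this form, as they
-- were just before the insertion.
linkB = (F1 [ ix ]≔ Far ⟨ Src ⟨ ix ⟩ ⟩+ 0) ∷ (F2 [ ix ]≔ Far ⟨ Tgt ⟨ ix ⟩ ⟩+ 0) ∷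
  (Far [ F1 ⟨ ix ⟩ ]≔ Pair ⟨ ix ⟩ ⟪ F2 ⟨ ix ⟩+ 0 ∣ Far ⟨ F1 ⟨ ix ⟩ ⟩+ 0 ⟫) ∷
  (Far [ F2 ⟨ ix ⟩ ]≔ Pair ⟨ ix ⟩ ⟪ F1 ⟨ ix ⟩+ 0 ∣ Far ⟨ F2 ⟨ ix ⟩ ⟩+ 0 ⟫) ∷ []

-- The vertex whose chain is to be exchanged: y, unless y ends the chain of x.
mateB = (Mate [ ix ]≔ Far ⟨ Vx ⟨ ix ⟩ ⟩ ≠ₓ Vy ⟨ ix ⟩ ⟪ Vy ⟨ ix ⟩+ 0 ∣ Vz ⟨ ix ⟩+ 0 ⟫) ∷ []

raise : Arr → Ex → Assign
raise k e = k [ e ]≔ Act ⟨ ix ⟩ ⟪ num 1 ∣ k ⟨ e ⟩+ 0 ⟫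

selectB =
  -- The verdict comes first, since every `raise` below reads the new `Act`; a denied edge changes
  -- no bit and no lock.
  (Act [ ix ]≔ Act ⟨ ix ⟩ ⟪ (Miss ⟨ ix ⟩ ≠ₓ BestA ⟨ con 0 ⟩) ⊞ (Want ⟨ ix ⟩ ≠ₓ BestB ⟨ con 0 ⟩) ⊞ Lock ⟨ Vx ⟨ ix ⟩ ⟩ ⊞ Lock ⟨ Mate ⟨ ix ⟩ ⟩
                           ⟪ num 0 ∣ num 1 ⟫ ∣ num 0 ⟫) ∷
  raise Bit (Mate ⟨ ix ⟩) ∷ raise Bit (Far ⟨ Mate ⟨ ix ⟩ ⟩) ∷
  raise Lock (Vx ⟨ ix ⟩) ∷ raise Lock (Far ⟨ Vx ⟨ ix ⟩ ⟩) ∷ raise Lock (Mate ⟨ ix ⟩) ∷ raise Lock (Far ⟨ Mate ⟨ ix ⟩ ⟩) ∷ []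

-- Runs through the edges backwards while the loop index goes forwards.
lastₓ : Ex
lastₓ = ∣E∣ₓ ⊟ (con 1 ⊞ ix)

spreadB =
  (Bit [ Src ⟨ lastₓ ⟩ ]≔ Pair ⟨ lastₓ ⟩ ⟪ Bit ⟨ F1 ⟨ lastₓ ⟩ ⟩+ 0 ∣ Bit ⟨ Src ⟨ lastₓ ⟩ ⟩+ 0 ⟫) ∷
  (Bit [ Tgt ⟨ lastₓ ⟩ ]≔ Pair ⟨ lastₓ ⟩ ⟪ Bit ⟨ F2 ⟨ lastₓ ⟩ ⟩+ 0 ∣ Bit ⟨ Tgt ⟨ lastₓ ⟩ ⟩+ 0 ⟫) ∷ []

recolourB = (Col [ ix ]≔ Bit ⟨ Src ⟨ ix ⟩ ⟩
  ⟪ Col ⟨ ix ⟩ ≠ₓ BestA ⟨ con 0 ⟩ ⟪ Col ⟨ ix ⟩ ≠ₓ BestB ⟨ con 0 ⟩ ⟪ Col ⟨ ix ⟩+ 0 ∣ BestA ⟨ con 0 ⟩+ 0 ⟫ ∣ BestB ⟨ con 0 ⟩+ 0 ⟫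
  ∣ Col ⟨ ix ⟩+ 0 ⟫) ∷ []

-- A candidate fixes which end of the edge plays the role of x, and the colours
-- of the edges xz, zs and xs.
Candidate : Set
Candidate = Bool × ℕ × ℕ × ℕ

tag : ∀ {A B : Set} → A → List B → List (A × B) → List (A × B)
tag a []       rest = rest
tag a (b ∷ bs) rest = (a , b) ∷ tag a bs rest

pairs : ∀ {A B : Set} → List A → List B → List (A × B)
pairs []       bs = []
pairs (a ∷ as) bs = tag a bs (pairs as bs)

tag⁺ : ∀ {A B : Set} {a : A} {b : B} {bs rest} → b ∈ₗ bs → (a , b) ∈ₗ tag a bs rest
tag⁺ (here refl) = here refl
tag⁺ (there i)   = there (tag⁺ i)

tag-rest : ∀ {A B : Set} {a : A} {q : A × B} {rest} bs → q ∈ₗ rest → q ∈ₗ tag a bs rest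
tag-rest []       i = i
tag-rest (b ∷ bs) i = there (tag-rest bs i)

pairs⁺ : ∀ {A B : Set} {a : A} {b : B} {as bs} → a ∈ₗ as → b ∈ₗ bs → (a , b) ∈ₗ pairs as bs
pairs⁺ (here refl) j = tag⁺ j
pairs⁺ {bs = bs} (there i) j = tag-rest bs (pairs⁺ i j)

upTo⁺ : ∀ {N c} → c < N → c ∈ₗ upTo N
upTo⁺ {suc N} {c} lt with c ≟ N
... | yes refl = here refl
... | no ne = there (upTo⁺ (≤∧≢⇒< (≤-pred lt) ne))

abstract
  -- There are 2 * 9 ^ 3 = 1458 of them; the list is abstract so that the trees built from it are
  -- not unfolded.
  candidates : List Candidate
  candidates = pairs (true ∷ false ∷ []) (pairs colours (pairs colours colours))

  candidate∈ : ∀ o {c₁ c₂ c₃} → c₁ < 9 → c₂ < 9 → c₃ < 9 → (o , c₁ , c₂ , c₃) ∈ₗ candidates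
  candidate∈ true  p q r = pairs⁺ {as = true ∷ false ∷ []} (here refl) (pairs⁺ (upTo⁺ p) (pairs⁺ (upTo⁺ q) (upTo⁺ r)))
  candidate∈ false p q r = pairs⁺ {as = true ∷ false ∷ []} (there (here refl)) (pairs⁺ (upTo⁺ p) (pairs⁺ (upTo⁺ q) (upTo⁺ r)))

search : List Candidate → (Candidate → Ex) → (Candidate → Tree) → Tree
search []       test out = num 0
search (q ∷ qs) test out = test q ⟪ search qs test out ∣ out q ⟫

xₓ yₓ zₓ : Candidate → Ex
xₓ (o , _) = (if o then Src else Tgt) ⟨ ix ⟩
yₓ (o , _) = (if o then Tgt else Src) ⟨ ix ⟩
zₓ q@(_ , c₁ , _) = Nbr ⟨ entry (xₓ q) (con c₁) ⟩

-- A sum of penalties which vanishes only if y and z have degree at most 3, the three edges are in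
-- the table with true colours, and those from z and from x meet in one vertex s.
fits : Candidate → Ex
fits q@(_ , c₁ , c₂ , c₃) =
  (Deg ⟨ yₓ q ⟩ ⊟ con 3) ⊞ (Deg ⟨ zₓ q ⟩ ⊟ con 3) ⊞
  (con 1 ⊟ Edg ⟨ entry (xₓ q) (con c₁) ⟩) ⊞ (con 1 ⊟ Edg ⟨ entry (zₓ q) (con c₂) ⟩) ⊞ (con 1 ⊟ Edg ⟨ entry (xₓ q) (con c₃) ⟩) ⊞
  (Nbr ⟨ entry (zₓ q) (con c₂) ⟩ ≠ₓ Nbr ⟨ entry (xₓ q) (con c₃) ⟩) ⊞ (con 1 ⊟ con c₁) ⊞ (con 1 ⊟ con c₂) ⊞ (con 1 ⊟ con c₃) ⊞
  -- These bounds are tested so that a successful candidate certifies them without any look into the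
  -- abstract list.
  (con c₁ ⊟ con 8) ⊞ (con c₂ ⊟ con 8) ⊞ (con c₃ ⊟ con 8)

-- A tree yields a single word, so the search is repeated for each array. `fits` reads none of the
-- arrays written here; hence all searches stop at the same candidate.
siteB : Body
siteB =
  (Act [ ix ]≔ Act ⟨ ix ⟩ ⟪ search candidates fits (λ _ → num 1) ∣ num 0 ⟫) ∷
  (Vx [ ix ]≔ search candidates fits (λ q → (if proj₁ q then Src else Tgt) ⟨ ix ⟩+ 0)) ∷
  (Vy [ ix ]≔ search candidates fits (λ q → (if proj₁ q then Tgt else Src) ⟨ ix ⟩+ 0)) ∷
  (Vz [ ix ]≔ search candidates fits (λ q → Nbr ⟨ entry (xₓ q) (con (proj₁ (proj₂ q))) ⟩+ 0)) ∷
  (Exz [ ix ]≔ search candidates fits (λ q → Edg ⟨ entry (xₓ q) (con (proj₁ (proj₂ q))) ⟩-1)) ∷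
  (Ezs [ ix ]≔ search candidates fits (λ q → Edg ⟨ entry (zₓ q) (con (proj₁ (proj₂ (proj₂ q)))) ⟩-1)) ∷
  (Exs [ ix ]≔ search candidates fits (λ q → Edg ⟨ entry (xₓ q) (con (proj₂ (proj₂ (proj₂ q)))) ⟩-1)) ∷
  (Miss [ ix ]≔ firstOf colours (λ c → Edg ⟨ entry (Vx ⟨ ix ⟩) (con c) ⟩)) ∷ []

tabulate prelude stage algorithm : Phase
tabulate  = eachV blankB ▷ eachE fillB
prelude   = eachE loadB ▷ eachE degreesB ▷ tabulate ▷ eachE siteB ▷ eachE colourB
stage     = tabulate ▷ eachE requestB ▷ eachV resetB ▷ eachV untallyB ▷ eachE tallyB ▷ eachE markB ▷ eachE linkB ▷ eachE mateB ▷
            eachE selectB ▷ eachE spreadB ▷ eachE recolourB ▷ tabulate ▷ eachE colourB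
algorithm = prelude ▷ stage ▷ stage ▷ stage ▷ stage ▷ stage

-- Frame properties and induction principles for loops

writes : Arr → Body → Bool
writes k []                  = false
writes k ((k′ [ e ]≔ t) ∷ b) = if slot k′ ≡ᵇ slot k then true else writes k b

-- Computes to `true` on closed phases, so the frame conditions below are proved by `tt`.
spares : Arr → Phase → Bool
spares k (eachV b) = not (writes k b)
spares k (eachE b) = not (writes k b)
spares k (p ▷ q)   = if spares k p then spares k q else false

-- Round i of such a body writes only to cells with index i, so a cell j is untouched before round j
-- and settled by it.
own : Body → Bool
own []                   = true
own ((k [ ix ]≔ t) ∷ b)  = own b
own (_ ∷ b)              = false

≠ₓ-zero : ∀ a b → (a ∸ b) + (b ∸ a) ≡ 0 → a ≡ b
≠ₓ-zero a b z = ≤-antisym (m∸n≡0⇒m≤n (m+n≡0⇒m≡0 (a ∸ b) z)) (m∸n≡0⇒m≤n (m+n≡0⇒n≡0 (a ∸ b) z))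

zero-≠ₓ : ∀ {a b} → a ≡ b → (a ∸ b) + (b ∸ a) ≡ 0
zero-≠ₓ {a} refl = cong₂ _+_ (n∸n≡0 a) (n∸n≡0 a)

module Execution (n m : ℕ) (inp : ℕ → ℕ) where
  open Meaning n m inp public

  exec-frame : ∀ {i st k j} b → T (not (writes k b)) → exec i b st k j ≡ st k j
  exec-frame [] t = refl
  exec-frame {i} {st} {k} {j} ((k′ [ e ]≔ u) ∷ b) t with slot k′ ≡ᵇ slot k in eq
  ... | false = trans (exec-frame b t) (skipped eq)
    where
    skipped : ∀ {x : Bool} → x ≡ false → (if x then (if ev i st e ≡ᵇ j then evT i st u else st k j) else st k j) ≡ st k j
    skipped refl = refl

  iter-frame : ∀ {st k j} i b → T (not (writes k b)) → iter i b st k j ≡ st k j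
  iter-frame zero    b t = refl
  iter-frame (suc i) b t = trans (exec-frame b t) (iter-frame i b t)

  run-frame : ∀ {st k j} p → T (spares k p) → run p st k j ≡ st k j
  run-frame (eachV b) t = iter-frame n b t
  run-frame (eachE b) t = iter-frame m b t
  run-frame {k = k} (p ▷ q) t with spares k p in eq
  ... | true = trans (run-frame q t) (run-frame p (subst T (sym eq) tt))

  exec-own : ∀ {i st k j} b → T (own b) → i ≢ j → exec i b st k j ≡ st k j
  exec-own [] t ne = refl
  exec-own {i} {st} {k} {j} ((k′ [ ix ]≔ u) ∷ b) t ne = trans (exec-own b t ne) (skipped (slot k′ ≡ᵇ slot k) (≢⇒≡ᵇ ne))
    where
    skipped : ∀ {x : Bool} c → x ≡ false → (if c then (if x then evT i st u else st k j) else st k j) ≡ st k j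
    skipped true  refl = refl
    skipped false refl = refl

  iter-before : ∀ {st k j} i b → T (own b) → i ≤ j → iter i b st k j ≡ st k j
  iter-before zero    b t le = refl
  iter-before (suc i) b t le = trans (exec-own b t (λ { refl → <⇒≱ le ≤-refl })) (iter-before i b t (<⇒≤ le))

  iter-at : ∀ {st k j} i b → T (own b) → j < i → iter i b st k j ≡ exec j b (iter j b st) k j
  iter-at {j = j} (suc i) b t lt with j ≟ i
  ... | yes refl = refl
  ... | no ne = trans (exec-own b t (ne ∘ sym)) (iter-at i b t (≤∧≢⇒< (≤-pred lt) ne))

  -- The step may use that every array not written by the body still has its contents from before
  -- the loop.
  iter-ind : ∀ {st} (I : ℕ → St → Set) b N → I 0 st →
             (∀ {i s} → i < N → (∀ k → T (not (writes k b)) → ∀ j → s k j ≡ st k j) → I i s → I (suc i) (exec i b s)) → I N (iter N b st)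
  iter-ind I b zero    base ind-step = base
  iter-ind I b (suc N) base ind-step = ind-step ≤-refl (λ k t j → iter-frame N b t) (iter-ind I b N base (λ lt → ind-step (m≤n⇒m≤1+n lt)))

  firstOf-found : ∀ {i st test} N → ∃[ c ] (c < N × ev i st (test c) ≡ 0) →
                  evT i st (firstOf (upTo N) test) < N × ev i st (test (evT i st (firstOf (upTo N) test))) ≡ 0
  firstOf-found {i} {st} {test} (suc N) (c , c< , z) with ev i st (test N) in eq
  ... | zero = ≤-refl , eq
  ... | suc _ with c ≟ N
  ...   | yes refl = ⊥-elim (1+n≢0 (trans (sym eq) z))
  ...   | no ne with firstOf-found {i} {st} {test} N (c , ≤∧≢⇒< (≤-pred c<) ne , z)
  ...     | lt , z′ = m≤n⇒m≤1+n lt , z′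

  firstOf-none : ∀ {i st test} N → (∀ {c} → c < N → ev i st (test c) ≢ 0) → evT i st (firstOf (upTo N) test) ≡ 0
  firstOf-none zero nope = refl
  firstOf-none {i} {st} {test} (suc N) nope = trans (branch-nonzero (nope ≤-refl)) (firstOf-none {i} {st} {test} N (λ lt → nope (m≤n⇒m≤1+n lt)))

  abstract
    colour-found : ∀ {i st} test → ∃[ c ] (c < 9 × ev i st (test c) ≡ 0) →
                   evT i st (firstOf colours test) < 9 × ev i st (test (evT i st (firstOf colours test))) ≡ 0
    colour-found {i} {st} test = firstOf-found {i} {st} {test} 9

    colour-none : ∀ {i st} test → (∀ {c} → c < 9 → ev i st (test c) ≢ 0) → evT i st (firstOf colours test) ≡ 0
    colour-none {i} {st} test = firstOf-none {i} {st} {test} 9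

  -- One candidate serves for every `out`; this makes the separate searches of `siteB` fit together.
  search-spec : ∀ {i st} qs test → (∃[ q ] (q ∈ₗ qs × ev i st (test q) ≡ 0 × ∀ out → evT i st (search qs test out) ≡ evT i st (out q)))
                ⊎ ((∀ {q} → q ∈ₗ qs → ev i st (test q) ≢ 0) × ∀ out → evT i st (search qs test out) ≡ 0)
  search-spec [] test = inj₂ ((λ ()) , λ out → refl)
  search-spec {i} {st} (q ∷ qs) test with ev i st (test q) ≟ 0
  ... | yes z = inj₁ (q , here refl , z , λ out → branch-zero z)
  ... | no nz with search-spec {i} {st} qs test
  ...   | inj₁ (q′ , q∈ , z , eq) = inj₁ (q′ , there q∈ , z , λ out → trans (branch-nonzero nz) (eq out))
  ...   | inj₂ (none , eq) = inj₂ ((λ { (here refl) → nz ; (there q∈) → none q∈ }) , λ out → trans (branch-nonzero nz) (eq out))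

-- The loops of a stage

module Tables (N : Net) (inp : ℕ → ℕ) where
  open Net N
  open Sites N public
  open Execution n m inp public

  record Drawn (st : St) : Set where
    field
      src≗ : ∀ j → st Src j ≡ src j
      tgt≗ : ∀ j → st Tgt j ≡ tgt j

  drawn-frame : ∀ {st} p → T (spares Src p) → T (spares Tgt p) → Drawn st → Drawn (run p st)
  drawn-frame p t u d = record { src≗ = λ j → trans (run-frame p t) (Drawn.src≗ d j) ; tgt≗ = λ j → trans (run-frame p u) (Drawn.tgt≗ d j) }

  -- In a proper colouring e is determined by v and a true colour c. Under c = 0 several edges may
  -- compete, and the entry is any of them.
  record Entry (st : St) (C : ℕ → ℕ) (v c : ℕ) : Set where
    constructor entryOf
    field
      {e}   : ℕ
      e<    : e < m
      holds : st Edg (9 * v + c) ≡ suc e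
      joins : Joins e v (st Nbr (9 * v + c))
      tint  : C e ≡ c

  record Table (st : St) (C : ℕ → ℕ) : Set where
    field
      none : ∀ {v c} → v < n → c < 9 → st Edg (9 * v + c) ≡ 0 → ¬ Has C v c
      some : ∀ {v c} → v < n → c < 9 → st Edg (9 * v + c) ≢ 0 → Entry st C v c

    has : ∀ {v c} → v < n → c < 9 → st Edg (9 * v + c) ≢ 0 → Has C v c
    has v< c< nz = Entry.e p , Entry.e< p , Colourings.joins-left N (Entry.joins p) , Entry.tint p
      where
      p = some v< c< nz

    filled : ∀ {v c} → v < n → c < 9 → Has C v c → st Edg (9 * v + c) ≢ 0
    filled v< c< h z = none v< c< z h

  table-cong : ∀ {st st′ C} → (∀ j → st′ Edg j ≡ st Edg j) → (∀ j → st′ Nbr j ≡ st Nbr j) → Table st C → Table st′ C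
  table-cong {st} {st′} {C} p u tb = record
    { none = λ v< c< z → none v< c< (trans (sym (p _)) z)
    ; some = λ v< c< nz → move (some v< c< (nz ∘ trans (p _))) }
    where
    open Table tb
    move : ∀ {v c} → Entry st C v c → Entry st′ C v c
    move (entryOf e< h j q) = entryOf e< (trans (p _) h) (subst (Joins _ _) (sym (u _)) j) q

  zeros-keep : ∀ {i st k f} cs {k′ j} → st k′ j ≡ 0 → exec i (zeros k f cs) st k′ j ≡ 0
  zeros-keep [] z = z
  zeros-keep {i} {st} {k} {f} (c ∷ cs) {k′} {j} z = zeros-keep cs (go (slot k ≡ᵇ slot k′) (ev i st (f c) ≡ᵇ j))
    where
    go : ∀ a b → (if a then (if b then 0 else st k′ j) else st k′ j) ≡ 0
    go true  true  = refl
    go true  false = z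
    go false b     = z

  zeros-hit : ∀ {i st k f} cs {c j} → c ∈ₗ cs → (∀ st → ev i st (f c) ≡ j) → exec i (zeros k f cs) st k j ≡ 0
  zeros-hit {i} {st} {k} {f} (c ∷ cs) {j = j} (here refl) eq = zeros-keep cs (go (≡ᵇ-refl (slot k)) (trans (cong (_≡ᵇ j) (eq st)) (≡ᵇ-refl j)))
    where
    go : ∀ {a b} → a ≡ true → b ≡ true → (if a then (if b then 0 else st k j) else st k j) ≡ 0
    go refl refl = refl
  zeros-hit (c ∷ cs) (there i) eq = zeros-hit cs i eq

  record Reset (i : ℕ) (st : St) : Set where
    field
      far≗ : ∀ {v} → v < i → st Far v ≡ v
      lock : ∀ {v} → v < i → st Lock v ≡ 0
      bit  : ∀ {v} → v < i → st Bit v ≡ 0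
      best : 0 < i → st Best 0 ≡ 0 × st BestA 0 ≡ 1 × st BestB 0 ≡ 2

  reset-spec : ∀ st → Reset n (iter n resetB st)
  reset-spec st = iter-ind Reset resetB n (record { far≗ = λ () ; lock = λ () ; bit = λ () ; best = λ () })
    λ {i} {s} i< fr c → record
      { far≗ = λ v< → at i v< (s Far) {λ v → v} (Reset.far≗ c) refl
      ; lock = λ v< → at i v< (s Lock) {λ _ → 0} (Reset.lock c) refl
      ; bit = λ v< → at i v< (s Bit) {λ _ → 0} (Reset.bit c) refl
      ; best = λ _ → refl , refl , refl }
    where
    at : ∀ i {v} → v < suc i → (f : ℕ → ℕ) {g : ℕ → ℕ} → (∀ {v} → v < i → f v ≡ g v) → ∀ {w} → w ≡ g i → upd f i w v ≡ g v
    at i {v} v< f old eq with v ≟ i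
    ... | yes refl = trans (upd-same f {v} refl) eq
    ... | no ne = trans (upd-other f (ne ∘ sym)) (old (≤∧≢⇒< (≤-pred v<) ne))

  untally-spec : ∀ st → 0 < n → ∀ {k} → k < 81 → iter n untallyB st Cnt k ≡ 0
  untally-spec st 0<n {k} k< = iter-ind (λ i s → 0 < i → s Cnt k ≡ 0) untallyB n (λ ()) (λ {i} {s} _ _ _ _ → zeros-hit {i} {s} {Cnt} {con} (upTo 81) {k} {k} (upTo⁺ k<) (λ _ → refl)) 0<n

  Blank : ℕ → St → Set
  Blank i st = ∀ {v c} → v < i → c < 9 → st Edg (9 * v + c) ≡ 0

  blank-spec : ∀ st → Blank n (iter n blankB st)
  blank-spec st = iter-ind Blank blankB n (λ ()) (λ {i} {s} _ _ → ind-step i s)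
    where
    ind-step : ∀ i s → Blank i s → Blank (suc i) (exec i blankB s)
    ind-step i s old {v} {c} v< c< with v ≟ i
    ... | yes refl = zeros-hit {i} {s} {Edg} {λ c → entry ix (con c)} (upTo 9) {c} {9 * v + c} (upTo⁺ c<) (λ _ → refl)
    ... | no ne = zeros-keep {i} {s} {Edg} {λ c → entry ix (con c)} (upTo 9) {Edg} {9 * v + c} (old (≤∧≢⇒< (≤-pred v<) ne) c<)

  Partly : ℕ → St → (ℕ → ℕ) → Set
  Partly i st C = ∀ {v c} → v < n → c < 9 → (st Edg (9 * v + c) ≡ 0 × (∀ {e} → e < i → inc e v → C e ≢ c)) ⊎ Entry st C v c

  fill-step : ∀ {i s C u v k} → i < m → s Src i ≡ u → s Tgt i ≡ v → s Col i ≡ k → src i ≡ u → tgt i ≡ v → C i ≡ k → k < 9 →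
              Partly i s C → Partly (suc i) (exec i fillB s) C
  fill-step {i} {s} {C} {u} {v} {k} i< refl refl refl pu pv pk k< part {w} {c} w< c<
    -- The entry at the target is written second and prevails, so it is examined first.
    with 9 * v + k ≟ 9 * w + c
  ... | yes eq with *+-injective 9 {v} {w} k< c< eq
  ...   | refl , refl = inj₂ (entryOf i< (upd-same (upd (s Edg) (9 * u + k) (suc i)) {9 * v + k} {suc i} refl)
             (subst (Joins i v) (sym (upd-same (upd (s Nbr) (9 * u + k) v) {9 * v + k} {u} refl)) (inj₂ (pu , pv))) pk)
  fill-step {i} {s} {C} {u} {v} {k} i< refl refl refl pu pv pk k< part {w} {c} w< c< | no ne with 9 * u + k ≟ 9 * w + c
  ... | yes eq with *+-injective 9 {u} {w} k< c< eq
  ...   | refl , refl = inj₂ (entryOf i< (trans (upd-other (upd (s Edg) (9 * u + k) (suc i)) ne) (upd-same (s Edg) {9 * u + k} refl))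
             (subst (Joins i u) (sym (trans (upd-other (upd (s Nbr) (9 * u + k) v) ne) (upd-same (s Nbr) {9 * u + k} refl))) (inj₁ (pu , pv))) pk)
  fill-step {i} {s} {C} {u} {v} {k} i< refl refl refl pu pv pk k< part {w} {c} w< c< | no ne | no ne′ = old (part w< c<)
    where
    edg≡ : exec i fillB s Edg (9 * w + c) ≡ s Edg (9 * w + c)
    edg≡ = trans (upd-other (upd (s Edg) (9 * u + k) (suc i)) ne) (upd-other (s Edg) ne′)
    nbr≡ : exec i fillB s Nbr (9 * w + c) ≡ s Nbr (9 * w + c)
    nbr≡ = trans (upd-other (upd (s Nbr) (9 * u + k) v) ne) (upd-other (s Nbr) ne′)
    old : _ → _
    old (inj₂ (entryOf e< h j q)) = inj₂ (entryOf e< (trans edg≡ h) (subst (Joins _ w) (sym nbr≡) j) q)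
    old (inj₁ (z , none)) = inj₁ (trans edg≡ z , λ {e} e< j q → case e ≟ i of λ
      { (no e≢i) → none (≤∧≢⇒< (≤-pred e<) e≢i) j q
      ; (yes refl) → case j of λ
          { (inj₁ p) → ne′ (cong₂ (λ a b → 9 * a + b) (trans (sym pu) p) (trans (sym pk) q))
          ; (inj₂ p) → ne (cong₂ (λ a b → 9 * a + b) (trans (sym pv) p) (trans (sym pk) q)) } })

  fill-spec : ∀ {st C} → Drawn st → (∀ {j} → j < m → st Col j ≡ C j) → (∀ {j} → j < m → C j < 9) → Blank n st → Table (iter m fillB st) C
  fill-spec {st} {C} d col C< cl = toTable (iter-ind (λ i s → Partly i s C) fillB m (λ v< c< → inj₁ (cl v< c< , λ ()))
    λ {i} {s} i< fr part → fill-step {i} {s} {C} i< (trans (fr Src tt i) (src≗ i)) (trans (fr Tgt tt i) (tgt≗ i))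
      (trans (fr Col tt i) (col i<)) refl refl refl (C< i<) part)
    where
    open Drawn d
    toTable : ∀ {s} → Partly m s C → Table s C
    toTable {s} part = record { none = no-one ; some = some-one }
      where
      no-one : ∀ {v c} → v < n → c < 9 → s Edg (9 * v + c) ≡ 0 → ¬ Has C v c
      no-one v< c< z (e , e< , i , q) with part v< c<
      ... | inj₁ (_ , none) = none e< i q
      ... | inj₂ (entryOf _ h _ _) = 1+n≢0 (trans (sym h) z)
      some-one : ∀ {v c} → v < n → c < 9 → s Edg (9 * v + c) ≢ 0 → Entry s C v c
      some-one v< c< nz with part v< c<
      ... | inj₁ (z , _) = ⊥-elim (nz z)
      ... | inj₂ en = en

  tabulate-spec : ∀ {st C} → Drawn st → (∀ {j} → j < m → st Col j ≡ C j) → (∀ {j} → j < m → C j < 9) → Table (run tabulate st) C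
  tabulate-spec {st} d col C< = fill-spec (drawn-frame (eachV blankB) tt tt d)
    (λ j< → trans (run-frame (eachV blankB) tt) (col j<)) C< (blank-spec st)

posᵇ : ℕ → Bool
posᵇ zero    = false
posᵇ (suc _) = true

posᵇ⁻ : ∀ {k} → T (posᵇ k) → k ≢ 0
posᵇ⁻ {suc k} t ()

posᵇ⁺ : ∀ {k} → k ≢ 0 → T (posᵇ k)
posᵇ⁺ {zero}  nz = nz refl
posᵇ⁺ {suc k} nz = tt

avoids⁺ : ∀ {a b} c k → a ≡ 0 → b ≡ 0 → c ≢ k → a + b + (1 ∸ ((c ∸ k) + (k ∸ c))) ≡ 0
avoids⁺ c k refl refl ne with (c ∸ k) + (k ∸ c) in eq
... | zero  = ⊥-elim (ne (≠ₓ-zero c k eq))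
... | suc w = 0∸n≡0 w

avoids⁻ : ∀ {a b} c k → a + b + (1 ∸ ((c ∸ k) + (k ∸ c))) ≡ 0 → a ≡ 0 × b ≡ 0 × c ≢ k
avoids⁻ {a} {b} c k z = m+n≡0⇒m≡0 a ab , m+n≡0⇒n≡0 a ab , ne
  where
  ab : a + b ≡ 0
  ab = m+n≡0⇒m≡0 (a + b) z
  ne : c ≢ k
  ne refl rewrite n∸n≡0 c = 1+n≢0 (m+n≡0⇒n≡0 (a + b) z)

siteArrays : List Arr
siteArrays = Vx ∷ Vy ∷ Vz ∷ Exz ∷ Exs ∷ Ezs ∷ Miss ∷ []

allSpared : List Arr → Phase → Bool
allSpared []       p = true
allSpared (k ∷ ks) p = if spares k p then allSpared ks p else false

allSpared⁻ : ∀ {ks p k} → T (allSpared ks p) → k ∈ₗ ks → T (spares k p)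
allSpared⁻ {k ∷ ks} {p} t i with spares k p in eq
allSpared⁻ {k ∷ ks} {p} t (here refl) | true = subst T (sym eq) tt
allSpared⁻ {k ∷ ks} {p} t (there i) | true = allSpared⁻ {ks} t i

module Rounds (N : Net) (inp : ℕ → ℕ) (μ : St) where
  open Net N
  open Tables N inp public
  open Site

  siteOf : ℕ → Site N
  siteOf j = site j (μ Vx j) (μ Vy j) (μ Vz j) (μ Exz j) (μ Exs j) (μ Ezs j) (μ Miss j)

  -- μ will be the memory after `siteB`. No later loop writes these arrays, so the sites stay fixed
  -- while `Col` and `Act` change.
  Sited : St → Set
  Sited st = ∀ {k} → k ∈ₗ siteArrays → ∀ j → st k j ≡ μ k j

  sited-frame : ∀ {st} p → T (allSpared siteArrays p) → Sited st → Sited (run p st)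
  sited-frame p t si i j = trans (run-frame p (allSpared⁻ {siteArrays} {p} t i)) (si i j)

  module _ {st : St} (si : Sited st) where
    vx≗ : ∀ j → st Vx j ≡ μ Vx j
    vx≗ = si (here refl)
    vy≗ : ∀ j → st Vy j ≡ μ Vy j
    vy≗ = si (there (here refl))
    vz≗ : ∀ j → st Vz j ≡ μ Vz j
    vz≗ = si (there (there (here refl)))
    exz≗ : ∀ j → st Exz j ≡ μ Exz j
    exz≗ = si (there (there (there (here refl))))
    exs≗ : ∀ j → st Exs j ≡ μ Exs j
    exs≗ = si (there (there (there (there (here refl)))))
    ezs≗ : ∀ j → st Ezs j ≡ μ Ezs j
    ezs≗ = si (there (there (there (there (there (here refl))))))
    miss≗ : ∀ j → st Miss j ≡ μ Miss j
    miss≗ = si (there (there (there (there (there (there (here refl)))))))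

  module _ {σ : Site N} (g : Geometry σ) where
    open Geometry g
    inc< : ∀ {f v} → f < m → inc f v → v < n
    inc< f< (inj₁ refl) = src< f<
    inc< f< (inj₂ refl) = tgt< f<
    x< : x σ < n
    x< = inc< e< (e-x g)
    y< : y σ < n
    y< = inc< e< (e-y g)
    z< : z σ < n
    z< = inc< xz< (xz-z g)

  module _ {s : St} {C : ℕ → ℕ} (tb : Table s C) where
    open Table tb

    zero-entry : ∀ {v c} → v < n → c < 9 → ¬ Has C v c → s Edg (9 * v + c) ≡ 0
    zero-entry {v} {c} v< c< nh with s Edg (9 * v + c) ≟ 0
    ... | yes z = z
    ... | no nz = ⊥-elim (nh (has v< c< nz))

    -- The components of the site are variables with equations, so that matching on `refl`
    -- identifies them with what the loop reads.
    want-spec : ∀ {j ρ y₀ z₀ xz₀ xs₀ zs₀ a₀} → s Vy j ≡ y₀ → s Vz j ≡ z₀ → s Exz j ≡ xz₀ → s Exs j ≡ xs₀ → s Ezs j ≡ zs₀ → s Miss j ≡ a₀ →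
                ∀ {x₀} → let σ = site j x₀ y₀ z₀ xz₀ xs₀ zs₀ a₀ in Geometry σ → (∀ {f} → f < m → C f < 9) → a₀ < 9 →
                s Col xz₀ ≡ C xz₀ → s Col xs₀ ≡ C xs₀ → s Col zs₀ ≡ C zs₀ →
                (rk : Rank σ C ρ) → Partner rk (evT j s wantT)
    want-spec {j} {y₀ = y₀} {z₀} {xz₀} {xs₀} {zs₀} {a₀} refl refl refl refl refl refl {x₀} g C< a<9 er ek ed = go
      where
      open Geometry g using (xz<; xs<; zs<; dy; dz)
      σ : Site N
      σ = site j x₀ y₀ z₀ xz₀ xs₀ zs₀ a₀
      yr⁺ : Has C y₀ (C xz₀) → s Edg (9 * y₀ + s Col xz₀) ≢ 0
      yr⁺ h = subst (λ c → s Edg (9 * y₀ + c) ≢ 0) (sym er) (filled (y< g) (C< xz<) h)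
      yr⁻ : ¬ Has C y₀ (C xz₀) → s Edg (9 * y₀ + s Col xz₀) ≡ 0
      yr⁻ h = subst (λ c → s Edg (9 * y₀ + c) ≡ 0) (sym er) (zero-entry (y< g) (C< xz<) h)
      zk⁺ : Has C z₀ (C xs₀) → s Edg (9 * z₀ + s Col xs₀) ≢ 0
      zk⁺ h = subst (λ c → s Edg (9 * z₀ + c) ≢ 0) (sym ek) (filled (z< g) (C< xs<) h)
      zk⁻ : ¬ Has C z₀ (C xs₀) → s Edg (9 * z₀ + s Col xs₀) ≡ 0
      zk⁻ h = subst (λ c → s Edg (9 * z₀ + c) ≡ 0) (sym ek) (zero-entry (z< g) (C< xs<) h)
      za⁺ : Has C z₀ a₀ → s Edg (9 * z₀ + a₀) ≢ 0
      za⁺ = filled (z< g) a<9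
      za⁻ : ¬ Has C z₀ a₀ → s Edg (9 * z₀ + a₀) ≡ 0
      za⁻ = zero-entry (z< g) a<9
      zs-a : C zs₀ ≡ a₀ → Has C z₀ a₀
      zs-a eq = zs₀ , zs< , zs-z g , eq
      freshTest : ℕ → Ex
      freshTest c = Edg ⟨ entry (Vy ⟨ ix ⟩) (con c) ⟩ ⊞ Edg ⟨ entry (Vz ⟨ ix ⟩) (con c) ⟩ ⊞ (con 1 ⊟ (con c ≠ₓ Col ⟨ Exs ⟨ ix ⟩ ⟩))
      freshV : ℕ
      freshV = evT j s freshT
      found : freshV < 9 × ev j s (freshTest freshV) ≡ 0
      found with fresh₂ C y₀ z₀ (C xs₀) dy dz
      ... | c , c< , ¬y , ¬z , c≢k = colour-found {j} {s} freshTest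
              (c , c< , avoids⁺ c (s Col xs₀) (zero-entry (y< g) c< ¬y) (zero-entry (z< g) c< ¬z) (c≢k ∘ λ q → trans q ek))
      isFresh : Fresh σ C freshV
      isFresh = unpack (proj₁ found) (avoids⁻ freshV (s Col xs₀) (proj₂ found))
        where
        unpack : ∀ {c} → c < 9 → s Edg (9 * y₀ + c) ≡ 0 × s Edg (9 * z₀ + c) ≡ 0 × c ≢ s Col xs₀ → Fresh σ C c
        unpack c< (p , q , ne) = c< , none (y< g) c< p , none (z< g) c< q , λ eq → ne (trans eq (sym ek))
      d≠ : C zs₀ ≢ a₀ → (s Col zs₀ ∸ a₀) + (a₀ ∸ s Col zs₀) ≢ 0
      d≠ ne = ne ∘ trans (sym ed) ∘ ≠ₓ-zero (s Col zs₀) a₀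
      go : ∀ {ρ} (rk : Rank σ C ρ) → Partner rk (evT j s wantT)
      go (α₁ p q)   = trans (branch-zero (yr⁻ p)) (trans (branch-zero (za⁻ q)) er)
      go (α₂ p q)   = subst (Fresh σ C) (sym (trans (branch-zero (yr⁻ p)) (branch-nonzero (za⁺ q)))) isFresh
      go (β₁ p q r) = trans (branch-nonzero (yr⁺ p)) (trans (branch-nonzero (za⁺ (zs-a q)))
        (trans (branch-zero (cong₂ _+_ (zero-≠ₓ (trans ed q)) (zk⁻ r))) ek))
      go (β₂ p q r) = trans (branch-nonzero (yr⁺ p)) (trans (branch-zero (za⁻ q)) (trans (branch-zero (zk⁻ r)) ed))
      go (β₃ p q r) = subst (Fresh σ C) (sym (trans (branch-nonzero (yr⁺ p)) (trans (branch-nonzero (za⁺ q))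
        (branch-nonzero (d≠ r ∘ m+n≡0⇒m≡0 _))))) isFresh
      go (β₄ p q r) = trans (branch-nonzero (yr⁺ p)) (trans (branch-zero (za⁻ q)) (trans (branch-nonzero (zk⁺ r)) ek))
      go (β₅ p q r) = subst (Fresh σ C) (sym (trans (branch-nonzero (yr⁺ p)) (trans (branch-nonzero (za⁺ (zs-a q)))
        (branch-nonzero (zk⁺ r ∘ m+n≡0⇒n≡0 ((s Col zs₀ ∸ a₀) + (a₀ ∸ s Col zs₀))))))) isFresh

  request-spec : ∀ {st C j ρ} → Sited st → Table st C → (∀ {f} → f < m → st Col f ≡ C f) → (∀ {f} → f < m → C f < 9) → j < m →
                 Geometry (siteOf j) → μ Miss j < 9 → (rk : Rank (siteOf j) C ρ) → Partner rk (iter m requestB st Want j)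
  request-spec {st} {C} {j} si tb col C< j< g a< rk = subst (Partner rk) (sym value)
    (want-spec (table-cong {st} {s} (fr Edg tt) (fr Nbr tt) tb)
      (trans (fr Vy tt j) (vy≗ si j)) (trans (fr Vz tt j) (vz≗ si j)) (trans (fr Exz tt j) (exz≗ si j)) (trans (fr Exs tt j) (exs≗ si j))
      (trans (fr Ezs tt j) (ezs≗ si j)) (trans (fr Miss tt j) (miss≗ si j)) g C< a<
      (trans (fr Col tt _) (col xz<)) (trans (fr Col tt _) (col xs<)) (trans (fr Col tt _) (col zs<)) rk)
    where
    open Geometry g using (xz<; xs<; zs<)
    s : St
    s = iter j requestB st
    fr : ∀ k → T (not (writes k requestB)) → ∀ i → s k i ≡ st k i
    fr k t i = iter-frame j requestB t
    value : iter m requestB st Want j ≡ evT j s wantT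
    value = trans (iter-at m requestB tt j<) (upd-same (s Want) {j} {evT j s wantT} refl)

-- Counting the requests for each pair of colours

record Valid (a b : ℕ) : Set where
  field
    a<9 : a < 9
    b<9 : b < 9
    a≢0 : a ≢ 0
    b≢0 : b ≢ 0
    a≢b : a ≢ b

sum-increment : ∀ {f f′ N j} → j < N → (∀ k → f′ k ≡ upd f j (suc (f j)) k) → sum f′ N ≡ suc (sum f N)
sum-increment {f} {f′} {N} {j} j< eq = +-cancelʳ-≡ (f j) _ _ (trans (cong (_+ f j) (sum-cong N (λ {k} _ → eq k)))
  (trans (sum-upd f j (suc (f j)) j<) (+-suc (sum f N) (f j))))

module Tally (ac mi wa : ℕ → ℕ) where

  key : ℕ → ℕ
  key e = 9 * mi e + wa e

  keyed : ℕ → ℕ → Bool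
  keyed k e = if posᵇ (ac e) then key e ≡ᵇ k else false

  matches : ℕ → ℕ → ℕ → Bool
  matches a b e = if posᵇ (ac e) then (if mi e ≡ᵇ a then wa e ≡ᵇ b else false) else false

  record Tallied (i : ℕ) (cnt : ℕ → ℕ) (best a b : ℕ) : Set where
    field
      active   : count (posᵇ ∘ ac) i ≤ sum cnt 81
      below    : ∀ {k} → k < 81 → cnt k ≤ best
      champion : best ≤ cnt (9 * a + b)
      valid    : Valid a b
      exact    : ∀ {k} → k < 81 → cnt k ≤ count (keyed k) i
  open Tallied

  key< : ∀ {a b} → Valid a b → 9 * a + b < 81
  key< {a} {b} v = s≤s (+-mono-≤ (*-monoʳ-≤ 9 (≤-pred (Valid.a<9 v))) (≤-pred (Valid.b<9 v)))

  tallied-skip : ∀ {i cnt cnt′ best best′ a a′ b b′} → ac i ≡ 0 → (∀ k → cnt′ k ≡ cnt k) → best′ ≡ best → a′ ≡ a → b′ ≡ b →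
                 Tallied i cnt best a b → Tallied (suc i) cnt′ best′ a′ b′
  tallied-skip {i} {cnt} {cnt′} z eq refl refl refl t = record
    { active = ≤-trans (≤-reflexive (cong (λ x → ind (posᵇ x) + count (posᵇ ∘ ac) i) z)) (≤-trans (active t) (≤-reflexive (sum-cong {cnt} {cnt′} 81 (λ {k} _ → sym (eq k)))))
    ; below = λ k< → ≤-trans (≤-reflexive (eq _)) (below t k<)
    ; champion = ≤-trans (champion t) (≤-reflexive (sym (eq _)))
    ; valid = valid t
    ; exact = λ k< → ≤-trans (≤-reflexive (eq _)) (≤-trans (exact t k<) (m≤n+m _ _)) }

  tallied-step : ∀ {i cnt cnt′ best best′ a a′ b b′} → ac i ≢ 0 → Valid (mi i) (wa i) →
                 (∀ k → cnt′ k ≡ upd cnt (key i) (suc (cnt (key i))) k) →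
                 best′ ≡ branch (suc (cnt (key i)) ∸ best) (suc (cnt (key i))) best →
                 a′ ≡ branch (suc (cnt (key i)) ∸ best) (mi i) a → b′ ≡ branch (suc (cnt (key i)) ∸ best) (wa i) b →
                 Tallied i cnt best a b → Tallied (suc i) cnt′ best′ a′ b′
  tallied-step {i} {cnt} {cnt′} {best} {best′} {a} {a′} {b} {b′} nz v eq e₁ e₂ e₃ t = record
    { active = ≤-trans (+-mono-≤ (ind≤1 _) (active t)) (≤-reflexive (sym grown))
    ; below = λ k< → below′ k<
    ; champion = proj₁ choice ; valid = proj₂ choice
    ; exact = exact′ }
    where
    κ : ℕ
    κ = key i
    new : cnt′ κ ≡ suc (cnt κ)
    new = trans (eq κ) (upd-same cnt {κ} refl)
    old : ∀ {k} → κ ≢ k → cnt′ k ≡ cnt k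
    old ne = trans (eq _) (upd-other cnt ne)
    grown : sum cnt′ 81 ≡ suc (sum cnt 81)
    grown = sum-increment (key< v) eq
    lo : suc (cnt κ) ≤ best → best′ ≡ best × a′ ≡ a × b′ ≡ b
    lo le = trans e₁ (branch-zero (m≤n⇒m∸n≡0 le)) , trans e₂ (branch-zero (m≤n⇒m∸n≡0 le)) , trans e₃ (branch-zero (m≤n⇒m∸n≡0 le))
    hi : ¬ suc (cnt κ) ≤ best → best′ ≡ suc (cnt κ) × a′ ≡ mi i × b′ ≡ wa i
    hi gt = trans e₁ (branch-nonzero d) , trans e₂ (branch-nonzero d) , trans e₃ (branch-nonzero d)
      where
      d : suc (cnt κ) ∸ best ≢ 0
      d z = gt (m∸n≡0⇒m≤n z)
    best≤ : best ≤ best′ × suc (cnt κ) ≤ best′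
    best≤ with suc (cnt κ) ≤? best
    ... | yes le = ≤-reflexive (sym (proj₁ (lo le))) , ≤-trans le (≤-reflexive (sym (proj₁ (lo le))))
    ... | no gt = ≤-trans (<⇒≤ (≰⇒> gt)) (≤-reflexive (sym (proj₁ (hi gt)))) , ≤-reflexive (sym (proj₁ (hi gt)))
    below′ : ∀ {k} → k < 81 → cnt′ k ≤ best′
    below′ {k} k< with κ ≟ k
    ... | yes refl = ≤-trans (≤-reflexive new) (proj₂ best≤)
    ... | no ne = ≤-trans (≤-reflexive (old ne)) (≤-trans (below t k<) (proj₁ best≤))
    cnt≤ : ∀ k → cnt k ≤ cnt′ k
    cnt≤ k with κ ≟ k
    ... | yes refl = ≤-trans (n≤1+n _) (≤-reflexive (sym new))
    ... | no ne = ≤-reflexive (sym (old ne))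
    choice : best′ ≤ cnt′ (9 * a′ + b′) × Valid a′ b′
    choice with suc (cnt κ) ≤? best
    ... | yes le = subst (λ x → x ≤ cnt′ (9 * a′ + b′)) (sym (proj₁ (lo le)))
                     (subst₂ (λ p q → best ≤ cnt′ (9 * p + q)) (sym (proj₁ (proj₂ (lo le)))) (sym (proj₂ (proj₂ (lo le)))) (≤-trans (champion t) (cnt≤ _)))
                 , subst₂ Valid (sym (proj₁ (proj₂ (lo le)))) (sym (proj₂ (proj₂ (lo le)))) (valid t)
    ... | no gt = subst (λ x → x ≤ cnt′ (9 * a′ + b′)) (sym (proj₁ (hi gt)))
                     (subst₂ (λ p q → suc (cnt κ) ≤ cnt′ (9 * p + q)) (sym (proj₁ (proj₂ (hi gt)))) (sym (proj₂ (proj₂ (hi gt)))) (≤-reflexive (sym new)))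
                 , subst₂ Valid (sym (proj₁ (proj₂ (hi gt)))) (sym (proj₂ (proj₂ (hi gt)))) v
    keyed-i : ∀ {k} → κ ≡ k → T (keyed k i)
    keyed-i {k} e = subst (λ b → T (if b then κ ≡ᵇ k else false)) (sym (true-of (posᵇ⁺ nz))) (≡⇒≡ᵇ κ k e)
      where
      true-of : ∀ {x} → T x → x ≡ true
      true-of {true} _ = refl
    exact′ : ∀ {k} → k < 81 → cnt′ k ≤ count (keyed k) (suc i)
    exact′ {k} k< with κ ≟ k
    ... | yes refl = ≤-trans (≤-reflexive new) (+-mono-≤ (≤-reflexive (sym (ind-true (keyed-i refl)))) (exact t k<))
    ... | no ne = ≤-trans (≤-reflexive (old ne)) (≤-trans (exact t k<) (m≤n+m _ _))

  -- Averaging: 81 counters, none above `best`, account for all active edges, and the counter of the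
  -- chosen pair reaches `best`.
  popular : ∀ {m cnt best a b} → (∀ {e} → e < m → ac e ≢ 0 → Valid (mi e) (wa e)) → Tallied m cnt best a b →
            count (posᵇ ∘ ac) m ≤ 81 * count (matches a b) m
  popular {m} {cnt} {best} {a} {b} va t = ≤-trans (active t) (≤-trans (sum≤ best 81 (below t))
    (*-monoʳ-≤ 81 (≤-trans (champion t) (≤-trans (exact t (key< (valid t))) (count-mono m same)))))
    where
    same : ∀ {e} → e < m → T (keyed (9 * a + b) e) → T (matches a b e)
    same {e} e< h = go (posᵇ (ac e)) refl h
      where
      go : ∀ p → posᵇ (ac e) ≡ p → T (if p then key e ≡ᵇ 9 * a + b else false) → T (if p then (if mi e ≡ᵇ a then wa e ≡ᵇ b else false) else false)
      go true eq h with *+-injective 9 {mi e} {a} (Valid.b<9 (va e< (posᵇ⁻ (subst T (sym eq) tt)))) (Valid.b<9 (valid t)) (≡ᵇ⇒≡ (key e) _ h)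
      ... | p , q = subst₂ (λ x y → T (if x then y else false)) (sym (eqᵇ p)) (sym (eqᵇ q)) tt
        where
        eqᵇ : ∀ {x y} → x ≡ y → (x ≡ᵇ y) ≡ true
        eqᵇ {x} refl = ≡ᵇ-refl x

module Passes (N : Net) (inp : ℕ → ℕ) (μ : St) where
  open Net N
  open Rounds N inp μ public
  open Site

  free? : ∀ σ C → Dec (Free σ C)
  free? σ C = anyUpTo? (λ c → both (has? C (x σ) c) (has? C (y σ) c)) 9
    where
    both : ∀ {A B : Set} → Dec A → Dec B → Dec (¬ A × ¬ B)
    both (yes a) _       = no (λ p → proj₁ p a)
    both (no _)  (yes b) = no (λ p → proj₂ p b)
    both (no ¬a) (no ¬b) = yes (¬a , ¬b)

  Coloured : (ℕ → ℕ) → ℕ → ℕ → ℕ → Set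
  Coloured C j col act = (col < 9 × col ≢ 0 × ¬ Has C (μ Vx j) col × ¬ Has C (μ Vy j) col × act ≡ 0)
                         ⊎ (¬ Free (siteOf j) C × col ≡ 0 × act ≢ 0)

  colour-spec : ∀ {st C j} → Sited st → Table st C → (∀ {f} → f < m → st Col f ≡ C f) → j < m → let st′ = iter m colourB st in
                (st Act j ≡ 0 → st′ Col j ≡ C j × st′ Act j ≡ 0) ×
                (st Act j ≢ 0 → Geometry (siteOf j) → C j ≡ 0 → Coloured C j (st′ Col j) (st′ Act j))
  colour-spec {st} {C} {j} si tb col j< = idle , busy
    where
    st′ s : St
    st′ = iter m colourB st
    s = iter j colourB st
    fr : ∀ k → T (not (writes k colourB)) → ∀ i → s k i ≡ st k i
    fr k t i = iter-frame j colourB t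
    test : ℕ → Ex
    test c = Edg ⟨ entry (Vx ⟨ ix ⟩) (con c) ⟩ ⊞ Edg ⟨ entry (Vy ⟨ ix ⟩) (con c) ⟩
    choice newCol newAct : ℕ
    choice = evT j s (firstOf colours test)
    newCol = branch (s Act j) choice (s Col j)
    newAct = branch (s Act j) (branch newCol 0 1) 0
    col≡ : st′ Col j ≡ newCol
    col≡ = trans (iter-at m colourB tt j<) (upd-same (s Col) {j} {newCol} refl)
    act≡ : st′ Act j ≡ newAct
    act≡ = trans (iter-at m colourB tt j<) (trans (upd-same (s Act) {j} {branch (s Act j) (branch (upd (s Col) j newCol j) 0 1) 0} refl)
      (cong (λ c → branch (s Act j) (branch c 0 1) 0) (upd-same (s Col) {j} {newCol} refl)))
    sAct : s Act j ≡ st Act j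
    sAct = iter-before j colourB tt ≤-refl
    sCol : s Col j ≡ C j
    sCol = trans (iter-before j colourB tt ≤-refl) (col j<)
    idle : st Act j ≡ 0 → st′ Col j ≡ C j × st′ Act j ≡ 0
    idle z = trans col≡ (trans (branch-zero (trans sAct z)) sCol) , trans act≡ (branch-zero (trans sAct z))
    busy : st Act j ≢ 0 → Geometry (siteOf j) → C j ≡ 0 → Coloured C j (st′ Col j) (st′ Act j)
    busy nz g open-e with free? (siteOf j) C
    ... | yes free = inj₁ (subst (λ c → c < 9 × c ≢ 0 × ¬ Has C (μ Vx j) c × ¬ Has C (μ Vy j) c × st′ Act j ≡ 0) (sym colour≡)
                       (proj₁ found , choice≢0 , proj₁ ok , proj₂ ok , trans act≡ (trans (branch-nonzero (nz ∘ trans (sym sAct)))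
                         (branch-nonzero (choice≢0 ∘ trans (sym (branch-nonzero (nz ∘ trans (sym sAct)))))))))
      where
      open Table (table-cong {st} {s} (fr Edg tt) (fr Nbr tt) tb)
      colour≡ : st′ Col j ≡ choice
      colour≡ = trans col≡ (branch-nonzero (nz ∘ trans (sym sAct)))
      xi : s Vx j ≡ μ Vx j
      xi = trans (fr Vx tt j) (vx≗ si j)
      yi : s Vy j ≡ μ Vy j
      yi = trans (fr Vy tt j) (vy≗ si j)
      tb′ : Table s C
      tb′ = table-cong {st} {s} (fr Edg tt) (fr Nbr tt) tb
      found : choice < 9 × ev j s (test choice) ≡ 0
      found = colour-found {j} {s} test (proj₁ free , proj₁ (proj₂ free)
        , cong₂ _+_ (trans (cong (λ v → s Edg (9 * v + proj₁ free)) xi) (zero-entry tb′ (x< g) (proj₁ (proj₂ free)) (proj₁ (proj₂ (proj₂ free)))))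
                    (trans (cong (λ v → s Edg (9 * v + proj₁ free)) yi) (zero-entry tb′ (y< g) (proj₁ (proj₂ free)) (proj₂ (proj₂ (proj₂ free))))))
      ok : ¬ Has C (μ Vx j) choice × ¬ Has C (μ Vy j) choice
      ok = none (x< g) (proj₁ found) (trans (cong (λ v → s Edg (9 * v + choice)) (sym xi)) (m+n≡0⇒m≡0 (s Edg (9 * s Vx j + choice)) (proj₂ found)))
         , none (y< g) (proj₁ found) (trans (cong (λ v → s Edg (9 * v + choice)) (sym yi)) (m+n≡0⇒n≡0 (s Edg (9 * s Vx j + choice)) (proj₂ found)))
      choice≢0 : choice ≢ 0
      choice≢0 eq = proj₁ ok (j , j< , e-x g , trans open-e (sym eq))
    ... | no stuck = inj₂ (stuck , colour≡ , λ z → 1+n≢0 (trans (sym act1) z))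
      where
      xi : s Vx j ≡ μ Vx j
      xi = trans (fr Vx tt j) (vx≗ si j)
      yi : s Vy j ≡ μ Vy j
      yi = trans (fr Vy tt j) (vy≗ si j)
      open Table (table-cong {st} {s} (fr Edg tt) (fr Nbr tt) tb)
      nothing-free : choice ≡ 0
      nothing-free = colour-none {j} {s} test λ {c} c< z → stuck (c , c<
        , none (x< g) c< (trans (cong (λ v → s Edg (9 * v + c)) (sym xi)) (m+n≡0⇒m≡0 (s Edg (9 * s Vx j + c)) z))
        , none (y< g) c< (trans (cong (λ v → s Edg (9 * v + c)) (sym yi)) (m+n≡0⇒n≡0 (s Edg (9 * s Vx j + c)) z)))
      newCol≡0 : newCol ≡ 0
      newCol≡0 = trans (branch-nonzero (nz ∘ trans (sym sAct))) nothing-free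
      colour≡ : st′ Col j ≡ 0
      colour≡ = trans col≡ newCol≡0
      act1 : st′ Act j ≡ 1
      act1 = trans act≡ (trans (branch-nonzero (nz ∘ trans (sym sAct))) (branch-zero newCol≡0))

  tally-spec : ∀ {st : St} → let open Tally (st Act) (st Miss) (st Want) in 0 < n → (∀ {k} → k < 81 → st Cnt k ≡ 0) → st Best 0 ≡ 0 → st BestA 0 ≡ 1 → st BestB 0 ≡ 2 →
               (∀ {e} → e < m → st Act e ≢ 0 → Valid (st Miss e) (st Want e)) →
               let st′ = iter m tallyB st in Tallied m (st′ Cnt) (st′ Best 0) (st′ BestA 0) (st′ BestB 0)
  tally-spec {st} 0<n cnt0 best0 a1 b2 va = iter-ind (λ i s → Tallied i (s Cnt) (s Best 0) (s BestA 0) (s BestB 0)) tallyB m base ind-step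
    where
    open Tally (st Act) (st Miss) (st Want)
    base : Tallied 0 (st Cnt) (st Best 0) (st BestA 0) (st BestB 0)
    base = record
      { active = z≤n ; below = λ k< → ≤-trans (≤-reflexive (cnt0 k<)) z≤n
      ; champion = ≤-trans (≤-reflexive best0) z≤n
      ; valid = subst₂ Valid (sym a1) (sym b2) (record { a<9 = s≤s (s≤s z≤n) ; b<9 = s≤s (s≤s (s≤s z≤n)) ; a≢0 = λ () ; b≢0 = λ () ; a≢b = λ () })
      ; exact = λ k< → ≤-trans (≤-reflexive (cnt0 k<)) z≤n }
    ind-step : ∀ {i s} → i < m → (∀ k → T (not (writes k tallyB)) → ∀ j → s k j ≡ st k j) →
               Tallied i (s Cnt) (s Best 0) (s BestA 0) (s BestB 0) →
               let s′ = exec i tallyB s in Tallied (suc i) (s′ Cnt) (s′ Best 0) (s′ BestA 0) (s′ BestB 0)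
    ind-step {i} {s} i< fr t with st Act i ≟ 0
    ... | yes z = tallied-skip z (λ k → unchanged (9 * s Miss i + s Want i) k (branch-zero az))
                    (branch-zero az) (branch-zero az) (branch-zero az) t
      where
      az : s Act i ≡ 0
      az = trans (fr Act tt i) z
      unchanged : ∀ κ k {v} → v ≡ s Cnt κ → upd (s Cnt) κ v k ≡ s Cnt k
      unchanged κ k eq with κ ≟ k
      ... | yes refl = trans (upd-same (s Cnt) {κ} refl) eq
      ... | no ne = upd-other (s Cnt) ne
    ... | no nz = tallied-step nz (va i< nz) cnt≡
          (trans (record≡ (upd (s Cnt) κ (branch (s Act i) (suc (s Cnt κ)) (s Cnt κ)) κ) (s Best 0))
            (cong (λ w → branch (suc (s Cnt (key i)) ∸ s Best 0) w (s Best 0)) counted))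
          (trans (record≡ (s Miss i) (s BestA 0)) (cong (λ w → branch (suc (s Cnt (key i)) ∸ s Best 0) w (s BestA 0)) (fr Miss tt i)))
          (trans (record≡ (s Want i) (s BestB 0)) (cong (λ w → branch (suc (s Cnt (key i)) ∸ s Best 0) w (s BestB 0)) (fr Want tt i))) t
      where
      κ : ℕ
      κ = 9 * s Miss i + s Want i
      κ≡ : κ ≡ key i
      κ≡ = cong₂ (λ a b → 9 * a + b) (fr Miss tt i) (fr Want tt i)
      anz : s Act i ≢ 0
      anz = nz ∘ trans (sym (fr Act tt i))
      cnt≡ : ∀ k → exec i tallyB s Cnt k ≡ upd (s Cnt) (key i) (suc (s Cnt (key i))) k
      cnt≡ k = trans (cong (λ v → upd (s Cnt) κ v k) (branch-nonzero anz)) (cong (λ κ → upd (s Cnt) κ (suc (s Cnt κ)) k) κ≡)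
      counted : upd (s Cnt) κ (branch (s Act i) (suc (s Cnt κ)) (s Cnt κ)) κ ≡ suc (s Cnt (key i))
      counted = trans (upd-same (s Cnt) {κ} refl) (trans (branch-nonzero anz) (cong (λ κ → suc (s Cnt κ)) κ≡))
      record≡ : ∀ t u → branch (s Act i) (branch (upd (s Cnt) κ (branch (s Act i) (suc (s Cnt κ)) (s Cnt κ)) κ ∸ s Best 0) t u) u ≡
                branch (suc (s Cnt (key i)) ∸ s Best 0) t u
      record≡ t u = trans (branch-nonzero anz) (cong (λ c → branch (c ∸ s Best 0) t u) counted)

-- Greedy choice of compatible exchanges

setIf : ℕ → (ℕ → ℕ) → ℕ → ℕ → ℕ
setIf a f j = upd f j (branch a 1 (f j))

setIf-idle : ∀ {a} f j w → a ≡ 0 → setIf a f j w ≡ f w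
setIf-idle f j w refl with j ≟ w
... | yes refl = upd-same f {j} refl
... | no ne = upd-other f ne

setIf-hit : ∀ {a} f {j w} → a ≢ 0 → j ≡ w → setIf a f j w ≡ 1
setIf-hit f {j} nz refl = trans (upd-same f {j} refl) (branch-nonzero nz)

setIf-miss : ∀ {a} f {j w} → j ≢ w → setIf a f j w ≡ f w
setIf-miss f ne = upd-other f ne

setIf-mono : ∀ {a} f j w → f w ≢ 0 → setIf a f j w ≢ 0
setIf-mono {a} f j w nz with j ≟ w
... | yes refl = λ z → branch-elim (_≢ 0) a {1} {f j} (λ _ → λ ()) (λ _ → nz) (trans (sym (upd-same f {j} refl)) z)
... | no ne = nz ∘ trans (sym (upd-other f ne))

setIf-from : ∀ {a} f j w → setIf a f j w ≢ 0 → f w ≢ 0 ⊎ j ≡ w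
setIf-from f j w nz with j ≟ w
... | yes eq = inj₂ eq
... | no ne = inj₁ (nz ∘ trans (upd-other f ne))

setIf-count : ∀ {a} f j N → count (posᵇ ∘ setIf a f j) N ≤ 1 + count (posᵇ ∘ f) N
setIf-count {a} f j N = ≤-trans (count-cover {posᵇ ∘ setIf a f j} {λ w → j ≡ᵇ w} {posᵇ ∘ f} N (λ {w} _ t → go w (setIf-from f j w (posᵇ⁻ t))))
  (+-monoˡ-≤ (count (posᵇ ∘ f) N) (count-injection {λ w → j ≡ᵇ w} {λ _ → true} N 1 (λ _ → 0) (λ _ _ → s≤s z≤n , tt)
    (λ {p} {q} _ _ t u _ → trans (sym (≡ᵇ⇒≡ j p t)) (≡ᵇ⇒≡ j q u))))
  where
  go : ∀ w → f w ≢ 0 ⊎ j ≡ w → T (j ≡ᵇ w) ⊎ T (posᵇ (f w))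
  go w (inj₁ nz) = inj₂ (posᵇ⁺ nz)
  go w (inj₂ eq) = inj₁ (≡⇒≡ᵇ j w eq)

-- Greedy selection: a request wants the chain ending at M flipped and the chain
-- ending at X kept; it is granted if neither of these chains is locked yet, and
-- then locks both.  A locked chain has two ends, so it can turn down few requests.

module Selection (n : ℕ) (End : ℕ → Set) (F : ℕ → ℕ) (F-inv : ∀ {v} → End v → F (F v) ≡ v) (F-end : ∀ {v} → End v → End (F v))
                 (X M : ℕ → ℕ) where

  record Requesting (e : ℕ) : Set where
    field
      x<    : X e < n
      m<    : M e < n
      fm<   : F (M e) < n
      x-end : End (X e)
      m-end : End (M e)
      x≢m   : X e ≢ M e
      x≢fm  : X e ≢ F (M e)

  -- By `bit⇒lock` an unlocked chain is not to be exchanged, so a new request can still have the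
  -- chain of X kept. `lock-far` and `bit-far` make both marks properties of chains and not of
  -- single ends.
  record Selected (i : ℕ) (want ac act bit lock : ℕ → ℕ) : Set where
    field
      bit⇒lock : ∀ {v} → v < n → bit v ≢ 0 → lock v ≢ 0
      lock-far : ∀ {v} → End v → v < n → F v < n → lock (F v) ≢ 0 → lock v ≢ 0
      bit-far  : ∀ {v} → End v → v < n → F v < n → bit (F v) ≡ bit v
      pending  : ∀ {e} → i ≤ e → act e ≡ ac e
      granted  : ∀ {e} → e < i → act e ≢ 0 → want e ≢ 0 × bit (X e) ≡ 0 × bit (M e) ≢ 0 × lock (X e) ≢ 0
      denied   : ∀ {e} → e < i → want e ≢ 0 → lock (X e) ≢ 0 ⊎ lock (M e) ≢ 0
      few      : count (posᵇ ∘ lock) n ≤ 4 * count (posᵇ ∘ act) i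
  open Selected
  open Requesting

  module _ {want ac act bit lock act′ bit′ lock′ : ℕ → ℕ} {i a : ℕ}
           (act≡ : ∀ e → act′ e ≡ upd act i a e)
           (bit≡ : ∀ v → bit′ v ≡ setIf a (setIf a bit (M i)) (F (M i)) v)
           (lock≡ : ∀ v → lock′ v ≡ setIf a (setIf a (setIf a (setIf a lock (X i)) (F (X i))) (M i)) (F (M i)) v) where

    act-same : act′ i ≡ a
    act-same = trans (act≡ i) (upd-same act {i} refl)

    act-other : ∀ {e} → e ≢ i → act′ e ≡ act e
    act-other ne = trans (act≡ _) (upd-other act (ne ∘ sym))

    pending′ : (∀ {e} → i ≤ e → act e ≡ ac e) → ∀ {e} → suc i ≤ e → act′ e ≡ ac e
    pending′ p le = trans (act-other λ { refl → <⇒≱ le ≤-refl }) (p (<⇒≤ le))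

    pass : a ≡ 0 → (want i ≢ 0 → lock (X i) ≢ 0 ⊎ lock (M i) ≢ 0) → Selected i want ac act bit lock → Selected (suc i) want ac act′ bit′ lock′
    pass a0 den sel = record
      { bit⇒lock = λ v< nz → bit⇒lock sel v< (nz ∘ trans (b≡ _)) ∘ trans (sym (l≡ _))
      ; lock-far = λ en v< f< nz → lock-far sel en v< f< (nz ∘ trans (l≡ _)) ∘ trans (sym (l≡ _))
      ; bit-far = λ en v< f< → trans (b≡ _) (trans (bit-far sel en v< f<) (sym (b≡ _)))
      ; pending = pending′ (pending sel)
      ; granted = gr
      ; denied = dn
      ; few = ≤-trans (≤-reflexive (sum-cong n (λ {v} _ → cong (ind ∘ posᵇ) (l≡ v)))) (≤-trans (few sel) (*-monoʳ-≤ 4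
          (≤-trans (≤-reflexive (sum-cong i (λ {e} e< → cong (ind ∘ posᵇ) (sym (act-other (<⇒≢ e<)))))) (m≤n+m _ (ind (posᵇ (act′ i))))))) }
      where
      b≡ : ∀ v → bit′ v ≡ bit v
      b≡ v = trans (bit≡ v) (trans (setIf-idle (setIf a bit (M i)) (F (M i)) v a0) (setIf-idle bit (M i) v a0))
      l≡ : ∀ v → lock′ v ≡ lock v
      l≡ v = trans (lock≡ v) (trans (setIf-idle _ (F (M i)) v a0) (trans (setIf-idle _ (M i) v a0)
        (trans (setIf-idle _ (F (X i)) v a0) (setIf-idle lock (X i) v a0))))
      gr : ∀ {e} → e < suc i → act′ e ≢ 0 → want e ≢ 0 × bit′ (X e) ≡ 0 × bit′ (M e) ≢ 0 × lock′ (X e) ≢ 0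
      gr {e} e< nz with e ≟ i
      ... | yes refl = ⊥-elim (nz (trans act-same a0))
      ... | no ne with granted sel (≤∧≢⇒< (≤-pred e<) ne) (nz ∘ trans (act-other ne))
      ...   | w , bx , bm , lx = w , trans (b≡ _) bx , bm ∘ trans (sym (b≡ _)) , lx ∘ trans (sym (l≡ _))
      dn : ∀ {e} → e < suc i → want e ≢ 0 → lock′ (X e) ≢ 0 ⊎ lock′ (M e) ≢ 0
      dn {e} e< w with e ≟ i
      ... | yes refl = case den w of λ { (inj₁ p) → inj₁ (p ∘ trans (sym (l≡ _))) ; (inj₂ p) → inj₂ (p ∘ trans (sym (l≡ _))) }
      ... | no ne = case denied sel (≤∧≢⇒< (≤-pred e<) ne) w of λ
        { (inj₁ p) → inj₁ (p ∘ trans (sym (l≡ _))) ; (inj₂ p) → inj₂ (p ∘ trans (sym (l≡ _))) }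

    grant : a ≢ 0 → want i ≢ 0 → Requesting i → lock (X i) ≡ 0 → lock (M i) ≡ 0 →
            Selected i want ac act bit lock → Selected (suc i) want ac act′ bit′ lock′
    grant nz wi req lx lm sel = record
      { bit⇒lock = λ {v} v< b → case bit-from v b of λ
          { (inj₁ b′) → lock-mono v (bit⇒lock sel v< b′) ; (inj₂ (inj₁ e)) → lock-m v e ; (inj₂ (inj₂ e)) → lock-fm v e }
      ; lock-far = lf
      ; bit-far = bf
      ; pending = pending′ (pending sel)
      ; granted = gr
      ; denied = dn
      ; few = ≤-trans (≤-reflexive (sum-cong n (λ {v} _ → cong (ind ∘ posᵇ) (lock≡ v)))) (≤-trans four
          (≤-reflexive (trans (sym (*-suc 4 (count (posᵇ ∘ act) i))) (cong (4 *_) (sym counted))))) }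
      where
      p fp x fx : ℕ
      p = M i
      fp = F (M i)
      x = X i
      fx = F (X i)
      l₁ l₂ l₃ : ℕ → ℕ
      l₁ = setIf a lock x
      l₂ = setIf a l₁ fx
      l₃ = setIf a l₂ p
      four : count (posᵇ ∘ setIf a l₃ fp) n ≤ 4 + 4 * count (posᵇ ∘ act) i
      four = ≤-trans (setIf-count l₃ fp n) (s≤s (≤-trans (setIf-count l₂ p n) (s≤s (≤-trans (setIf-count l₁ fx n)
        (s≤s (≤-trans (setIf-count lock x n) (s≤s (few sel))))))))
      counted : count (posᵇ ∘ act′) (suc i) ≡ suc (count (posᵇ ∘ act) i)
      counted = cong₂ _+_ (ind-true (posᵇ⁺ (nz ∘ trans (sym act-same)))) (sum-cong i (λ {e} e< → cong (ind ∘ posᵇ) (act-other (<⇒≢ e<))))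
      nonzero : ∀ {k} → k ≡ 1 → k ≢ 0
      nonzero refl ()
      lock-mono : ∀ v → lock v ≢ 0 → lock′ v ≢ 0
      lock-mono v h = setIf-mono l₃ fp v (setIf-mono l₂ p v (setIf-mono l₁ fx v (setIf-mono lock x v h))) ∘ trans (sym (lock≡ v))
      lock-x : ∀ v → x ≡ v → lock′ v ≢ 0
      lock-x v e = setIf-mono l₃ fp v (setIf-mono l₂ p v (setIf-mono l₁ fx v (nonzero (setIf-hit lock nz e)))) ∘ trans (sym (lock≡ v))
      lock-fx : ∀ v → fx ≡ v → lock′ v ≢ 0
      lock-fx v e = setIf-mono l₃ fp v (setIf-mono l₂ p v (nonzero (setIf-hit l₁ nz e))) ∘ trans (sym (lock≡ v))
      lock-m : ∀ v → p ≡ v → lock′ v ≢ 0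
      lock-m v e = setIf-mono l₃ fp v (nonzero (setIf-hit l₂ nz e)) ∘ trans (sym (lock≡ v))
      lock-fm : ∀ v → fp ≡ v → lock′ v ≢ 0
      lock-fm v e = nonzero (setIf-hit l₃ nz e) ∘ trans (sym (lock≡ v))
      lock-from : ∀ v → lock′ v ≢ 0 → lock v ≢ 0 ⊎ x ≡ v ⊎ fx ≡ v ⊎ p ≡ v ⊎ fp ≡ v
      lock-from v h with setIf-from l₃ fp v (h ∘ trans (lock≡ v))
      ... | inj₂ e = inj₂ (inj₂ (inj₂ (inj₂ e)))
      ... | inj₁ h₃ with setIf-from l₂ p v h₃
      ...   | inj₂ e = inj₂ (inj₂ (inj₂ (inj₁ e)))
      ...   | inj₁ h₂ with setIf-from l₁ fx v h₂
      ...     | inj₂ e = inj₂ (inj₂ (inj₁ e))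
      ...     | inj₁ h₁ with setIf-from lock x v h₁
      ...       | inj₂ e = inj₂ (inj₁ e)
      ...       | inj₁ h₀ = inj₁ h₀
      bit-from : ∀ v → bit′ v ≢ 0 → bit v ≢ 0 ⊎ p ≡ v ⊎ fp ≡ v
      bit-from v h with setIf-from (setIf a bit p) fp v (h ∘ trans (bit≡ v))
      ... | inj₂ e = inj₂ (inj₂ e)
      ... | inj₁ h₁ with setIf-from bit p v h₁
      ...   | inj₂ e = inj₂ (inj₁ e)
      ...   | inj₁ h₀ = inj₁ h₀
      bit-miss : ∀ {v} → p ≢ v → fp ≢ v → bit′ v ≡ bit v
      bit-miss {v} q r = trans (bit≡ v) (trans (setIf-miss (setIf a bit p) r) (setIf-miss bit q))
      bit-fm : ∀ {v} → fp ≡ v → bit′ v ≡ 1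
      bit-fm {v} e = trans (bit≡ v) (setIf-hit (setIf a bit p) nz e)
      bit-m : ∀ {v} → p ≡ v → bit′ v ≡ 1
      bit-m {v} e with fp ≟ v
      ... | yes e′ = bit-fm e′
      ... | no ne = trans (bit≡ v) (trans (setIf-miss (setIf a bit p) ne) (setIf-hit bit nz e))
      back : ∀ {v w} → End v → F v ≡ w → F w ≡ v
      back en refl = F-inv en
      lf : ∀ {v} → End v → v < n → F v < n → lock′ (F v) ≢ 0 → lock′ v ≢ 0
      lf {v} en v< f< h with lock-from (F v) h
      ... | inj₁ h₀ = lock-mono v (lock-far sel en v< f< h₀)
      ... | inj₂ (inj₁ e) = lock-fx v (back en (sym e))
      ... | inj₂ (inj₂ (inj₁ e)) = lock-x v (trans (sym (F-inv (x-end req))) (trans (cong F e) (F-inv en)))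
      ... | inj₂ (inj₂ (inj₂ (inj₁ e))) = lock-fm v (back en (sym e))
      ... | inj₂ (inj₂ (inj₂ (inj₂ e))) = lock-m v (trans (sym (F-inv (m-end req))) (trans (cong F e) (F-inv en)))
      bf : ∀ {v} → End v → v < n → F v < n → bit′ (F v) ≡ bit′ v
      bf {v} en v< f< with p ≟ v | fp ≟ v
      ... | yes e | _ = trans (bit-fm (cong F e)) (sym (bit-m e))
      ... | no _ | yes e = trans (bit-m (trans (sym (F-inv (m-end req))) (cong F e))) (sym (bit-fm e))
      ... | no q | no r = trans (bit-miss (λ e → r (back en (sym e))) (λ e → q (trans (sym (F-inv (m-end req))) (trans (cong F e) (F-inv en)))))
                            (trans (bit-far sel en v< f<) (sym (bit-miss q r)))
      gr : ∀ {e} → e < suc i → act′ e ≢ 0 → want e ≢ 0 × bit′ (X e) ≡ 0 × bit′ (M e) ≢ 0 × lock′ (X e) ≢ 0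
      gr {e} e< h with e ≟ i
      ... | yes refl = wi , trans (bit-miss (x≢m req ∘ sym) (x≢fm req ∘ sym)) bx , nonzero (bit-m refl) , lock-x x refl
        where
        bx : bit x ≡ 0
        bx with bit x ≟ 0
        ... | yes z = z
        ... | no b = ⊥-elim (bit⇒lock sel (x< req) b lx)
      ... | no ne with granted sel (≤∧≢⇒< (≤-pred e<) ne) (h ∘ trans (act-other ne))
      -- The end X e of an earlier grant is locked, while the chain of the new M was not; hence they
      -- lie on different chains and the bit at X e stays 0.
      ...   | w , bx , bm , l = w , trans (bit-miss (λ e → l (trans (cong lock (sym e)) lm))
                (λ e → lock-far sel (m-end req) (m< req) (fm< req) (subst (λ v → lock v ≢ 0) (sym e) l) lm)) bx
              , (λ z → keep (M e) bm z) , lock-mono (X e) l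
        where
        keep : ∀ v → bit v ≢ 0 → bit′ v ≢ 0
        keep v b = setIf-mono (setIf a bit p) fp v (setIf-mono bit p v b) ∘ trans (sym (bit≡ v))
      dn : ∀ {e} → e < suc i → want e ≢ 0 → lock′ (X e) ≢ 0 ⊎ lock′ (M e) ≢ 0
      dn {e} e< w with e ≟ i
      ... | yes refl = inj₁ (lock-x x refl)
      ... | no ne = case denied sel (≤∧≢⇒< (≤-pred e<) ne) w of λ
        { (inj₁ h) → inj₁ (lock-mono (X e) h) ; (inj₂ h) → inj₂ (lock-mono (M e) h) }

  -- Granted or denied, each request has a locked vertex among X and M. Different requests share no
  -- such vertex, so there are at most as many requests as locked vertices, and a grant locks four
  -- at most.
  many : ∀ {m want ac act bit lock} → (∀ {e} → e < m → want e ≢ 0 → Requesting e) →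
         (∀ {e f v} → e < m → f < m → want e ≢ 0 → want f ≢ 0 → v ≡ X e ⊎ v ≡ M e → v ≡ X f ⊎ v ≡ M f → e ≡ f) →
         Selected m want ac act bit lock → count (posᵇ ∘ want) m ≤ 4 * count (posᵇ ∘ act) m
  many {m} {want} {lock = lock} req apart sel = ≤-trans
    (count-injection {posᵇ ∘ want} {posᵇ ∘ lock} m n h into
      (λ {e} {f} e< f< t u eq → apart e< f< (posᵇ⁻ t) (posᵇ⁻ u) (h-one e) (subst (λ v → v ≡ X f ⊎ v ≡ M f) (sym eq) (h-one f))))
    (few sel)
    where
    h : ℕ → ℕ
    h e = branch (lock (X e)) (X e) (M e)
    h-one : ∀ e → h e ≡ X e ⊎ h e ≡ M e
    h-one e = branch-elim (λ v → v ≡ X e ⊎ v ≡ M e) (lock (X e)) (λ _ → inj₁ refl) (λ _ → inj₂ refl)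
    into : ∀ {e} → e < m → T (posᵇ (want e)) → h e < n × T (posᵇ (lock (h e)))
    into {e} e< t = branch-elim (λ v → v < n × T (posᵇ (lock v))) (lock (X e))
      (λ nz → x< (req e< (posᵇ⁻ t)) , posᵇ⁺ nz)
      (λ z → m< (req e< (posᵇ⁻ t)) , posᵇ⁺ (case denied sel e< (posᵇ⁻ t) of λ { (inj₁ p) → ⊥-elim (p z) ; (inj₂ p) → p }))

upd-idle : ∀ f {j v w} → v ≡ f j → upd f j v w ≡ f w
upd-idle f {j} {v} {w} eq with j ≟ w
... | yes refl = trans (upd-same f {j} refl) eq
... | no ne = upd-other f ne

distance : ℕ → ℕ → ℕ
distance a b = (a ∸ b) + (b ∸ a)

module Steps (N : Net) (inp : ℕ → ℕ) (μ : St) where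
  open Net N
  open Passes N inp μ public

  own-value : ∀ {st k j v} b → T (own b) → j < m → exec j b (iter j b st) k j ≡ v → iter m b st k j ≡ v
  own-value b t j< eq = trans (iter-at m b t j<) eq

  mark-spec : ∀ st {j} → j < m → let c = st Col j in
              iter m markB st Pair j ≡ branch (distance c (st BestA 0)) (branch (distance c (st BestB 0)) 0 1) 1
  mark-spec st {j} j< = own-value {st} {Pair} markB tt j< (trans (upd-same (s Pair) {j} {value (s Col j) (s BestA 0) (s BestB 0)} refl)
    (trans (cong (λ c → value c (s BestA 0) (s BestB 0)) (iter-frame j markB tt))
           (cong₂ (value (st Col j)) (iter-frame j markB tt) (iter-frame j markB tt))))
    where
    s : St
    s = iter j markB st
    value : ℕ → ℕ → ℕ → ℕ
    value c a b = branch (distance c a) (branch (distance c b) 0 1) 1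

  marked⁻ : ∀ c a b → branch (distance c a) (branch (distance c b) 0 1) 1 ≢ 0 → c ≡ a ⊎ c ≡ b
  marked⁻ c a b nz with c ≟ a | c ≟ b
  ... | yes p | _ = inj₁ p
  ... | no _ | yes q = inj₂ q
  ... | no p | no q = ⊥-elim (nz (trans (branch-nonzero (p ∘ ≠ₓ-zero c a)) (branch-nonzero (q ∘ ≠ₓ-zero c b))))

  marked⁺ : ∀ c a b → c ≡ a ⊎ c ≡ b → branch (distance c a) (branch (distance c b) 0 1) 1 ≢ 0
  marked⁺ c a b (inj₁ p) z = 1+n≢0 (trans (sym (branch-zero (zero-≠ₓ p))) z)
  marked⁺ c a b (inj₂ q) z = branch-elim (_≢ 0) (distance c a) {branch (distance c b) 0 1} {1}
    (λ _ z′ → 1+n≢0 (trans (sym (branch-zero (zero-≠ₓ q))) z′)) (λ _ → λ ()) z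

  module Linking (pr : ℕ → ℕ) where
    open Chains m src tgt pr loopless public

    -- `F1` and `F2` hold the ends at the moment of insertion, hence `far e` and not the final
    -- `far m`.
    Linked : ℕ → St → Set
    Linked i s = (∀ {v} → v < n → s Far v ≡ far i v) × (∀ {e} → e < i → s F1 e ≡ far e (src e) × s F2 e ≡ far e (tgt e))

    link-step : ∀ {i s u v} → i < m → s Src i ≡ u → s Tgt i ≡ v → src i ≡ u → tgt i ≡ v → s Pair i ≡ pr i → u < n → v < n →
                Linked i s → Linked (suc i) (exec i linkB s)
    link-step {i} {s} {u} {v} i< refl refl pu pv pp u< v< (fars , saved) = fars′ , saved′
      where
      f g p : ℕ
      f = s Far u
      g = s Far v
      p = s Pair i
      shape : ∀ w → exec i linkB s Far w ≡ upd (upd (s Far) f (branch p g (s Far f))) g (branch p f (upd (s Far) f (branch p g (s Far f)) g)) w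
      shape w rewrite ≡ᵇ-refl i = refl
      fars′ : ∀ {w} → w < n → exec i linkB s Far w ≡ far (suc i) w
      fars′ {w} w< = trans (shape w) (go (pr i ≟ 0))
        where
        go : Dec (pr i ≡ 0) → upd (upd (s Far) f (branch p g (s Far f))) g (branch p f (upd (s Far) f (branch p g (s Far f)) g)) w ≡ far (suc i) w
        go (yes z) = trans (upd-idle (upd (s Far) f (branch p g (s Far f))) {g} {w = w} (branch-zero (trans pp z)))
          (trans (upd-idle (s Far) {f} {w = w} (branch-zero (trans pp z))) (trans (fars w<) (sym (branch-zero z))))
        go (no nz) = trans (cong₂ (λ x y → upd (upd (s Far) f x) g y w) (branch-nonzero (nz ∘ trans (sym pp))) (branch-nonzero (nz ∘ trans (sym pp))))
          (trans ends (sym (branch-nonzero nz)))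
          where
          ends : upd (upd (s Far) f g) g f w ≡ link (far i) (src i) (tgt i) w
          ends = trans (outer (fars u<) (fars v<)) (cong₂ (λ x y → link (far i) x y w) (sym pu) (sym pv))
            where
            outer : ∀ {f′ g′} → f ≡ f′ → g ≡ g′ → upd (upd (s Far) f g) g f w ≡ upd (upd (far i) f′ g′) g′ f′ w
            outer refl refl with g ≡ᵇ w | f ≡ᵇ w
            ... | true  | _     = refl
            ... | false | true  = refl
            ... | false | false = fars w<
      saved′ : ∀ {e} → e < suc i → exec i linkB s F1 e ≡ far e (src e) × exec i linkB s F2 e ≡ far e (tgt e)
      saved′ {e} e< with e ≟ i
      ... | yes refl = trans (upd-same (s F1) {i} refl) (trans (fars u<) (cong (far i) (sym pu)))
                     , trans (upd-same (s F2) {i} refl) (trans (fars v<) (cong (far i) (sym pv)))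
      ... | no ne = trans (upd-other (s F1) (ne ∘ sym)) (proj₁ (saved (≤∧≢⇒< (≤-pred e<) ne)))
                  , trans (upd-other (s F2) (ne ∘ sym)) (proj₂ (saved (≤∧≢⇒< (≤-pred e<) ne)))

    link-spec : ∀ {st} → Drawn st → (∀ j → st Pair j ≡ pr j) → (∀ {v} → v < n → st Far v ≡ v) → Linked m (iter m linkB st)
    link-spec {st} d prs far0 = iter-ind Linked linkB m (far0 , λ ()) λ {i} {s} i< fr l →
      link-step {i} {s} i< (trans (fr Src tt i) (Drawn.src≗ d i)) (trans (fr Tgt tt i) (Drawn.tgt≗ d i)) refl refl
        (trans (fr Pair tt i) (prs i)) (src< i<) (tgt< i<) l

    spread-step : ∀ {i s u v f g b₀} j → j ≡ m ∸ suc i → s Src j ≡ u → s Tgt j ≡ v → s F1 j ≡ f → s F2 j ≡ g → s Pair j ≡ pr j →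
                  src j ≡ u → tgt j ≡ v → far j (src j) ≡ f → far j (tgt j) ≡ g →
                  (∀ w → s Bit w ≡ bits b₀ i w) → ∀ w → exec i spreadB s Bit w ≡ bits b₀ (suc i) w
    spread-step {i} {s} {b₀ = b₀} j refl refl refl refl refl pp pu pv pf pg old w = go (pr j ≟ 0)
      where
      u t f g p : ℕ
      u = s Src j
      t = s Tgt j
      f = s F1 j
      g = s F2 j
      p = s Pair j
      B₁ : ℕ → ℕ
      B₁ = upd (s Bit) u (branch p (s Bit f) (s Bit u))
      go : Dec (pr j ≡ 0) → upd B₁ t (branch p (B₁ g) (B₁ t)) w ≡ bits b₀ (suc i) w
      go (yes z) = trans (upd-idle B₁ {t} {w = w} (branch-zero (trans pp z)))
        (trans (upd-idle (s Bit) {u} {w = w} (branch-zero (trans pp z))) (trans (old w) (sym (branch-zero z))))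
      go (no nz) = trans (cong₂ (λ x y → upd (upd (s Bit) u x) t y w) (branch-nonzero (nz ∘ trans (sym pp))) inner)
        (trans (spread≡ {u} {t} {f} {g}) (trans (cong (λ q → q w) spreads) (sym (branch-nonzero nz))))
        where
        inner : branch p (B₁ g) (B₁ t) ≡ upd (s Bit) u (s Bit f) g
        inner = trans (branch-nonzero (nz ∘ trans (sym pp))) (cong (λ x → upd (s Bit) u x g) (branch-nonzero (nz ∘ trans (sym pp))))
        spread≡ : ∀ {u t f g} → upd (upd (s Bit) u (s Bit f)) t (upd (s Bit) u (s Bit f) g) w ≡
                  upd (upd (bits b₀ i) u (bits b₀ i f)) t (upd (bits b₀ i) u (bits b₀ i f) g) w
        spread≡ {u} {t} {f} {g} = upd-cong t (upd-cong u old (old f)) (upd-cong u old (old f) g) w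
        spreads : upd (upd (bits b₀ i) u (bits b₀ i f)) t (upd (bits b₀ i) u (bits b₀ i f) g) ≡ spread j (bits b₀ i)
        spreads rewrite pu | pv | pf | pg = refl

    spread-spec : ∀ {st} → Drawn st → (∀ j → st Pair j ≡ pr j) → (∀ {e} → e < m → st F1 e ≡ far e (src e) × st F2 e ≡ far e (tgt e)) →
                  ∀ w → iter m spreadB st Bit w ≡ bits (st Bit) m w
    spread-spec {st} d prs saved = iter-ind (λ i s → ∀ w → s Bit w ≡ bits (st Bit) i w) spreadB m (λ w → refl) λ {i} {s} i< fr old →
      let j = m ∸ suc i
          j< = ∸-monoʳ-< {m} {suc i} {0} (s≤s z≤n) i< in
      spread-step {i} {s} j refl (trans (fr Src tt j) (Drawn.src≗ d j)) (trans (fr Tgt tt j) (Drawn.tgt≗ d j))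
        (trans (fr F1 tt j) (proj₁ (saved j<))) (trans (fr F2 tt j) (proj₂ (saved j<))) (trans (fr Pair tt j) (prs j)) refl refl refl refl old

  mate-spec : ∀ st {j} → j < m → iter m mateB st Mate j ≡ branch (distance (st Far (st Vx j)) (st Vy j)) (st Vy j) (st Vz j)
  mate-spec st {j} j< = own-value {st} {Mate} mateB tt j< (trans (upd-same (s Mate) {j} {value (s Far (s Vx j)) (s Vy j) (s Vz j)} refl)
    (trans (cong₂ (value (s Far (s Vx j))) (iter-frame j mateB tt) (iter-frame j mateB tt))
      (cong (λ f → value f (st Vy j) (st Vz j)) (trans (iter-frame j mateB tt) (cong (st Far) (iter-frame j mateB tt))))))
    where
    s : St
    s = iter j mateB st
    value : ℕ → ℕ → ℕ → ℕ
    value f y z = branch (distance f y) y z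

  recolour-spec : ∀ st {j} → j < m → iter m recolourB st Col j ≡ branch (st Bit (st Src j)) (swap (st BestA 0) (st BestB 0) (st Col j)) (st Col j)
  recolour-spec st {j} j< = own-value {st} {Col} recolourB tt j< (trans (upd-same (s Col) {j} {value (s Bit (s Src j)) (s Col j) (s BestA 0) (s BestB 0)} refl)
    (trans (cong₂ (λ t c → value t c (s BestA 0) (s BestB 0)) (trans (iter-frame j recolourB tt) (cong (st Bit) (iter-frame j recolourB tt)))
                  (iter-before j recolourB tt ≤-refl))
    (trans (cong₂ (value (st Bit (st Src j)) (st Col j)) (iter-frame j recolourB tt) (iter-frame j recolourB tt))
           (cong (λ c → branch (st Bit (st Src j)) c (st Col j)) (swapping (st Col j) (st BestA 0) (st BestB 0))))))
    where
    s : St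
    s = iter j recolourB st
    value : ℕ → ℕ → ℕ → ℕ → ℕ
    value t c a b = branch t (branch (distance c a) (branch (distance c b) c a) b) c
    swapping : ∀ c a b → branch (distance c a) (branch (distance c b) c a) b ≡ swap a b c
    swapping c a b with c ≟ a | c ≟ b
    ... | yes refl | _ = trans (branch-zero (zero-≠ₓ {c} refl)) (sym (swap-left c b))
    ... | no p | yes refl = trans (branch-nonzero (p ∘ ≠ₓ-zero c a)) (trans (branch-zero (zero-≠ₓ {c} refl)) (sym (swap-right a c)))
    ... | no p | no q = trans (branch-nonzero (p ∘ ≠ₓ-zero c a)) (trans (branch-nonzero (q ∘ ≠ₓ-zero c b)) (sym (swap-other p q)))

  module Selecting (want : ℕ → ℕ) (End : ℕ → Set) (F X M : ℕ → ℕ) (F-inv : ∀ {v} → End v → F (F v) ≡ v) (F-end : ∀ {v} → End v → End (F v)) where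
    open Selection n End F F-inv F-end X M public

    select-spec : ∀ {st} → (∀ j → st Vx j ≡ X j) → (∀ j → st Mate j ≡ M j) → (∀ v → st Far v ≡ F v) →
                  (∀ {v} → v < n → st Lock v ≡ 0) → (∀ {v} → v < n → st Bit v ≡ 0) →
                  (∀ {e} → e < m → want e ≢ 0 → Requesting e) →
                  (∀ {e} → want e ≢ 0 → st Act e ≢ 0 × st Miss e ≡ st BestA 0 × st Want e ≡ st BestB 0) →
                  (∀ {e} → st Act e ≢ 0 → st Miss e ≡ st BestA 0 → st Want e ≡ st BestB 0 → want e ≢ 0) →
                  let st′ = iter m selectB st in Selected m want (st Act) (st′ Act) (st′ Bit) (st′ Lock)
    select-spec {st} xs ms fs lock0 bit0 req want⁻ want⁺ =
      iter-ind (λ i s → Selected i want (st Act) (s Act) (s Bit) (s Lock)) selectB m base (λ {i} {s} → ind-step i s)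
      where
      base : Selected 0 want (st Act) (st Act) (st Bit) (st Lock)
      base = record
        { bit⇒lock = λ v< nz → ⊥-elim (nz (bit0 v<)) ; lock-far = λ _ v< f< nz → ⊥-elim (nz (lock0 f<))
        ; bit-far = λ _ v< f< → trans (bit0 f<) (sym (bit0 v<)) ; pending = λ _ → refl ; granted = λ () ; denied = λ ()
        ; few = ≤-trans (≤-reflexive (sum-cong n (λ v< → cong (ind ∘ posᵇ) (lock0 v<)))) (≤-trans (sum≤ 0 n (λ _ → ≤-refl)) (≤-reflexive (*-zeroʳ n))) }
      ind-step : ∀ i s → i < m → (∀ k → T (not (writes k selectB)) → ∀ j → s k j ≡ st k j) → Selected i want (st Act) (s Act) (s Bit) (s Lock) →
                 let s′ = exec i selectB s in Selected (suc i) want (st Act) (s′ Act) (s′ Bit) (s′ Lock)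
      ind-step i s i< fr sel = go (D ≟ 0) (st Act i ≟ 0)
        where
        D val a : ℕ
        D = distance (s Miss i) (s BestA 0) + distance (s Want i) (s BestB 0) + s Lock (s Vx i) + s Lock (s Mate i)
        val = branch (s Act i) (branch D 0 1) 0
        a = exec i selectB s Act i
        a≡ : a ≡ val
        a≡ = upd-same (s Act) {i} refl
        act≡ : ∀ e → exec i selectB s Act e ≡ upd (s Act) i a e
        act≡ e = cong (λ v → upd (s Act) i v e) (sym a≡)
        x≡ : s Vx i ≡ X i
        x≡ = trans (fr Vx tt i) (xs i)
        m≡ : s Mate i ≡ M i
        m≡ = trans (fr Mate tt i) (ms i)
        far≡ : ∀ {v w} → v ≡ w → s Far v ≡ F w
        far≡ refl = trans (fr Far tt _) (fs _)
        bit≡ : ∀ v → exec i selectB s Bit v ≡ setIf a (setIf a (s Bit) (M i)) (F (M i)) v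
        bit≡ v = cong₂ (λ p q → setIf a (setIf a (s Bit) p) q v) m≡ (far≡ m≡)
        lock≡ : ∀ v → exec i selectB s Lock v ≡ setIf a (setIf a (setIf a (setIf a (s Lock) (X i)) (F (X i))) (M i)) (F (M i)) v
        lock≡ v = trans (cong₂ (λ p q → setIf a (setIf a (setIf a (setIf a (s Lock) p) q) (s Mate i)) (s Far (s Mate i)) v) x≡ (far≡ x≡))
                        (cong₂ (λ p q → setIf a (setIf a (setIf a (setIf a (s Lock) (X i)) (F (X i))) p) q v) m≡ (far≡ m≡))
        ac≡ : s Act i ≡ st Act i
        ac≡ = Selected.pending sel ≤-refl
        lx : s Lock (s Vx i) ≡ s Lock (X i)
        lx = cong (s Lock) x≡
        lm : s Lock (s Mate i) ≡ s Lock (M i)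
        lm = cong (s Lock) m≡
        miss0 : st Miss i ≡ st BestA 0 → distance (s Miss i) (s BestA 0) ≡ 0
        miss0 eq = zero-≠ₓ (trans (fr Miss tt i) (trans eq (sym (fr BestA tt 0))))
        want0 : st Want i ≡ st BestB 0 → distance (s Want i) (s BestB 0) ≡ 0
        want0 eq = zero-≠ₓ (trans (fr Want tt i) (trans eq (sym (fr BestB tt 0))))
        go : Dec (D ≡ 0) → Dec (st Act i ≡ 0) → let s′ = exec i selectB s in Selected (suc i) want (st Act) (s′ Act) (s′ Bit) (s′ Lock)
        go _ (yes z) = pass act≡ bit≡ lock≡ (trans a≡ (branch-zero (trans ac≡ z))) (λ w → ⊥-elim (proj₁ (want⁻ w) z)) sel
        go (no nz) _ = pass act≡ bit≡ lock≡ (trans a≡ (branch-elim (_≡ 0) (s Act i) (λ _ → branch-nonzero nz) (λ _ → refl))) blocked sel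
          where
          blocked : want i ≢ 0 → s Lock (X i) ≢ 0 ⊎ s Lock (M i) ≢ 0
          blocked w with s Lock (X i) ≟ 0 | s Lock (M i) ≟ 0
          ... | no p | _ = inj₁ p
          ... | yes _ | no q = inj₂ q
          ... | yes p | yes q = ⊥-elim (nz (cong₂ _+_ (cong₂ _+_ (cong₂ _+_ (miss0 (proj₁ (proj₂ (want⁻ w)))) (want0 (proj₂ (proj₂ (want⁻ w))))) (trans lx p)) (trans lm q)))
        go (yes z) (no nz) = grant act≡ bit≡ lock≡ (λ a0 → 1+n≢0 (trans (sym (trans a≡ (trans (branch-nonzero (nz ∘ trans (sym ac≡))) (branch-zero z)))) a0))
            w (req i< w) (trans (sym lx) (m+n≡0⇒n≡0 (distance (s Miss i) (s BestA 0) + distance (s Want i) (s BestB 0)) (m+n≡0⇒m≡0 (distance (s Miss i) (s BestA 0) + distance (s Want i) (s BestB 0) + s Lock (s Vx i)) z)))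
            (trans (sym lm) (m+n≡0⇒n≡0 (distance (s Miss i) (s BestA 0) + distance (s Want i) (s BestB 0) + s Lock (s Vx i)) z)) sel
          where
          d0 : distance (s Miss i) (s BestA 0) + distance (s Want i) (s BestB 0) ≡ 0
          d0 = m+n≡0⇒m≡0 _ (m+n≡0⇒m≡0 (distance (s Miss i) (s BestA 0) + distance (s Want i) (s BestB 0) + s Lock (s Vx i)) z)
          w : want i ≢ 0
          w = want⁺ nz (trans (sym (fr Miss tt i)) (trans (≠ₓ-zero _ _ (m+n≡0⇒m≡0 (distance (s Miss i) (s BestA 0)) d0)) (fr BestA tt 0)))
                       (trans (sym (fr Want tt i)) (trans (≠ₓ-zero _ _ (m+n≡0⇒n≡0 (distance (s Miss i) (s BestA 0)) d0)) (fr BestB tt 0)))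

-- The stages

module Invariants (N : Net) (inp : ℕ → ℕ) (μ : St) (inW : ℕ → Bool) where
  open Net N
  open Steps N inp μ public
  open Site

  Corner : ℕ → ℕ → Set
  Corner j v = v ≡ μ Vx j ⊎ v ≡ μ Vy j ⊎ v ≡ μ Vz j

  -- `apart` is the form in which independence enters the stages: no vertex is a corner of two
  -- active edges.
  record Sound (st : St) (C : ℕ → ℕ) : Set where
    field
      drawn    : Drawn st
      sited    : Sited st
      col≗     : ∀ {f} → f < m → st Col f ≡ C f
      C<       : ∀ {f} → f < m → C f < 9
      proper   : Proper C
      outside  : ∀ {f} → f < m → ¬ T (inW f) → C f ≢ 0
      member   : ∀ {e} → e < m → st Act e ≢ 0 → T (inW e)
      geometry : ∀ {e} → e < m → st Act e ≢ 0 → Geometry (siteOf e)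
      waiting  : ∀ {e} → e < m → st Act e ≢ 0 → Waiting (siteOf e) C
      apart    : ∀ {e f v} → e < m → f < m → st Act e ≢ 0 → st Act f ≢ 0 → Corner e v → Corner f v → e ≡ f

  -- Holds between stages. Within a stage, after the exchanges and before the colouring, active
  -- edges may have a free colour, and only `Sound` is kept.
  record Inv (ρ : ℕ) (st : St) (C : ℕ → ℕ) : Set where
    field
      sound  : Sound st C
      stuck  : ∀ {e} → e < m → st Act e ≢ 0 → ¬ Free (siteOf e) C
      ranked : ∀ {e} → e < m → st Act e ≢ 0 → ∃[ r ] (r ≤ ρ × Rank (siteOf e) C r)

  solvedᵇ : (ℕ → ℕ) → ℕ → Bool
  solvedᵇ C e = if inW e then posᵇ (C e) else false

  solved : (ℕ → ℕ) → ℕ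
  solved C = count (solvedᵇ C) m

  active : St → ℕ
  active st = count (posᵇ ∘ st Act) m

  solvedᵇ⁺ : ∀ {C e} → T (inW e) → C e ≢ 0 → T (solvedᵇ C e)
  solvedᵇ⁺ {C} {e} w nz with inW e
  ... | true = posᵇ⁺ nz

  solvedᵇ⁻ : ∀ {C e} → T (solvedᵇ C e) → T (inW e) × C e ≢ 0
  solvedᵇ⁻ {C} {e} t with inW e
  ... | true = tt , posᵇ⁻ t

  -- All active edges choose from one table made before the loop. This is safe because their corners
  -- are distinct: two newly coloured edges have no common end, and no new colour appears at the
  -- corners of an edge that stays active.
  module Colouring {ρ : ℕ} {st : St} {C : ℕ → ℕ} (snd : Sound st C) (tb : Table st C)
                   (ready : ∀ {e} → e < m → st Act e ≢ 0 → ¬ Free (siteOf e) C → ∃[ r ] (r ≤ ρ × Rank (siteOf e) C r)) where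
    open Sound snd

    st′ : St
    st′ = iter m colourB st

    C′ : ℕ → ℕ
    C′ = st′ Col

    New : ℕ → Set
    New f = st Act f ≢ 0 × C′ f < 9 × C′ f ≢ 0 × ¬ Has C (μ Vx f) (C′ f) × ¬ Has C (μ Vy f) (C′ f) × st′ Act f ≡ 0

    Old : ℕ → Set
    Old f = C′ f ≡ C f × (st′ Act f ≢ 0 → st Act f ≢ 0 × ¬ Free (siteOf f) C) × (st Act f ≢ 0 → st′ Act f ≢ 0)

    status : ∀ {f} → f < m → New f ⊎ Old f
    status {f} f< with st Act f ≟ 0
    ... | yes z = inj₂ (proj₁ (idle z) , (λ nz → ⊥-elim (nz (proj₂ (idle z)))) , λ nz → ⊥-elim (nz z))
      where
      idle : st Act f ≡ 0 → st′ Col f ≡ C f × st′ Act f ≡ 0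
      idle = proj₁ (colour-spec {st} {C} sited tb col≗ f<)
    ... | no nz with proj₂ (colour-spec {st} {C} sited tb col≗ f<) nz (geometry f< nz) (Waiting.open-e (waiting f< nz))
    ...   | inj₁ (c< , c≢0 , ¬x , ¬y , a0) = inj₁ (nz , c< , c≢0 , ¬x , ¬y , a0)
    ...   | inj₂ (st-f , c0 , a1) = inj₂ (trans c0 (sym (Waiting.open-e (waiting f< nz))) , (λ _ → nz , st-f) , λ _ → a1)

    ends-corner : ∀ {f v} → f < m → st Act f ≢ 0 → inc f v → (v ≡ μ Vx f ⊎ v ≡ μ Vy f)
    ends-corner f< nz i = joins-two (Geometry.je (geometry f< nz)) i

    corner : ∀ {f v} → v ≡ μ Vx f ⊎ v ≡ μ Vy f → Corner f v
    corner (inj₁ p) = inj₁ p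
    corner (inj₂ p) = inj₂ (inj₁ p)

    clash : ∀ {f h v} → f < m → New f → h < m → Old h → inc f v → inc h v → C′ f ≢ C′ h
    clash f< (nz , _ , _ , ¬x , ¬y , _) h< (ch , _) i j eq with ends-corner f< nz i
    ... | inj₁ refl = ¬x (_ , h< , j , trans (sym ch) (sym eq))
    ... | inj₂ refl = ¬y (_ , h< , j , trans (sym ch) (sym eq))

    proper′ : Proper C′
    proper′ {f} {h} f< h< ne i j eq with status f< | status h<
    ... | inj₁ p | inj₁ q = ⊥-elim (ne (apart f< h< (proj₁ p) (proj₁ q) (corner (ends-corner f< (proj₁ p) i)) (corner (ends-corner h< (proj₁ q) j))))
    ... | inj₁ p | inj₂ q = ⊥-elim (clash f< p h< q i j eq)
    ... | inj₂ p | inj₁ q = ⊥-elim (clash h< q f< p j i (sym eq))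
    ... | inj₂ p | inj₂ q = trans (proj₁ p) (proper f< h< ne i j (trans (sym (proj₁ p)) (trans eq (proj₁ q))))

    was : ∀ {e} → e < m → st′ Act e ≢ 0 → st Act e ≢ 0 × ¬ Free (siteOf e) C
    was e< nz with status e<
    ... | inj₁ (_ , _ , _ , _ , _ , z) = ⊥-elim (nz z)
    ... | inj₂ (_ , h , _) = h nz

    near : ∀ {e} → e < m → st′ Act e ≢ 0 → ∀ {f} → f < m → Near (siteOf e) f → C′ f ≡ C f
    near {e} e< nz {f} f< nr with status f<
    ... | inj₂ (eq , _) = eq
    ... | inj₁ (fz , _ , _ , _ , _ , z) = ⊥-elim (nz (trans (cong (st′ Act) (sym (same nr))) z))
      where
      meet : ∀ {v} → inc f v → Corner e v → f ≡ e
      meet i k = apart f< e< fz (proj₁ (was e< nz)) (corner (ends-corner f< fz i)) k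
      same : Near (siteOf e) f → f ≡ e
      same (inj₁ i)        = meet i (inj₁ refl)
      same (inj₂ (inj₁ i)) = meet i (inj₂ (inj₁ refl))
      same (inj₂ (inj₂ i)) = meet i (inj₂ (inj₂ refl))

    inv : Inv ρ st′ C′
    inv = record
      { sound = record
        { drawn = drawn-frame (eachE colourB) tt tt drawn
        ; sited = sited-frame (eachE colourB) tt sited
        ; col≗ = λ _ → refl
        ; C< = λ {f} f< → case status f< of λ { (inj₁ p) → proj₁ (proj₂ p) ; (inj₂ q) → subst (_< 9) (sym (proj₁ q)) (C< f<) }
        ; proper = proper′
        ; outside = λ {f} f< w → case status f< of λ { (inj₁ p) → proj₁ (proj₂ (proj₂ p)) ; (inj₂ q) → outside f< w ∘ trans (sym (proj₁ q)) }
        ; member = λ e< nz → member e< (proj₁ (was e< nz))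
        ; geometry = λ e< nz → geometry e< (proj₁ (was e< nz))
        ; waiting = λ {e} e< nz → Waiting-local (geometry e< (proj₁ (was e< nz))) (near e< nz) (waiting e< (proj₁ (was e< nz)))
        ; apart = λ e< f< p q → apart e< f< (proj₁ (was e< p)) (proj₁ (was f< q)) }
      ; stuck = λ {e} e< nz → λ { (c , c< , ¬x , ¬y) → proj₂ (was e< nz) (c , c<
          , ¬x ∘ transfer (geometry e< (proj₁ (was e< nz))) (λ f< i → sym (near e< nz f< (inj₁ i)))
          , ¬y ∘ transfer (geometry e< (proj₁ (was e< nz))) (λ f< i → sym (near e< nz f< (inj₂ (inj₁ i))))) }
      ; ranked = λ {e} e< nz → let (r , r≤ , rk) = ready e< (proj₁ (was e< nz)) (proj₂ (was e< nz)) in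
          r , r≤ , Rank-local (geometry e< (proj₁ (was e< nz))) (near e< nz) rk }

    -- An active edge is coloured or stays active, so colouring loses nothing; only the selection
    -- does.
    tally : solved C + active st ≤ solved C′ + active st′
    tally = ≤-trans
      (count-disjoint {solvedᵇ C} {posᵇ ∘ st Act} {live} m keeps rises distinct)
      (count-cover {live} {solvedᵇ C′} {posᵇ ∘ st′ Act} m (λ {e} _ → split e))
      where
      live : ℕ → Bool
      live e = if solvedᵇ C′ e then true else posᵇ (st′ Act e)
      left : ∀ {b c} → T b → T (if b then true else c)
      left {true} _ = tt
      right : ∀ {b c} → T c → T (if b then true else c)
      right {true} _ = tt
      right {false} t = t
      split : ∀ e → T (live e) → T (solvedᵇ C′ e) ⊎ T (posᵇ (st′ Act e))
      split e t with solvedᵇ C′ e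
      ... | true  = inj₁ tt
      ... | false = inj₂ t
      keeps : ∀ {e} → e < m → T (solvedᵇ C e) → T (live e)
      keeps {e} e< t with status e<
      ... | inj₁ p = left (solvedᵇ⁺ {C′} (proj₁ (solvedᵇ⁻ {C} t)) (proj₁ (proj₂ (proj₂ p))))
      ... | inj₂ q = left (solvedᵇ⁺ {C′} (proj₁ (solvedᵇ⁻ {C} t)) (proj₂ (solvedᵇ⁻ {C} t) ∘ trans (sym (proj₁ q))))
      rises : ∀ {e} → e < m → T (posᵇ (st Act e)) → T (live e)
      rises {e} e< t with status e<
      ... | inj₁ p = left (solvedᵇ⁺ {C′} (member e< (posᵇ⁻ t)) (proj₁ (proj₂ (proj₂ p))))
      ... | inj₂ q = right {solvedᵇ C′ e} (posᵇ⁺ (proj₂ (proj₂ q) (posᵇ⁻ t)))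
      distinct : ∀ {e} → e < m → T (solvedᵇ C e) → ¬ T (posᵇ (st Act e))
      distinct e< t u = proj₂ (solvedᵇ⁻ {C} t) (Waiting.open-e (waiting e< (posᵇ⁻ u)))

-- 81 pairs of colours compete in a stage, and a granted request locks 4 vertices.

abstract
  loss : ℕ
  loss = 81 * 4

  combine : ∀ {s s′ a w a′} → s ≤ s′ → a ≤ 81 * w → w ≤ 4 * a′ → s + a ≤ loss * (s′ + a′)
  combine {s} {s′} {a} {w} {a′} p q r = ≤-trans
    (+-mono-≤ (≤-trans p (m≤n*m s′ (81 * 4))) (≤-trans q (≤-trans (*-monoʳ-≤ 81 r) (≤-reflexive (sym (*-assoc 81 4 a′))))))
    (≤-reflexive (sym (*-distribˡ-+ (81 * 4) s′ a′)))

module Stage (N : Net) (inp : ℕ → ℕ) (μ : St) (inW : ℕ → Bool) where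
  open Net N
  open Invariants N inp μ inW public
  open Site

  tinted : (ℕ → ℕ) → ℕ → ℕ → ℕ → Bool
  tinted C c v e = if incᵇ e v then C e ≡ᵇ c else false

  tinted⁻ : ∀ {C c v e} → T (tinted C c v e) → inc e v × C e ≡ c
  tinted⁻ {C} {c} {v} {e} t with inc? e v
  ... | yes i = i , ≡ᵇ⇒≡ (C e) c t

  tinted⁺ : ∀ {C c v e} → inc e v → C e ≡ c → T (tinted C c v e)
  tinted⁺ {C} {c} {v} {e} i eq with inc? e v
  ... | yes _ = ≡⇒≡ᵇ (C e) c eq
  ... | no ¬i = ⊥-elim (¬i i)

  tinted≤1 : ∀ {C c} v → Proper C → c ≢ 0 → count (tinted C c v) m ≤ 1
  tinted≤1 {C} {c} v pr c≢0 = count-injection {tinted C c v} {λ _ → true} m 1 (λ _ → 0) (λ _ _ → s≤s z≤n , tt) same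
    where
    same : ∀ {e f} → e < m → f < m → T (tinted C c v e) → T (tinted C c v f) → 0 ≡ 0 → e ≡ f
    same {e} {f} e< f< t u _ with e ≟ f
    ... | yes eq = eq
    ... | no ne = ⊥-elim (c≢0 (trans (sym (proj₂ (tinted⁻ {C} {c} {v} {e} t)))
                    (pr e< f< ne (proj₁ (tinted⁻ {C} {c} {v} {e} t)) (proj₁ (tinted⁻ {C} {c} {v} {f} u))
                      (trans (proj₂ (tinted⁻ {C} {c} {v} {e} t)) (sym (proj₂ (tinted⁻ {C} {c} {v} {f} u)))))))

  tinted≡0 : ∀ {C c} v → ¬ Has C v c → count (tinted C c v) m ≤ 0
  tinted≡0 {C} {c} v nh = ≤-trans (sum≤ 0 m (λ {e} e< → ≤-reflexive (ind-false (λ t → nh (e , e< , tinted⁻ {C} {c} {v} {e} t))))) (≤-reflexive (*-zeroʳ m))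

  module _ {C pr : ℕ → ℕ} {a b : ℕ} (only : ∀ {e} → e < m → pr e ≢ 0 → C e ≡ a ⊎ C e ≡ b) where
    open Linking pr

    valency≤ : ∀ v → valency m v ≤ count (tinted C a v) m + count (tinted C b v) m
    valency≤ v = ≤-trans (sum-mono m (λ {e} e< → pointwise e<)) (≤-reflexive (sum-+ (ind ∘ tinted C a v) (ind ∘ tinted C b v) m))
      where
      pointwise : ∀ {e} → e < m → marked e v ≤ ind (tinted C a v e) + ind (tinted C b v e)
      pointwise {e} e< = branch-elim (_≤ ind (tinted C a v e) + ind (tinted C b v e)) (pr e) (λ nz → hit≤ (inc? e v) (only e< nz)) (λ _ → z≤n)
        where
        hit1 : hit e v ≤ 1
        hit1 with src e ≟ v
        ... | yes refl = ≤-reflexive (cong₂ _+_ (cong ind (≡ᵇ-refl (src e))) (cong ind (≢⇒≡ᵇ (loopless e< ∘ sym))))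
        ... | no ne = ≤-trans (≤-reflexive (cong (λ x → ind x + ind (tgt e ≡ᵇ v)) (≢⇒≡ᵇ ne))) (ind≤1 (tgt e ≡ᵇ v))
        hit≤ : Dec (inc e v) → C e ≡ a ⊎ C e ≡ b → hit e v ≤ ind (tinted C a v e) + ind (tinted C b v e)
        hit≤ (yes i) (inj₁ p) = ≤-trans hit1 (≤-trans (≤-reflexive (sym (ind-true (tinted⁺ {C} i p)))) (m≤m+n _ _))
        hit≤ (yes i) (inj₂ p) = ≤-trans hit1 (≤-trans (≤-reflexive (sym (ind-true (tinted⁺ {C} i p)))) (m≤n+m _ (ind (tinted C a v e))))
        hit≤ (no ¬i) _ = ≤-trans (≤-reflexive (cong₂ (λ x y → ind x + ind y) (≢⇒≡ᵇ (¬i ∘ inj₁)) (≢⇒≡ᵇ (¬i ∘ inj₂)))) z≤n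

  module OneStage {ρ : ℕ} {st : St} {C : ℕ → ℕ} (iv : Inv (suc ρ) st C) (0<n : 0 < n) where
    open Inv iv
    open Sound sound

    -- Prefixes of the stage, so that one frame condition compares an intermediate memory with `st`.
    p₁ p₂ p₄ p₅ p₆ p₇ p₈ p₉ p₁₀ p₁₁ p₁₂ : Phase
    p₁ = tabulate
    p₂ = p₁ ▷ eachE requestB
    p₄ = p₂ ▷ eachV resetB ▷ eachV untallyB
    p₅ = p₄ ▷ eachE tallyB
    p₆ = p₅ ▷ eachE markB
    p₇ = p₆ ▷ eachE linkB
    p₈ = p₇ ▷ eachE mateB
    p₉ = p₈ ▷ eachE selectB
    p₁₀ = p₉ ▷ eachE spreadB
    p₁₁ = p₁₀ ▷ eachE recolourB
    p₁₂ = p₁₁ ▷ tabulate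

    s₁ s₂ s₃ s₄ s₅ s₆ s₇ s₈ s₉ s₁₀ s₁₁ s₁₂ : St
    s₁ = run tabulate st
    s₂ = iter m requestB s₁
    s₃ = iter n resetB s₂
    s₄ = iter n untallyB s₃
    s₅ = iter m tallyB s₄
    s₆ = iter m markB s₅
    s₇ = iter m linkB s₆
    s₈ = iter m mateB s₇
    s₉ = iter m selectB s₈
    s₁₀ = iter m spreadB s₉
    s₁₁ = iter m recolourB s₁₀
    s₁₂ = run tabulate s₁₁

    table₁ : Table s₁ C
    table₁ = tabulate-spec drawn col≗ C<

    Active : ℕ → Set
    Active e = e < m × st Act e ≢ 0

    module At {e : ℕ} (ac : Active e) where
      geo : Geometry (siteOf e)
      geo = geometry (proj₁ ac) (proj₂ ac)
      wait : Waiting (siteOf e) C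
      wait = waiting (proj₁ ac) (proj₂ ac)
      stk : ¬ Free (siteOf e) C
      stk = stuck (proj₁ ac) (proj₂ ac)
      r : ℕ
      r = proj₁ (ranked (proj₁ ac) (proj₂ ac))
      r≤ : r ≤ suc ρ
      r≤ = proj₁ (proj₂ (ranked (proj₁ ac) (proj₂ ac)))
      rk : Rank (siteOf e) C r
      rk = proj₂ (proj₂ (ranked (proj₁ ac) (proj₂ ac)))
      partner : Partner rk (s₂ Want e)
      partner = request-spec (sited-frame tabulate tt sited) table₁ (λ f< → trans (run-frame p₁ tt) (col≗ f<)) C< (proj₁ ac) geo (Waiting.a<9 wait) rk
      open Stuck geo C< proper wait stk public using (Ends; partner-ends)
      ends : Ends (s₂ Want e)
      ends = partner-ends rk partner
      open Ends ends public
      valid : Valid (μ Miss e) (s₂ Want e)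
      valid = record { a<9 = Waiting.a<9 wait ; b<9 = b<9 ; a≢0 = a≢0 geo C< proper wait ; b≢0 = b≢0 ; a≢b = a≢b }

    miss₄ : ∀ j → s₄ Miss j ≡ μ Miss j
    miss₄ j = trans (run-frame p₄ tt) (miss≗ sited j)
    want₄ : ∀ j → s₄ Want j ≡ s₂ Want j
    want₄ j = run-frame (eachV resetB ▷ eachV untallyB) tt
    act₄ : ∀ j → s₄ Act j ≡ st Act j
    act₄ j = run-frame p₄ tt

    open Tally (s₄ Act) (s₄ Miss) (s₄ Want)

    A Bc : ℕ
    A = s₅ BestA 0
    Bc = s₅ BestB 0

    active₄ : ∀ {e} → e < m → s₄ Act e ≢ 0 → Active e
    active₄ e< nz = e< , nz ∘ trans (act₄ _)

    valid₄ : ∀ {e} → e < m → s₄ Act e ≢ 0 → Valid (s₄ Miss e) (s₄ Want e)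
    valid₄ {e} e< nz = subst₂ Valid (sym (miss₄ e)) (sym (want₄ e)) (At.valid (active₄ e< nz))

    tallied : Tallied m (s₅ Cnt) (s₅ Best 0) A Bc
    tallied = tally-spec {s₄} 0<n (untally-spec s₃ 0<n)
      (trans (run-frame (eachV untallyB) tt) (proj₁ best)) (trans (run-frame (eachV untallyB) tt) (proj₁ (proj₂ best)))
      (trans (run-frame (eachV untallyB) tt) (proj₂ (proj₂ best))) valid₄
      where
      best : s₃ Best 0 ≡ 0 × s₃ BestA 0 ≡ 1 × s₃ BestB 0 ≡ 2
      best = Reset.best (reset-spec s₂) 0<n

    chosen : Valid A Bc
    chosen = Tallied.valid tallied
    open Valid chosen renaming (a<9 to A<9; b<9 to B<9; a≢0 to A≢0; b≢0 to B≢0; a≢b to A≢B)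

    pr : ℕ → ℕ
    pr = s₆ Pair

    pair≡ : ∀ {j} → j < m → pr j ≡ branch (distance (C j) A) (branch (distance (C j) Bc) 0 1) 1
    pair≡ {j} j< = trans (mark-spec s₅ j<) (cong (λ c → branch (distance c A) (branch (distance c Bc) 0 1) 1) (trans (run-frame p₅ tt) (col≗ j<)))

    only : ∀ {e} → e < m → pr e ≢ 0 → C e ≡ A ⊎ C e ≡ Bc
    only e< nz = marked⁻ _ A Bc (nz ∘ trans (pair≡ e<))

    open Linking pr

    degree≤2 : ∀ v → valency m v ≤ 2
    degree≤2 v = ≤-trans (valency≤ {C} only v) (+-mono-≤ (tinted≤1 v proper A≢0) (tinted≤1 v proper B≢0))

    end-a : ∀ {v} → ¬ Has C v A → valency m v ≤ 1
    end-a {v} nh = ≤-trans (valency≤ {C} only v) (+-mono-≤ (tinted≡0 v nh) (tinted≤1 v proper B≢0))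

    end-b : ∀ {v} → ¬ Has C v Bc → valency m v ≤ 1
    end-b {v} nh = ≤-trans (valency≤ {C} only v) (+-mono-≤ (tinted≤1 v proper A≢0) (tinted≡0 v nh))

    -- Chains are formed on all numbers, whereas `Far` is only known to agree with `far` below n.
    -- The vertices beyond are isolated and thus fixed by `far`.
    lone : ∀ {v} → n ≤ v → valency m v ≡ 0
    lone {v} le = n≤0⇒n≡0 (≤-trans (valency≤ {C} only v) (+-mono-≤ (tinted≡0 v none) (tinted≡0 v none)))
      where
      none : ∀ {c} → ¬ Has C v c
      none (e , e< , inj₁ refl , _) = <⇒≱ (src< e<) le
      none (e , e< , inj₂ refl , _) = <⇒≱ (tgt< e<) le

    far-lone : ∀ {v} → n ≤ v → far m v ≡ v
    far-lone {v} le = Paths.iso (paths degree≤2 m ≤-refl v (≤-trans (≤-reflexive (lone le)) z≤n)) (lone le)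

    -- Beyond n the map `far` is the identity, but from `far m v` it leads back to v.
    far< : ∀ {v} → v < n → valency m v ≤ 1 → far m v < n
    far< {v} v< v1 with far m v <? n
    ... | yes lt = lt
    ... | no nlt = ⊥-elim (nlt (subst (_< n) (trans (sym (far-involutive degree≤2 v1)) (far-lone (≮⇒≥ nlt))) v<))

    F X M : ℕ → ℕ
    F = s₈ Far
    X = μ Vx
    M = s₈ Mate

    linked : Linked m s₇
    linked = link-spec (drawn-frame p₆ tt tt drawn) (λ _ → refl)
      (λ v< → trans (run-frame (eachV untallyB ▷ eachE tallyB ▷ eachE markB) tt) (Reset.far≗ (reset-spec s₂) v<))

    F≡ : ∀ {v} → v < n → F v ≡ far m v
    F≡ v< = trans (run-frame (eachE mateB) tt) (proj₁ linked v<)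

    End : ℕ → Set
    End v = v < n × valency m v ≤ 1

    F-end : ∀ {v} → End v → End (F v)
    F-end (v< , v1) = subst End (sym (F≡ v<)) (far< v< v1 , Chains.far-end m src tgt pr loopless degree≤2 v1)

    F-inv : ∀ {v} → End v → F (F v) ≡ v
    F-inv {v} en@(v< , v1) = trans (F≡ (proj₁ (F-end en))) (trans (cong (far m) (F≡ v<)) (far-involutive degree≤2 v1))

    want : ℕ → ℕ
    want e = ind (matches A Bc e)

    decode : ∀ {e} → want e ≢ 0 → s₄ Act e ≢ 0 × s₄ Miss e ≡ A × s₄ Want e ≡ Bc
    decode {e} nz with s₄ Act e | s₄ Miss e ≡ᵇ A in p | s₄ Want e ≡ᵇ Bc in q
    ... | zero  | _     | _     = ⊥-elim (nz refl)
    ... | suc _ | false | _     = ⊥-elim (nz refl)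
    ... | suc _ | true  | false = ⊥-elim (nz refl)
    ... | suc _ | true  | true  = (λ ()) , ≡ᵇ⇒≡ _ _ (subst T (sym p) tt) , ≡ᵇ⇒≡ _ _ (subst T (sym q) tt)

    encode-want : ∀ {e} → s₄ Act e ≢ 0 → s₄ Miss e ≡ A → s₄ Want e ≡ Bc → want e ≢ 0
    encode-want {e} nz p q z = 1+n≢0 (trans (sym (ind-true match)) z)
      where
      match : T (matches A Bc e)
      match = subst T (sym (trans (cong₂ (λ x y → if x then (if y then s₄ Want e ≡ᵇ Bc else false) else false) (yes-true (posᵇ⁺ nz)) (yes-true (≡⇒≡ᵇ _ _ p)))
                (yes-true (≡⇒≡ᵇ _ _ q)))) tt
        where
        yes-true : ∀ {b} → T b → b ≡ true
        yes-true {true} _ = refl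

    module Wanted {e : ℕ} (e< : e < m) (w : want e ≢ 0) where
      ac : Active e
      ac = active₄ e< (proj₁ (decode w))
      open At ac public
      a≡A : μ Miss e ≡ A
      a≡A = trans (sym (miss₄ e)) (proj₁ (proj₂ (decode w)))
      b≡B : s₂ Want e ≡ Bc
      b≡B = trans (sym (want₄ e)) (proj₂ (proj₂ (decode w)))
      x-end : End (X e)
      x-end = x< geo , end-a (Waiting.a-absent wait ∘ subst (Has C (X e)) (sym a≡A))
      y-end : End (μ Vy e)
      y-end = y< geo , end-b (y∌b ∘ subst (Has C (μ Vy e)) (sym b≡B))
      z-end : End (μ Vz e)
      z-end = z< geo , (case z∌ of λ { (inj₁ p) → end-a (p ∘ subst (Has C (μ Vz e)) (sym a≡A)) ; (inj₂ q) → end-b (q ∘ subst (Has C (μ Vz e)) (sym b≡B)) })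
      mate≡ : M e ≡ branch (distance (F (X e)) (μ Vy e)) (μ Vy e) (μ Vz e)
      mate≡ = trans (mate-spec s₇ e<) (trans (cong₂ (λ y z → branch (distance (s₇ Far (s₇ Vx e)) y) y z) (vy≗ si e) (vz≗ si e))
        (cong (λ f → branch (distance f (μ Vy e)) (μ Vy e) (μ Vz e)) (trans (cong (s₇ Far) (vx≗ si e)) (sym (run-frame (eachE mateB) tt)))))
        where
        si : Sited s₇
        si = sited-frame p₇ tt sited
      mate : (F (X e) ≡ μ Vy e × M e ≡ μ Vz e) ⊎ (F (X e) ≢ μ Vy e × M e ≡ μ Vy e)
      mate with F (X e) ≟ μ Vy e
      ... | yes p = inj₁ (p , trans mate≡ (branch-zero (zero-≠ₓ p)))
      ... | no np = inj₂ (np , trans mate≡ (branch-nonzero (np ∘ ≠ₓ-zero _ _)))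
      m-corner : M e ≡ μ Vy e ⊎ M e ≡ μ Vz e
      m-corner = case mate of λ { (inj₁ (_ , p)) → inj₂ p ; (inj₂ (_ , p)) → inj₁ p }

    open Selecting want End F X M F-inv F-end

    requesting : ∀ {e} → e < m → want e ≢ 0 → Requesting e
    requesting {e} e< w = record
      { x< = proj₁ x-end ; m< = proj₁ m-end ; fm< = proj₁ (F-end m-end) ; x-end = x-end ; m-end = m-end ; x≢m = x≢m ; x≢fm = x≢fm }
      where
      open Wanted e< w
      m-end : End (M e)
      m-end = case m-corner of λ { (inj₁ p) → subst End (sym p) y-end ; (inj₂ p) → subst End (sym p) z-end }
      x≢m : X e ≢ M e
      x≢m eq = case m-corner of λ { (inj₁ p) → x≢y geo (trans eq p) ; (inj₂ p) → x≢z geo (trans eq p) }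
      -- Partners on a chain are mutual. If y is the partner of x, the mate is z and differs from y;
      -- if not, the mate y cannot have x as its partner.
      x≢fm : X e ≢ F (M e)
      x≢fm eq with mate
      ... | inj₁ (p , q) = y≢z geo C< proper wait (trans (sym p) (trans (cong F eq) (trans (F-inv m-end) q)))
      ... | inj₂ (np , q) = np (trans (cong F eq) (trans (F-inv m-end) q))

    selected : Selected m want (s₈ Act) (s₉ Act) (s₉ Bit) (s₉ Lock)
    selected = select-spec {s₈} (λ j → trans (run-frame p₈ tt) (vx≗ sited j)) (λ _ → refl) (λ _ → refl)
      (λ v< → trans (run-frame r₃ tt) (Reset.lock (reset-spec s₂) v<))
      (λ v< → trans (run-frame r₃ tt) (Reset.bit (reset-spec s₂) v<))
      requesting
      (λ {e} w → proj₁ (decode w) ∘ trans (sym (run-frame r₄ tt)) , trans (run-frame r₄ tt) (trans (proj₁ (proj₂ (decode w))) (sym (run-frame r₅ tt)))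
        , trans (run-frame r₄ tt) (trans (proj₂ (proj₂ (decode w))) (sym (run-frame r₅ tt))))
      (λ {e} nz p q → encode-want (nz ∘ trans (run-frame r₄ tt)) (trans (sym (run-frame r₄ tt)) (trans p (run-frame r₅ tt))) (trans (sym (run-frame r₄ tt)) (trans q (run-frame r₅ tt))))
      where
      r₃ r₄ r₅ : Phase
      r₃ = eachV untallyB ▷ eachE tallyB ▷ eachE markB ▷ eachE linkB ▷ eachE mateB
      r₄ = eachE tallyB ▷ eachE markB ▷ eachE linkB ▷ eachE mateB
      r₅ = eachE markB ▷ eachE linkB ▷ eachE mateB

    wants-many : active st ≤ 81 * count (posᵇ ∘ want) m
    wants-many = ≤-trans (≤-reflexive (sum-cong m (λ {e} _ → cong (ind ∘ posᵇ) (sym (act₄ e))))) (≤-trans (popular valid₄ tallied)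
      (*-monoʳ-≤ 81 (count-mono m (λ {e} _ t → posᵇ⁺ (λ z → 1+n≢0 (trans (sym (ind-true t)) z))))))

    selects-many : count (posᵇ ∘ want) m ≤ 4 * active s₉
    selects-many = many requesting disjoint selected
      where
      corner : ∀ {e v} (e< : e < m) (w : want e ≢ 0) → v ≡ X e ⊎ v ≡ M e → Corner e v
      corner e< w (inj₁ p) = inj₁ p
      corner e< w (inj₂ p) = case Wanted.m-corner e< w of λ { (inj₁ q) → inj₂ (inj₁ (trans p q)) ; (inj₂ q) → inj₂ (inj₂ (trans p q)) }
      disjoint : ∀ {e f v} → e < m → f < m → want e ≢ 0 → want f ≢ 0 → v ≡ X e ⊎ v ≡ M e → v ≡ X f ⊎ v ≡ M f → e ≡ f
      disjoint e< f< w u p q = apart e< f< (proj₂ (Wanted.ac e< w)) (proj₂ (Wanted.ac f< u)) (corner e< w p) (corner f< u q)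

    agree : ∀ {v} → valency m v ≤ 1 → s₉ Bit (far m v) ≡ s₉ Bit v
    agree {v} v1 with v <? n
    ... | yes v< = trans (cong (s₉ Bit) (sym (F≡ v<))) (Selected.bit-far selected (v< , v1) v< (proj₁ (F-end (v< , v1))))
    ... | no v≮ = cong (s₉ Bit) (far-lone (≮⇒≥ v≮))

    B : ℕ → ℕ
    B = s₁₀ Bit

    B≡ : ∀ v → B v ≡ bits (s₉ Bit) m v
    B≡ = spread-spec {s₉} (drawn-frame p₉ tt tt drawn) (λ j → run-frame (eachE linkB ▷ eachE mateB ▷ eachE selectB) tt)
      (λ e< → trans (run-frame r tt) (proj₁ (proj₂ linked e<)) , trans (run-frame r tt) (proj₂ (proj₂ linked e<)))
      where
      r : Phase
      r = eachE mateB ▷ eachE selectB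

    B-end : ∀ {v} → End v → B v ≡ s₉ Bit v
    B-end (v< , v1) = trans (B≡ _) (bits-end degree≤2 (s₉ Bit) agree v1)

    even : ∀ {f} → f < m → C f ≡ A ⊎ C f ≡ Bc → B (src f) ≡ B (tgt f)
    even {f} f< c = trans (B≡ _) (trans (bits-joined degree≤2 (s₉ Bit) agree f< (marked⁺ _ A Bc c ∘ trans (sym (pair≡ f<)))) (sym (B≡ _)))

    C′ : ℕ → ℕ
    C′ = s₁₁ Col

    recoloured : ∀ {f} → f < m → C′ f ≡ branch (B (src f)) (swap A Bc (C f)) (C f)
    recoloured {f} f< = trans (recolour-spec s₁₀ f<) (trans (cong₂ (λ v c → branch (B v) (swap (s₁₀ BestA 0) (s₁₀ BestB 0) c) c)
        (Drawn.src≗ (drawn-frame p₁₀ tt tt drawn) f) (trans (run-frame p₁₀ tt) (col≗ f<)))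
      (cong₂ (λ a b → branch (B (src f)) (swap a b (C f)) (C f)) (run-frame r tt) (run-frame r tt)))
      where
      r : Phase
      r = eachE markB ▷ eachE linkB ▷ eachE mateB ▷ eachE selectB ▷ eachE spreadB

    module Sw = Swapping C< proper A<9 B<9 A≢0 B≢0 B even {C′} recoloured

    act₁₂ : ∀ j → s₁₂ Act j ≡ s₉ Act j
    act₁₂ j = run-frame (eachE spreadB ▷ eachE recolourB ▷ tabulate) tt

    module Granted {e : ℕ} (e< : e < m) (nz : s₁₂ Act e ≢ 0) where
      grants : want e ≢ 0 × s₉ Bit (X e) ≡ 0 × s₉ Bit (M e) ≢ 0 × s₉ Lock (X e) ≢ 0
      grants = Selected.granted selected e< (nz ∘ trans (act₁₂ e))
      open Wanted e< (proj₁ grants) public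
      Bx : B (X e) ≡ 0
      Bx = trans (B-end x-end) (proj₁ (proj₂ grants))
      even′ : ∀ {f} → f < m → C f ≡ μ Miss e ⊎ C f ≡ s₂ Want e → B (src f) ≡ B (tgt f)
      even′ f< (inj₁ p) = even f< (inj₁ (trans p a≡A))
      even′ f< (inj₂ p) = even f< (inj₂ (trans p b≡B))
      def : ∀ {f} → f < m → C′ f ≡ branch (B (src f)) (swap (μ Miss e) (s₂ Want e) (C f)) (C f)
      def {f} f< = trans (recoloured f<) (cong₂ (λ a b → branch (B (src f)) (swap a b (C f)) (C f)) (sym a≡A) (sym b≡B))
      open Progress geo C< proper wait stk rk partner B even′ {C′} def Bx public using (waiting′; free-y; lower)
      progress : ¬ Free (siteOf e) C′ → ∃[ r ] (r ≤ ρ × Rank (siteOf e) C′ r)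
      progress stk′ with mate
      -- The mate is y, so the exchange has made a free for the edge.
      ... | inj₂ (_ , q) = ⊥-elim (stk′ (free-y (λ z → proj₁ (proj₂ (proj₂ grants)) (trans (cong (s₉ Bit) q) (trans (sym (B-end y-end)) z)))))
      ... | inj₁ (p , q) = let (r′ , eq , rk′) = lower By Bz in r′ , ≤-pred (≤-trans (≤-reflexive (sym eq)) r≤) , rk′
        where
        -- Here y is the other end of the chain of x and shares its bit.
        By : B (μ Vy e) ≡ 0
        By = trans (B-end y-end) (trans (cong (s₉ Bit) (sym p)) (trans (Selected.bit-far selected x-end (proj₁ x-end) (proj₁ (F-end x-end))) (proj₁ (proj₂ grants))))
        Bz : B (μ Vz e) ≢ 0
        Bz z = proj₁ (proj₂ (proj₂ grants)) (trans (cong (s₉ Bit) q) (trans (sym (B-end z-end)) z))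

    sound′ : Sound s₁₂ C′
    sound′ = record
      { drawn = drawn-frame p₁₂ tt tt drawn
      ; sited = sited-frame p₁₂ tt sited
      ; col≗ = λ _ → run-frame tabulate tt
      ; C< = Sw.C′<
      ; proper = Sw.proper′
      ; outside = λ f< w → outside f< w ∘ Sw.zero⁻ f<
      ; member = λ e< nz → member e< (was e< nz)
      ; geometry = λ e< nz → geometry e< (was e< nz)
      ; waiting = λ e< nz → Granted.waiting′ e< nz
      ; apart = λ e< f< p q → apart e< f< (was e< p) (was f< q) }
      where
      was : ∀ {e} → e < m → s₁₂ Act e ≢ 0 → st Act e ≢ 0
      was e< nz = proj₂ (Granted.ac e< nz)

    module Final = Colouring {ρ} {s₁₂} {C′} sound′ (tabulate-spec (drawn-frame p₁₁ tt tt drawn) (λ _ → refl) Sw.C′<)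
                             (λ e< nz → Granted.progress e< nz)

    solved-same : solved C ≤ solved C′
    solved-same = count-mono m λ {e} e< t → solvedᵇ⁺ {C′} (proj₁ (solvedᵇ⁻ {C} t)) (proj₂ (solvedᵇ⁻ {C} t) ∘ Sw.zero⁻ e<)

    progress : solved C + active st ≤ loss * (solved Final.C′ + active Final.st′)
    progress = ≤-trans (combine solved-same wants-many (≤-trans selects-many (*-monoʳ-≤ 4 kept-active))) (*-monoʳ-≤ loss Final.tally)
      where
      kept-active : active s₉ ≤ active s₁₂
      kept-active = ≤-reflexive (sum-cong m (λ {e} _ → cong (ind ∘ posᵇ) (sym (act₁₂ e))))

  stage-spec : ∀ {ρ st C} → 0 < n → Inv (suc ρ) st C →
               Σ[ C′ ∈ (ℕ → ℕ) ] (Inv ρ (run stage st) C′ × solved C + active st ≤ loss * (solved C′ + active (run stage st)))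
  stage-spec 0<n iv = Final.C′ , Final.inv , progress
    where
    open OneStage iv 0<n

-- The search for butterflies

module Prelude (N : Net) (inp : ℕ → ℕ) where
  open Net N
  open Tables N inp public
  open Site

  degrees-spec : ∀ {st} → Drawn st → (∀ v → st Deg v ≡ 0) → ∀ v → iter m degreesB st Deg v ≡ deg v
  degrees-spec {st} d zeroed = iter-ind (λ i s → ∀ v → s Deg v ≡ sum (λ e → ind (src e ≡ᵇ v) + ind (tgt e ≡ᵇ v)) i) degreesB m zeroed
    λ {i} {s} i< fr old v → trans (two (s Deg) (s Src i) (s Tgt i) v) (cong₂ _+_
      (cong₂ (λ a b → ind (a ≡ᵇ v) + ind (b ≡ᵇ v)) (trans (fr Src tt i) (Drawn.src≗ d i)) (trans (fr Tgt tt i) (Drawn.tgt≗ d i))) (old v))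
    where
    one : ∀ f j v → upd f j (suc (f j)) v ≡ ind (j ≡ᵇ v) + f v
    one f j v with j ≟ v
    ... | yes refl rewrite ≡ᵇ-refl j = refl
    ... | no ne rewrite ≢⇒≡ᵇ ne = refl
    two : ∀ f j k v → upd (upd f j (suc (f j))) k (suc (upd f j (suc (f j)) k)) v ≡ ind (j ≡ᵇ v) + ind (k ≡ᵇ v) + f v
    two f j k v = trans (one (upd f j (suc (f j))) k v) (trans (cong (ind (k ≡ᵇ v) +_) (one f j v))
      (trans (sym (+-assoc (ind (k ≡ᵇ v)) _ _)) (cong (_+ f v) (+-comm (ind (k ≡ᵇ v)) _))))

  search-cong : ∀ {i s s′ test out} qs → (∀ q → ev i s′ (test q) ≡ ev i s (test q)) → (∀ q → evT i s′ (out q) ≡ evT i s (out q)) →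
                evT i s′ (search qs test out) ≡ evT i s (search qs test out)
  search-cong [] p r = refl
  search-cong {i} {s} {s′} {test} {out} (q ∷ qs) p r = go (p q) (r q) (search-cong qs p r)
    where
    go : ∀ {c c′ t t′ u u′} → c′ ≡ c → t′ ≡ t → u′ ≡ u → branch c′ u′ t′ ≡ branch c u t
    go refl refl refl = refl

  joins-other : ∀ {e u v w} → e < m → Joins e u v → Joins e u w → v ≡ w
  joins-other e< (inj₁ (p , q)) (inj₁ (r , t)) = trans (sym q) t
  joins-other e< (inj₁ (p , q)) (inj₂ (r , t)) = ⊥-elim (loopless e< (trans p (sym t)))
  joins-other e< (inj₂ (p , q)) (inj₁ (r , t)) = ⊥-elim (loopless e< (trans r (sym q)))
  joins-other e< (inj₂ (p , q)) (inj₂ (r , t)) = trans (sym p) r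

  record Suits (s : St) (x y c₁ c₂ c₃ : ℕ) : Set where
    zc : ℕ
    zc = s Nbr (9 * x + c₁)
    field
      dy    : s Deg y ∸ 3 ≡ 0
      dz    : s Deg zc ∸ 3 ≡ 0
      e₁    : 1 ∸ s Edg (9 * x + c₁) ≡ 0
      e₂    : 1 ∸ s Edg (9 * zc + c₂) ≡ 0
      e₃    : 1 ∸ s Edg (9 * x + c₃) ≡ 0
      meet  : distance (s Nbr (9 * zc + c₂)) (s Nbr (9 * x + c₃)) ≡ 0
      n₁    : 1 ∸ c₁ ≡ 0
      n₂    : 1 ∸ c₂ ≡ 0
      n₃    : 1 ∸ c₃ ≡ 0
      u₁    : c₁ ∸ 8 ≡ 0
      u₂    : c₂ ∸ 8 ≡ 0
      u₃    : c₃ ∸ 8 ≡ 0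

  penalty : St → ℕ → ℕ → ℕ → ℕ → ℕ → ℕ
  penalty s x y c₁ c₂ c₃ = let z = s Nbr (9 * x + c₁) in
    (s Deg y ∸ 3) + (s Deg z ∸ 3) + (1 ∸ s Edg (9 * x + c₁)) + (1 ∸ s Edg (9 * z + c₂)) + (1 ∸ s Edg (9 * x + c₃)) +
    distance (s Nbr (9 * z + c₂)) (s Nbr (9 * x + c₃)) + (1 ∸ c₁) + (1 ∸ c₂) + (1 ∸ c₃) + (c₁ ∸ 8) + (c₂ ∸ 8) + (c₃ ∸ 8)

  suits⁺ : ∀ {s x y c₁ c₂ c₃} → Suits s x y c₁ c₂ c₃ → penalty s x y c₁ c₂ c₃ ≡ 0
  suits⁺ p = dy ∙ dz ∙ e₁ ∙ e₂ ∙ e₃ ∙ meet ∙ n₁ ∙ n₂ ∙ n₃ ∙ u₁ ∙ u₂ ∙ u₃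
    where
    open Suits p
    infixl 5 _∙_
    _∙_ : ∀ {a b} → a ≡ 0 → b ≡ 0 → a + b ≡ 0
    refl ∙ refl = refl

  suits⁻ : ∀ {s x y c₁ c₂ c₃} → penalty s x y c₁ c₂ c₃ ≡ 0 → Suits s x y c₁ c₂ c₃
  suits⁻ {s} {x} {y} {c₁} {c₂} {c₃} = vanish (s Deg y ∸ 3) (s Deg z′ ∸ 3) (1 ∸ s Edg (9 * x + c₁)) (1 ∸ s Edg (9 * z′ + c₂))
    (1 ∸ s Edg (9 * x + c₃)) (distance (s Nbr (9 * z′ + c₂)) (s Nbr (9 * x + c₃))) (1 ∸ c₁) (1 ∸ c₂) (1 ∸ c₃) (c₁ ∸ 8) (c₂ ∸ 8) (c₃ ∸ 8)
    λ p₁ p₂ p₃ p₄ p₅ p₆ p₇ p₈ p₉ p₁₀ p₁₁ p₁₂ → record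
      { dy = p₁ ; dz = p₂ ; e₁ = p₃ ; e₂ = p₄ ; e₃ = p₅ ; meet = p₆ ; n₁ = p₇ ; n₂ = p₈ ; n₃ = p₉ ; u₁ = p₁₀ ; u₂ = p₁₁ ; u₃ = p₁₂ }
    where
    z′ : ℕ
    z′ = s Nbr (9 * x + c₁)
    -- For variables in place of the actual terms, matching on `zero` refutes all other cases by
    -- computation.
    vanish : ∀ {P : Set} a b c d e f g h i j k l →
             (a ≡ 0 → b ≡ 0 → c ≡ 0 → d ≡ 0 → e ≡ 0 → f ≡ 0 → g ≡ 0 → h ≡ 0 → i ≡ 0 → j ≡ 0 → k ≡ 0 → l ≡ 0 → P) →
             a + b + c + d + e + f + g + h + i + j + k + l ≡ 0 → P
    vanish zero zero zero zero zero zero zero zero zero zero zero zero cont _ =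
      cont refl refl refl refl refl refl refl refl refl refl refl refl

  module Siting {st : St} {C : ℕ → ℕ} (dr : Drawn st) (tb₀ : Table st C) (degs : ∀ v → st Deg v ≡ deg v)
                (C< : ∀ {f} → f < m → C f < 9) (pr : Proper C) (deg≤8 : ∀ {v} → v < n → deg v ≤ 8) where

    st′ : St
    st′ = iter m siteB st

    open Rounds N inp st′ using (siteOf; x<; z<; zero-entry)

    module _ {j : ℕ} (j< : j < m) where
      s : St
      s = iter j siteB st

      tb : Table s C
      tb = table-cong {st} {s} (λ _ → iter-frame j siteB tt) (λ _ → iter-frame j siteB tt) tb₀

      degs′ : ∀ v → s Deg v ≡ deg v
      degs′ v = trans (iter-frame j siteB tt) (degs v)

      srcs : s Src j ≡ src j
      srcs = trans (iter-frame j siteB tt) (Drawn.src≗ dr j)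

      tgts : s Tgt j ≡ tgt j
      tgts = trans (iter-frame j siteB tt) (Drawn.tgt≗ dr j)

      xOf yOf : Bool → ℕ
      xOf o = if o then s Src j else s Tgt j
      yOf o = if o then s Tgt j else s Src j

      je : ∀ o → Joins j (xOf o) (yOf o)
      je true  = inj₁ (sym srcs , sym tgts)
      je false = inj₂ (sym srcs , sym tgts)

      fits≡ : ∀ o c₁ c₂ c₃ → ev j s (fits (o , c₁ , c₂ , c₃)) ≡ penalty s (xOf o) (yOf o) c₁ c₂ c₃
      fits≡ true  c₁ c₂ c₃ = refl
      fits≡ false c₁ c₂ c₃ = refl

      -- Prefixes of `siteB`; the states below are the memories in which its later trees are
      -- evaluated.
      b₁ b₂ b₃ b₄ b₅ b₆ b₇ : Body
      b₁ = (Act [ ix ]≔ Act ⟨ ix ⟩ ⟪ search candidates fits (λ _ → num 1) ∣ num 0 ⟫) ∷ []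
      b₂ = b₁ ++ (Vx [ ix ]≔ search candidates fits (λ q → (if proj₁ q then Src else Tgt) ⟨ ix ⟩+ 0)) ∷ []
      b₃ = b₂ ++ (Vy [ ix ]≔ search candidates fits (λ q → (if proj₁ q then Tgt else Src) ⟨ ix ⟩+ 0)) ∷ []
      b₄ = b₃ ++ (Vz [ ix ]≔ search candidates fits (λ q → Nbr ⟨ entry (xₓ q) (con (proj₁ (proj₂ q))) ⟩+ 0)) ∷ []
      b₅ = b₄ ++ (Exz [ ix ]≔ search candidates fits (λ q → Edg ⟨ entry (xₓ q) (con (proj₁ (proj₂ q))) ⟩-1)) ∷ []
      b₆ = b₅ ++ (Ezs [ ix ]≔ search candidates fits (λ q → Edg ⟨ entry (zₓ q) (con (proj₁ (proj₂ (proj₂ q)))) ⟩-1)) ∷ []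
      b₇ = b₆ ++ (Exs [ ix ]≔ search candidates fits (λ q → Edg ⟨ entry (xₓ q) (con (proj₂ (proj₂ (proj₂ q)))) ⟩-1)) ∷ []

      s₁ s₂ s₃ s₄ s₅ s₆ s₇ : St
      s₁ = exec j b₁ s
      s₂ = exec j b₂ s
      s₃ = exec j b₃ s
      s₄ = exec j b₄ s
      s₅ = exec j b₅ s
      s₆ = exec j b₆ s
      s₇ = exec j b₇ s

      at : ∀ {k v} → exec j siteB s k j ≡ v → st′ k j ≡ v
      at eq = trans (iter-at m siteB tt j<) eq

      module Hit (o : Bool) (c₁ c₂ c₃ : ℕ) (su : Suits s (xOf o) (yOf o) c₁ c₂ c₃)
                 (value : ∀ out → evT j s (search candidates fits out) ≡ evT j s (out (o , c₁ , c₂ , c₃))) where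
        open Suits su using (zc)

        found : ∀ {s′ out v} → (∀ q → ev j s′ (fits q) ≡ ev j s (fits q)) → (∀ q → evT j s′ (out q) ≡ evT j s (out q)) →
                evT j s (out (o , c₁ , c₂ , c₃)) ≡ v → evT j s′ (search candidates fits out) ≡ v
        found {out = out} p r eq = trans (search-cong candidates p r) (trans (value out) eq)

        vx : st′ Vx j ≡ xOf o
        vx = at (trans (upd-same (s Vx) {j} refl) (found {s₁} (λ { (true , _) → refl ; (false , _) → refl })
          (λ { (true , _) → refl ; (false , _) → refl }) (pick o)))
          where
          pick : ∀ o → evT j s ((if o then Src else Tgt) ⟨ ix ⟩+ 0) ≡ xOf o
          pick true  = refl
          pick false = refl
        vy : st′ Vy j ≡ yOf o
        vy = at (trans (upd-same (s Vy) {j} refl) (found {s₂} (λ { (true , _) → refl ; (false , _) → refl })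
          (λ { (true , _) → refl ; (false , _) → refl }) (pick o)))
          where
          pick : ∀ o → evT j s ((if o then Tgt else Src) ⟨ ix ⟩+ 0) ≡ yOf o
          pick true  = refl
          pick false = refl
        vz : st′ Vz j ≡ zc
        vz = at (trans (upd-same (s Vz) {j} refl) (found {s₃} (λ { (true , _) → refl ; (false , _) → refl })
          (λ { (true , _) → refl ; (false , _) → refl }) (pick o)))
          where
          pick : ∀ o → evT j s (Nbr ⟨ entry (xₓ (o , c₁ , c₂ , c₃)) (con c₁) ⟩+ 0) ≡ s Nbr (9 * xOf o + c₁)
          pick true  = refl
          pick false = refl
        vxz : st′ Exz j ≡ s Edg (9 * xOf o + c₁) ∸ 1
        vxz = at (trans (upd-same (s Exz) {j} refl) (found {s₄} (λ { (true , _) → refl ; (false , _) → refl })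
          (λ { (true , _) → refl ; (false , _) → refl }) (pick o)))
          where
          pick : ∀ o → evT j s (Edg ⟨ entry (xₓ (o , c₁ , c₂ , c₃)) (con c₁) ⟩-1) ≡ s Edg (9 * xOf o + c₁) ∸ 1
          pick true  = refl
          pick false = refl
        vzs : st′ Ezs j ≡ s Edg (9 * zc + c₂) ∸ 1
        vzs = at (trans (upd-same (s Ezs) {j} refl) (found {s₅} (λ { (true , _) → refl ; (false , _) → refl })
          (λ { (true , _) → refl ; (false , _) → refl }) (pick o)))
          where
          pick : ∀ o → evT j s (Edg ⟨ entry (zₓ (o , c₁ , c₂ , c₃)) (con c₂) ⟩-1) ≡ s Edg (9 * s Nbr (9 * xOf o + c₁) + c₂) ∸ 1
          pick true  = refl
          pick false = refl
        vxs : st′ Exs j ≡ s Edg (9 * xOf o + c₃) ∸ 1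
        vxs = at (trans (upd-same (s Exs) {j} refl) (found {s₆} (λ { (true , _) → refl ; (false , _) → refl })
          (λ { (true , _) → refl ; (false , _) → refl }) (pick o)))
          where
          pick : ∀ o → evT j s (Edg ⟨ entry (xₓ (o , c₁ , c₂ , c₃)) (con c₃) ⟩-1) ≡ s Edg (9 * xOf o + c₃) ∸ 1
          pick true  = refl
          pick false = refl

        nz : ∀ {k} → 1 ∸ k ≡ 0 → k ≢ 0
        nz p refl = 1+n≢0 p

        small : ∀ {c} → c ∸ 8 ≡ 0 → c < 9
        small p = s≤s (m∸n≡0⇒m≤n p)

        inc<n : ∀ {e v} → e < m → inc e v → v < n
        inc<n e< (inj₁ refl) = src< e<
        inc<n e< (inj₂ refl) = tgt< e<

        xv : xOf o < n
        xv = inc<n j< (joins-left (je o))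

        en₁ : Entry s C (xOf o) c₁
        en₁ = Table.some tb xv (small (Suits.u₁ su)) (nz (Suits.e₁ su))
        zv : zc < n
        zv = inc<n (Entry.e< en₁) (joins-right (Entry.joins en₁))
        en₂ : Entry s C zc c₂
        en₂ = Table.some tb zv (small (Suits.u₂ su)) (nz (Suits.e₂ su))
        en₃ : Entry s C (xOf o) c₃
        en₃ = Table.some tb xv (small (Suits.u₃ su)) (nz (Suits.e₃ su))

        exz : st′ Exz j ≡ Entry.e en₁
        exz = trans vxz (cong (_∸ 1) (Entry.holds en₁))
        ezs : st′ Ezs j ≡ Entry.e en₂
        ezs = trans vzs (cong (_∸ 1) (Entry.holds en₂))
        exs : st′ Exs j ≡ Entry.e en₃
        exs = trans vxs (cong (_∸ 1) (Entry.holds en₃))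

        geo : Geometry (siteOf j)
        geo = record
          { e< = j< ; xz< = subst (_< m) (sym exz) (Entry.e< en₁) ; xs< = subst (_< m) (sym exs) (Entry.e< en₃) ; zs< = subst (_< m) (sym ezs) (Entry.e< en₂)
          ; s = s Nbr (9 * xOf o + c₃)
          ; je = subst₂ (Joins j) (sym vx) (sym vy) (je o)
          ; jxz = subst (λ e → Joins e (st′ Vx j) (st′ Vz j)) (sym exz) (subst₂ (Joins (Entry.e en₁)) (sym vx) (sym vz) (Entry.joins en₁))
          ; jxs = subst (λ e → Joins e (st′ Vx j) (s Nbr (9 * xOf o + c₃))) (sym exs) (subst (λ v → Joins (Entry.e en₃) v (s Nbr (9 * xOf o + c₃))) (sym vx) (Entry.joins en₃))
          ; jzs = subst (λ e → Joins e (st′ Vz j) (s Nbr (9 * xOf o + c₃))) (sym ezs) (subst₂ (Joins (Entry.e en₂)) (sym vz) (≠ₓ-zero (s Nbr (9 * zc + c₂)) (s Nbr (9 * xOf o + c₃)) (Suits.meet su)) (Entry.joins en₂))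
          ; dy = subst (_≤ 3) (trans (degs′ _) (cong deg (sym vy))) (m∸n≡0⇒m≤n (Suits.dy su))
          ; dz = subst (_≤ 3) (trans (degs′ _) (cong deg (sym vz))) (m∸n≡0⇒m≤n (Suits.dz su)) }

        missing : st′ Miss j < 9 × ¬ Has C (st′ Vx j) (st′ Miss j)
        missing = subst (λ a → a < 9 × ¬ Has C (st′ Vx j) a) (sym (at (upd-same (s Miss) {j} refl))) (proj₁ hit
          , Table.none tb (x< geo) (proj₁ hit) (trans (cong (λ v → s Edg (9 * v + chosen)) (sym xx)) (proj₂ hit)))
          where
          test : ℕ → Ex
          test c = Edg ⟨ entry (Vx ⟨ ix ⟩) (con c) ⟩
          chosen : ℕ
          chosen = evT j s₇ (firstOf colours test)
          xx : s₇ Vx j ≡ st′ Vx j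
          xx = sym (at refl)
          lacking : ∃[ c ] (c < 9 × ¬ Has C (st′ Vx j) c)
          lacking = fresh C (st′ Vx j) (deg≤8 (x< geo))
          hit : chosen < 9 × ev j s₇ (test chosen) ≡ 0
          hit = colour-found {j} {s₇} test (proj₁ lacking , proj₁ (proj₂ lacking)
            , trans (cong (λ v → s Edg (9 * v + proj₁ lacking)) xx) (zero-entry tb (x< geo) (proj₁ (proj₂ lacking)) (proj₂ (proj₂ lacking))))

        wait : C j ≡ 0 → Waiting (siteOf j) C
        wait open-e = record
          { open-e = open-e
          ; xz≢0 = nz (Suits.n₁ su) ∘ trans (sym (trans (cong C exz) (Entry.tint en₁)))
          ; xs≢0 = nz (Suits.n₃ su) ∘ trans (sym (trans (cong C exs) (Entry.tint en₃)))
          ; zs≢0 = nz (Suits.n₂ su) ∘ trans (sym (trans (cong C ezs) (Entry.tint en₂)))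
          ; a-absent = proj₂ missing
          ; a<9 = proj₁ missing }

      act≡ : st′ Act j ≡ branch (st Act j) (evT j s (search candidates fits (λ _ → num 1))) 0
      act≡ = at (trans (upd-same (s Act) {j} refl) (cong (λ c → branch c (evT j s (search candidates fits (λ _ → num 1))) 0) (iter-before j siteB tt ≤-refl)))

      Outcome : Set
      Outcome = (∃[ q ] (q ∈ₗ candidates × ev j s (fits q) ≡ 0 × ∀ out → evT j s (search candidates fits out) ≡ evT j s (out q)))
                ⊎ ((∀ {q} → q ∈ₗ candidates → ev j s (fits q) ≢ 0) × ∀ out → evT j s (search candidates fits out) ≡ 0)

      outcome : Outcome
      outcome = search-spec {j} {s} candidates fits

      sound : st′ Act j ≢ 0 → st Act j ≢ 0 × Geometry (siteOf j) × (C j ≡ 0 → Waiting (siteOf j) C)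
      sound nz = go outcome
        where
        go : Outcome → st Act j ≢ 0 × Geometry (siteOf j) × (C j ≡ 0 → Waiting (siteOf j) C)
        go (inj₁ ((o , c₁ , c₂ , c₃) , _ , z , value)) = (λ a0 → nz (trans act≡ (branch-zero a0))) , Hit.geo o c₁ c₂ c₃ su value , Hit.wait o c₁ c₂ c₃ su value
          where
          su : Suits s (xOf o) (yOf o) c₁ c₂ c₃
          su = suits⁻ (trans (sym (fits≡ o c₁ c₂ c₃)) z)
        go (inj₂ (_ , value)) = ⊥-elim (nz (trans act≡ (branch-elim (_≡ 0) (st Act j) (λ _ → value _) (λ _ → refl))))

      complete : ∀ {x₀ y₀ z₀ xz₀ xs₀ zs₀ a₀} → st Act j ≢ 0 → Geometry (site j x₀ y₀ z₀ xz₀ xs₀ zs₀ a₀) → C xz₀ ≢ 0 → C xs₀ ≢ 0 → C zs₀ ≢ 0 →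
                 st′ Act j ≢ 0
      complete {x₀} {y₀} {z₀} {xz₀} {xs₀} {zs₀} nz g r≢0 k≢0 d≢0 = go outcome
        where
        module G = Geometry g
        way : Σ[ o ∈ Bool ] (xOf o ≡ x₀ × yOf o ≡ y₀)
        way = case G.je of λ { (inj₁ (p , q)) → true , trans srcs p , trans tgts q ; (inj₂ (p , q)) → false , trans tgts q , trans srcs p }
        xo : xOf (proj₁ way) ≡ x₀
        xo = proj₁ (proj₂ way)
        inc<n : ∀ {e v} → e < m → inc e v → v < n
        inc<n e< (inj₁ refl) = src< e<
        inc<n e< (inj₂ refl) = tgt< e<
        -- Properness leaves only f as an edge at v with this nonzero colour, so the table must
        -- return f and its other end.
        look : ∀ {f v w} → f < m → Joins f v w → C f ≢ 0 → s Edg (9 * v + C f) ≢ 0 × s Nbr (9 * v + C f) ≡ w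
        look {f} {v} {w} f< jf c≢0 = here-edge , joins-other f< (subst (λ e → Joins e v _) same (Entry.joins en)) jf
          where
          here-edge : s Edg (9 * v + C f) ≢ 0
          here-edge = Table.filled tb (inc<n f< (joins-left jf)) (C< f<) (f , f< , joins-left jf , refl)
          en : Entry s C v (C f)
          en = Table.some tb (inc<n f< (joins-left jf)) (C< f<) here-edge
          same : Entry.e en ≡ f
          same with Entry.e en ≟ f
          ... | yes eq = eq
          ... | no ne = ⊥-elim (c≢0 (trans (sym (Entry.tint en)) (pr (Entry.e< en) f< ne (joins-left (Entry.joins en)) (joins-left jf) (Entry.tint en))))
        gone : ∀ {k} → k ≢ 0 → 1 ∸ k ≡ 0
        gone h = m≤n⇒m∸n≡0 (n≢0⇒n>0 h)
        zo : s Nbr (9 * xOf (proj₁ way) + C xz₀) ≡ z₀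
        zo = trans (cong (λ v → s Nbr (9 * v + C xz₀)) xo) (proj₂ (look G.xz< G.jxz r≢0))
        su : Suits s (xOf (proj₁ way)) (yOf (proj₁ way)) (C xz₀) (C zs₀) (C xs₀)
        su = record
          { dy = m≤n⇒m∸n≡0 (subst (_≤ 3) (sym (trans (degs′ _) (cong deg (proj₂ (proj₂ way))))) G.dy)
          ; dz = m≤n⇒m∸n≡0 (subst (_≤ 3) (sym (trans (degs′ _) (cong deg zo))) G.dz)
          ; e₁ = gone (subst (λ v → s Edg (9 * v + C xz₀) ≢ 0) (sym xo) (proj₁ (look G.xz< G.jxz r≢0)))
          ; e₂ = gone (subst (λ v → s Edg (9 * v + C zs₀) ≢ 0) (sym zo) (proj₁ (look G.zs< G.jzs d≢0)))
          ; e₃ = gone (subst (λ v → s Edg (9 * v + C xs₀) ≢ 0) (sym xo) (proj₁ (look G.xs< G.jxs k≢0)))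
          ; meet = zero-≠ₓ (trans (trans (cong (λ v → s Nbr (9 * v + C zs₀)) zo) (proj₂ (look G.zs< G.jzs d≢0)))
                             (sym (trans (cong (λ v → s Nbr (9 * v + C xs₀)) xo) (proj₂ (look G.xs< G.jxs k≢0)))))
          ; n₁ = gone r≢0 ; n₂ = gone d≢0 ; n₃ = gone k≢0
          ; u₁ = m≤n⇒m∸n≡0 (≤-pred (C< G.xz<)) ; u₂ = m≤n⇒m∸n≡0 (≤-pred (C< G.zs<)) ; u₃ = m≤n⇒m∸n≡0 (≤-pred (C< G.xs<)) }
        go : Outcome → st′ Act j ≢ 0
        go (inj₁ (_ , _ , _ , value)) z = 1+n≢0 (trans (sym (trans act≡ (trans (branch-nonzero nz) (value (λ _ → num 1))))) z)
        go (inj₂ (none , _)) _ = none (candidate∈ (proj₁ way) (C< G.xz<) (C< G.zs<) (C< G.xs<))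
          (trans (fits≡ (proj₁ way) (C xz₀) (C zs₀) (C xs₀)) (suits⁺ {s} {xOf (proj₁ way)} {yOf (proj₁ way)} {C xz₀} {C zs₀} {C xs₀} su))

-- The network of a graph and the layout of the input

ext : ∀ {k} {A : Set} → A → (Fin k → A) → ℕ → A
ext {zero}  d p j       = d
ext {suc k} d p zero    = p Fin.zero
ext {suc k} d p (suc j) = ext d (p ∘ Fin.suc) j

ext-toℕ : ∀ {k} {A : Set} (d : A) (p : Fin k → A) i → ext d p (toℕ i) ≡ p i
ext-toℕ d p Fin.zero    = refl
ext-toℕ d p (Fin.suc i) = ext-toℕ d (p ∘ Fin.suc) i

ext-beyond : ∀ {k} {A : Set} (d : A) (p : Fin k → A) {j} → k ≤ j → ext d p j ≡ d
ext-beyond {zero}  d p le = refl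
ext-beyond {suc k} d p (s≤s le) = ext-beyond d (p ∘ Fin.suc) le

sum-bottom : ∀ f k → sum f (suc k) ≡ f 0 + sum (f ∘ suc) k
sum-bottom f zero    = refl
sum-bottom f (suc k) = trans (cong (f (suc k) +_) (sum-bottom f k)) (trans (sym (+-assoc (f (suc k)) (f 0) _))
  (trans (cong (_+ sum (f ∘ suc) k) (+-comm (f (suc k)) (f 0))) (+-assoc (f 0) (f (suc k)) _)))

card : ∀ {k} (S : Subset k) → ∣ S ∣ ≡ count (ext false (Vec.lookup S)) k
card Vec.[] = refl
card {suc k} (b Vec.∷ S) = trans (top b) (trans (cong (ind b +_) (card S)) (sym (sum-bottom (ind ∘ ext false (Vec.lookup (b Vec.∷ S))) k)))
  where
  top : ∀ b → ∣ b Vec.∷ S ∣ ≡ ind b + ∣ S ∣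
  top true  = refl
  top false = refl

index : ∀ {k e} → e < k → Σ[ i ∈ Fin k ] toℕ i ≡ e
index e< = fromℕ< e< , Fin.toℕ-fromℕ< e<

blocks : ∀ {k} {A : Set} → (A → Fin 4 → ℕ) → (Fin k → A) → List ℕ
blocks f g = List.concatMap (λ a → f a 0F ∷ f a 1F ∷ f a 2F ∷ f a 3F ∷ []) (List.tabulate g)

cells-block : ∀ {k} {A : Set} (f : A → Fin 4 → ℕ) (g : Fin k → A) (i : Fin k) (j : Fin 4) →
              cells (blocks f g) (4 * toℕ i + toℕ j) ≡ f (g i) j
cells-block f g Fin.zero 0F = refl
cells-block f g Fin.zero 1F = refl
cells-block f g Fin.zero 2F = refl
cells-block f g Fin.zero 3F = refl
cells-block {suc k} {A} f g (Fin.suc i) j = trans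
  (cong (cells (blocks f g)) (cong (_+ toℕ j) (*-suc 4 (toℕ i))))
  (cells-block f (g ∘ Fin.suc) i j)

cells-bounded : ∀ {k M} {A : Set} (f : A → Fin 4 → ℕ) (g : Fin k → A) → (∀ a j → f a j ≤ M) → ∀ a →
                cells (blocks f g) a ≤ M
cells-bounded {zero}  f g b a = z≤n
cells-bounded {suc k} f g b 0 = b _ 0F
cells-bounded {suc k} f g b 1 = b _ 1F
cells-bounded {suc k} f g b 2 = b _ 2F
cells-bounded {suc k} f g b 3 = b _ 3F
cells-bounded {suc k} f g b (suc (suc (suc (suc a)))) = cells-bounded f (g ∘ Fin.suc) b a

cells-beyond : ∀ {k} {A : Set} (f : A → Fin 4 → ℕ) (g : Fin k → A) a → 4 * k ≤ a →
               cells (blocks f g) a ≡ 0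
cells-beyond {zero}  f g a le = refl
cells-beyond {suc k} f g a le with ≤-trans (≤-reflexive (sym (*-suc 4 k))) le
... | s≤s (s≤s (s≤s (s≤s le′))) = cells-beyond f (g ∘ Fin.suc) _ le′

maximum-index : ∀ {k} {A : Set} (f : A → ℕ) (g : Fin k → A) i → f (g i) ≤ List.foldr _⊔_ 0 (List.map f (List.tabulate g))
maximum-index f g Fin.zero    = m≤m⊔n _ _
maximum-index f g (Fin.suc i) = ≤-trans (maximum-index f (g ∘ Fin.suc) i) (m≤n⊔m _ _)

module OfGraph (G : Graph) where
  module G = Graph G

  source target : ℕ → ℕ
  source = ext 0 (toℕ ∘ G.src)
  target = ext 0 (toℕ ∘ G.tgt)

  module _ (i : G.E) where
    source≡ : source (toℕ i) ≡ toℕ (G.src i)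
    source≡ = ext-toℕ 0 (toℕ ∘ G.src) i
    target≡ : target (toℕ i) ≡ toℕ (G.tgt i)
    target≡ = ext-toℕ 0 (toℕ ∘ G.tgt) i

  lower-joins : ∀ {i u v} → (source (toℕ i) ≡ u × target (toℕ i) ≡ v) ⊎ (source (toℕ i) ≡ v × target (toℕ i) ≡ u) →
                Σ[ u′ ∈ G.V ] Σ[ v′ ∈ G.V ] (G.Joins i u′ v′ × toℕ u′ ≡ u × toℕ v′ ≡ v)
  lower-joins {i} (inj₁ (p , q)) = G.src i , G.tgt i , inj₁ (refl , refl) , trans (sym (source≡ i)) p , trans (sym (target≡ i)) q
  lower-joins {i} (inj₂ (p , q)) = G.tgt i , G.src i , inj₂ (refl , refl) , trans (sym (target≡ i)) q , trans (sym (source≡ i)) p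

  net : Net
  net = record
    { n = G.∣V∣ ; m = G.∣E∣ ; src = source ; tgt = target
    ; src< = λ e< → bound e< source≡
    ; tgt< = λ e< → bound e< target≡
    ; loopless = λ e< eq → no-loop e< eq
    ; simple = λ e< f< p q → one e< f< p q }
    where
    bound : ∀ {e} {f : ℕ → ℕ} {g : G.E → G.V} → e < G.∣E∣ → (∀ i → f (toℕ i) ≡ toℕ (g i)) → f e < G.∣V∣
    bound {g = g} e< eq with index e<
    ... | i , refl = subst (_< G.∣V∣) (sym (eq i)) (Fin.toℕ<n (g i))
    no-loop : ∀ {e} → e < G.∣E∣ → source e ≢ target e
    no-loop e< eq with index e<
    ... | i , refl = G.loopless i (Fin.toℕ-injective (trans (sym (source≡ i)) (trans eq (target≡ i))))
    one : ∀ {e f u v} → e < G.∣E∣ → f < G.∣E∣ → (source e ≡ u × target e ≡ v) ⊎ (source e ≡ v × target e ≡ u) →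
          (source f ≡ u × target f ≡ v) ⊎ (source f ≡ v × target f ≡ u) → e ≡ f
    one e< f< p q with index e< | index f<
    ... | i , refl | j , refl with lower-joins {i} p | lower-joins {j} q
    ...   | u , v , ju , refl , refl | u′ , v′ , jv , p′ , q′ with Fin.toℕ-injective p′ | Fin.toℕ-injective q′
    ...     | refl | refl = cong toℕ (G.noMultiEdges ju jv)

  open Net net using (n; m; deg; Joins; inc) public

  raise-joins : ∀ {i u v} → G.Joins i u v → Joins (toℕ i) (toℕ u) (toℕ v)
  raise-joins {i} (inj₁ (p , q)) = inj₁ (trans (source≡ i) (cong toℕ p) , trans (target≡ i) (cong toℕ q))
  raise-joins {i} (inj₂ (p , q)) = inj₂ (trans (source≡ i) (cong toℕ p) , trans (target≡ i) (cong toℕ q))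

  lower-inc : ∀ {i v} → inc (toℕ i) v → Σ[ v′ ∈ G.V ] (G.Incident i v′ × toℕ v′ ≡ v)
  lower-inc {i} (inj₁ p) = G.src i , inj₁ refl , trans (sym (source≡ i)) p
  lower-inc {i} (inj₂ p) = G.tgt i , inj₂ refl , trans (sym (target≡ i)) p

  raise-inc : ∀ {i v} → G.Incident i v → inc (toℕ i) (toℕ v)
  raise-inc {i} (inj₁ p) = inj₁ (trans (source≡ i) (cong toℕ p))
  raise-inc {i} (inj₂ p) = inj₂ (trans (target≡ i) (cong toℕ p))

  incident? : ∀ v i → Dec (G.Incident i v)
  incident? v i = (G.src i Fin.≟ v) ⊎-dec (G.tgt i Fin.≟ v)

  deg≤degree : ∀ v → deg (toℕ v) ≤ G.degree v
  deg≤degree v = ≤-trans (sum-mono m pointwise) (≤-reflexive (sym (card star)))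
    where
    star : Subset G.∣E∣
    star = Vec.tabulate (λ i → does (incident? v i))
    member : ∀ i → ind (source (toℕ i) ≡ᵇ toℕ v) + ind (target (toℕ i) ≡ᵇ toℕ v) ≤ ind (does (incident? v i))
    member i with source (toℕ i) ≟ toℕ v | target (toℕ i) ≟ toℕ v
    ... | yes p | yes q = ⊥-elim (G.loopless i (Fin.toℕ-injective (trans (sym (source≡ i)) (trans p (trans (sym q) (target≡ i))))))
    ... | no p | no q = ≤-trans (≤-reflexive (cong₂ (λ a b → ind a + ind b) (≢⇒≡ᵇ p) (≢⇒≡ᵇ q))) z≤n
    ... | yes p | no q = ≤-trans (+-mono-≤ (ind≤1 (source (toℕ i) ≡ᵇ toℕ v)) (≤-reflexive (cong ind (≢⇒≡ᵇ q)))) (one (inj₁ (Fin.toℕ-injective (trans (sym (source≡ i)) p))))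
      where
      one : G.Incident i v → 1 ≤ ind (does (incident? v i))
      one h = ≤-reflexive (sym (cong ind (dec-true (incident? v i) h)))
    ... | no p | yes q = ≤-trans (+-mono-≤ (≤-reflexive (cong ind (≢⇒≡ᵇ p))) (ind≤1 (target (toℕ i) ≡ᵇ toℕ v))) (one (inj₂ (Fin.toℕ-injective (trans (sym (target≡ i)) q))))
      where
      one : G.Incident i v → 1 ≤ ind (does (incident? v i))
      one h = ≤-reflexive (sym (cong ind (dec-true (incident? v i) h)))
    pointwise : ∀ {e} → e < m → ind (source e ≡ᵇ toℕ v) + ind (target e ≡ᵇ toℕ v) ≤ ind (ext false (Vec.lookup star) e)
    pointwise e< with index e<
    ... | i , refl = ≤-trans (member i) (≤-reflexive (cong ind (sym (trans (ext-toℕ false (Vec.lookup star) i) (Vec.lookup∘tabulate (λ i → does (incident? v i)) i)))))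

  module _ (Δ≤8 : G.Δ ≤ 8) where
    deg≤8 : ∀ {v} → v < n → deg v ≤ 8
    deg≤8 v< with index v<
    ... | v′ , refl = ≤-trans (deg≤degree v′) (≤-trans (maximum-index G.degree id v′) Δ≤8)

    -- Each edge adds at least 1 to a degree sum of at most 8 * n. This makes loops over E linear in
    -- the number of vertices.
    edges≤ : m ≤ 8 * n
    edges≤ = ≤-trans (handshake m ≤-refl) (≤-trans (sum≤ 8 n deg≤8) (≤-reflexive (*-comm n 8)))
      where
      hit : ℕ → ℕ → ℕ
      hit e v = ind (source e ≡ᵇ v) + ind (target e ≡ᵇ v)
      handshake : ∀ i → i ≤ m → i ≤ sum (λ v → sum (λ e → hit e v) i) n
      handshake zero    le = z≤n
      handshake (suc i) le = ≤-trans (+-mono-≤ end (handshake i (<⇒≤ le))) (≤-reflexive (sym (sum-+ (hit i) (λ v → sum (λ e → hit e v) i) n)))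
        where
        end : 1 ≤ sum (hit i) n
        end = ≤-trans (≤-trans (≤-reflexive (sym (cong ind (≡ᵇ-refl (source i))))) (m≤m+n _ _)) (sum-index (hit i) {n} {source i} (Net.src< net le))

  module Apart (W : Subset G.∣E∣) (indep : PairwiseIndependent G 4 W) where

    -- Independence speaks of minimal walks. Strong induction on the length makes a shortest walk
    -- available, which then is a distance of at most 4.
    no-walk : ∀ {i j} → i ∈ W → j ∈ W → i ≢ j → ∀ d → d ≤ 4 → ∀ {u v} → G.Incident i u → G.Incident j v → ¬ Walk G u v d
    no-walk {i} {j} i∈ j∈ ne = <-rec (λ d → d ≤ 4 → ∀ {u v} → G.Incident i u → G.Incident j v → ¬ Walk G u v d) shortest
      where
      shortest : ∀ d → (∀ {d′} → d′ < d → d′ ≤ 4 → ∀ {u v} → G.Incident i u → G.Incident j v → ¬ Walk G u v d′) →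
                 d ≤ 4 → ∀ {u v} → G.Incident i u → G.Incident j v → ¬ Walk G u v d
      shortest d ih d≤ {u} {v} iu jv w = <⇒≱ (indep i∈ j∈ ne ((u , v , iu , jv , w , least iu jv) , λ { (u′ , v′ , iu′ , jv′ , w′ , _) → least iu′ jv′ w′ })) d≤
        where
        least : ∀ {u v} → G.Incident i u → G.Incident j v → ∀ {d′} → Walk G u v d′ → d ≤ d′
        least iu jv {d′} w′ with d ≤? d′
        ... | yes le = le
        ... | no gt = ⊥-elim (ih (≰⇒> gt) (≤-trans (<⇒≤ (≰⇒> gt)) d≤) iu jv w′)

    adj-sym : ∀ {u v} → G.Adj u v → G.Adj v u
    adj-sym (e , inj₁ p) = e , inj₂ p
    adj-sym (e , inj₂ p) = e , inj₁ p

    Reaches₁ : G.E → ℕ → Set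
    Reaches₁ i v = Σ[ u ∈ G.V ] Σ[ w ∈ G.V ] (G.Incident i u × toℕ w ≡ v × (u ≡ w ⊎ G.Adj u w))

    -- A corner is at distance at most 1 from its edge, so a common corner gives a walk of length at
    -- most 2.
    meet : ∀ {i j v} → i ∈ W → j ∈ W → Reaches₁ i v → Reaches₁ j v → i ≡ j
    meet {i} {j} i∈ j∈ (u , w , iu , p , r) (u′ , w′ , ju , q , r′) with i Fin.≟ j
    ... | yes eq = eq
    ... | no ne with Fin.toℕ-injective (trans p (sym q))
    ...   | refl = ⊥-elim (close r r′)
      where
      close : u ≡ w ⊎ G.Adj u w → u′ ≡ w ⊎ G.Adj u′ w → ⊥
      close (inj₁ refl) (inj₁ refl) = no-walk i∈ j∈ ne 0 z≤n iu ju stop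
      close (inj₁ refl) (inj₂ a)    = no-walk i∈ j∈ ne 1 (s≤s z≤n) iu ju (step (adj-sym a) stop)
      close (inj₂ a)    (inj₁ refl) = no-walk i∈ j∈ ne 1 (s≤s z≤n) iu ju (step a stop)
      close (inj₂ a)    (inj₂ b)    = no-walk i∈ j∈ ne 2 (s≤s (s≤s z≤n)) iu ju (step a (step (adj-sym b) stop))

  -- Both forms of butterfly contain one: a triangle x z s on the edge xz, with s = v₁ in B1 and s =
  -- v₂ in B2.
  record Wedge (x y : G.V) : Set where
    field
      z s   : G.V
      zx-distinct   : x ≢ z
      zy-distinct   : y ≢ z
      sy-distinct   : y ≢ s
      xz    : G.Adj x z
      xs    : G.Adj x s
      zs    : G.Adj z s
      deg-y : G.degree y ≡ 3
      deg-z : G.degree z ≡ 3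

  wedge : ∀ {x y} → ButterflyB1 G x y ⊎ ButterflyB2 G x y → Wedge x y
  wedge (inj₁ b) with ButterflyB1.distinct b
  ... | (_ ∷ zx-distinct ∷ _) ∷ (zy-distinct ∷ sy-distinct ∷ _) ∷ _ = record
    { z = z ; s = v₁ ; zx-distinct = zx-distinct ; zy-distinct = zy-distinct ; sy-distinct = sy-distinct ; xz = xz ; xs = xv₁ ; zs = zv₁ ; deg-y = deg-y ; deg-z = deg-z }
    where open ButterflyB1 b
  wedge (inj₂ b) with ButterflyB2.distinct b
  ... | (_ ∷ zx-distinct ∷ _) ∷ (zy-distinct ∷ _ ∷ sy-distinct ∷ _) ∷ _ = record
    { z = z ; s = v₂ ; zx-distinct = zx-distinct ; zy-distinct = zy-distinct ; sy-distinct = sy-distinct ; xz = xz ; xs = xv₂ ; zs = zv₂ ; deg-y = deg-y ; deg-z = deg-z }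
    where open ButterflyB2 b

-- The initial memory, the first invariant and the count over all stages

decode : ℕ → Maybe (Fin 8)
decode zero = nothing
decode (suc c) with c <? 8
... | yes c< = just (fromℕ< c<)
... | no _   = nothing

code-decode : ∀ {c} → c < 9 → code (decode c) ≡ c
code-decode {zero} _ = refl
code-decode {suc c} (s≤s c<) with c <? 8
... | yes p = cong suc (Fin.toℕ-fromℕ< p)
... | no np = ⊥-elim (np c<)

code<9 : ∀ (c : Maybe (Fin 8)) → code c < 9
code<9 nothing  = s≤s z≤n
code<9 (just a) = s≤s (Fin.toℕ<n a)

is-just-posᵇ : ∀ (c : Maybe (Fin 8)) → is-just c ≡ posᵇ (code c)
is-just-posᵇ nothing  = refl
is-just-posᵇ (just _) = refl

lookup-extensional : ∀ {k} {S S′ : Subset k} → (∀ i → Vec.lookup S i ≡ Vec.lookup S′ i) → S ≡ S′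
lookup-extensional {S = S} {S′} eq = trans (sym (Vec.tabulate∘lookup S)) (trans (Vec.tabulate-cong eq) (Vec.tabulate∘lookup S′))

module Instance (G : Graph) (Δ≤8 : Graph.Δ G ≤ 8) (W : Subset (Graph.∣E∣ G)) (butterflies : ∀ {e} → e ∈ W → ButterflyLike G e)
                (indep : PairwiseIndependent G 4 W) (π : PartialColoring G 8) (π-colored : PartialColoring.colored π ≡ ∁ W) where
  open OfGraph G
  open Apart W indep
  module π = PartialColoring π

  val : G.E → Fin 4 → ℕ
  val i 0F = toℕ (G.src i)
  val i 1F = toℕ (G.tgt i)
  val i 2F = if Vec.lookup W i then 1 else 0
  val i 3F = code (π.color i)

  inp : ℕ → ℕ
  inp = cells (encode G W π)

  input≡ : ∀ i j → inp (2 + 4 * toℕ i + toℕ j) ≡ val i j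
  input≡ i j = cells-block val id i j

  -- 9 covers the codes of colours and 8 * n the number of edges.
  widest : ℕ
  widest = 9 + 8 * n

  n≤widest : n ≤ widest
  n≤widest = ≤-trans (m≤n*m n 8) (m≤n+m _ 9)

  m≤widest : m ≤ widest
  m≤widest = ≤-trans (edges≤ Δ≤8) (m≤n+m _ 9)

  inp≤ : ∀ a → inp a ≤ widest
  inp≤ 0 = n≤widest
  inp≤ 1 = m≤widest
  inp≤ (suc (suc a)) = cells-bounded val id bound a
    where
    bit≤ : ∀ b → (if b then 1 else 0) ≤ widest
    bit≤ true  = s≤s z≤n
    bit≤ false = z≤n
    bound : ∀ i j → val i j ≤ widest
    bound i 0F = ≤-trans (<⇒≤ (Fin.toℕ<n (G.src i))) n≤widest
    bound i 1F = ≤-trans (<⇒≤ (Fin.toℕ<n (G.tgt i))) n≤widest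
    bound i 2F = bit≤ (Vec.lookup W i)
    bound i 3F = ≤-trans (<⇒≤ (code<9 (π.color i))) (m≤m+n 9 _)

  inp-beyond : ∀ {a} → 6 + 4 * (n + m) ≤ a → inp a ≡ 0
  inp-beyond {suc (suc a)} (s≤s (s≤s le)) = cells-beyond val id a (≤-trans (≤-trans (*-monoʳ-≤ 4 (m≤n+m m n)) (m≤n+m _ 4)) le)

  inW : ℕ → Bool
  inW = ext false (Vec.lookup W)

  C₀ : ℕ → ℕ
  C₀ = ext 0 (code ∘ π.color)

  inW⁻ : ∀ {i} → T (inW (toℕ i)) → i ∈ W
  inW⁻ {i} t = Vec.lookup⇒[]= i W (true-of (subst T (ext-toℕ false (Vec.lookup W) i) t))
    where
    true-of : ∀ {b} → T b → b ≡ true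
    true-of {true} _ = refl

  C₀≡ : ∀ i → C₀ (toℕ i) ≡ code (π.color i)
  C₀≡ = ext-toℕ 0 (code ∘ π.color)

  complementary : ∀ i → posᵇ (C₀ (toℕ i)) ≡ not (inW (toℕ i))
  complementary i = trans (cong posᵇ (C₀≡ i)) (trans (sym (is-just-posᵇ (π.color i)))
    (trans (sym (Vec.lookup∘tabulate (λ i → is-just (π.color i)) i)) (trans (cong (λ S → Vec.lookup S i) π-colored)
      (trans (Vec.lookup-map i not W) (cong not (sym (ext-toℕ false (Vec.lookup W) i)))))))

  uncoloured : ∀ {e} → e < m → T (inW e) → C₀ e ≡ 0
  uncoloured e< t with index e<
  ... | i , refl = go (C₀ (toℕ i)) (inW (toℕ i)) (complementary i) t
    where
    go : ∀ c b → posᵇ c ≡ not b → T b → c ≡ 0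
    go zero    true eq _ = refl
    go (suc c) true ()  _

  coloured : ∀ {e} → e < m → ¬ T (inW e) → C₀ e ≢ 0
  coloured e< nt with index e<
  ... | i , refl = go (C₀ (toℕ i)) (inW (toℕ i)) (complementary i) nt
    where
    go : ∀ c b → posᵇ c ≡ not b → ¬ T b → c ≢ 0
    go zero    false () _ _
    go zero    true  eq nt _ = nt tt
    go (suc c) b     eq nt ()

  in-W : ∀ {i} → C₀ (toℕ i) ≡ 0 → i ∈ W
  in-W {i} z with T? (inW (toℕ i))
  ... | yes t = inW⁻ t
  ... | no nt = ⊥-elim (coloured (Fin.toℕ<n i) nt z)

  C₀< : ∀ {f} → f < m → C₀ f < 9
  C₀< f< with index f<
  ... | i , refl = subst (_< 9) (sym (C₀≡ i)) (code<9 (π.color i))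

  open Prelude net inp using (joins-left; joins-right; Proper; Geometry; Drawn; Table; tabulate-spec; degrees-spec; Has)
  open Execution n m inp using (iter; run; exec; iter-at; iter-before; run-frame)

  proper₀ : Proper C₀
  proper₀ {v = v} e< f< ne p q eq with index e< | index f<
  ... | i , refl | j , refl with lower-inc {i} p | lower-inc {j} q
  ...   | v₁ , iv , refl | v₂ , jv , same with Fin.toℕ-injective same
  ...     | refl with π.color i in ci | π.color j in cj
  ...       | nothing | _ = trans (C₀≡ i) (cong code ci)
  ...       | just a | nothing = trans eq (trans (C₀≡ j) (cong code cj))
  ...       | just a | just b = ⊥-elim (π.proper (ne ∘ cong toℕ) iv jv ci cj
                (Fin.toℕ-injective (suc-injective (trans (cong code (sym ci)) (trans (sym (C₀≡ i)) (trans eq (trans (C₀≡ j) (cong code cj))))))))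

  blank s₁ s₂ s₃ μ : St
  blank _ _ = 0
  s₁ = iter m loadB blank
  s₂ = iter m degreesB s₁
  s₃ = run tabulate s₂
  μ  = iter m siteB s₃

  -- Cells beyond the last edge keep their initial 0, which `f d ≡ 0` matches; so the equations hold
  -- for every index.
  loaded : ∀ k (v : ℕ → ℕ) → (∀ j s → exec j loadB s k j ≡ v j) → ∀ {A : Set} (d : A) (f : A → ℕ) (p : G.E → A) → f d ≡ 0 →
           (∀ i → v (toℕ i) ≡ f (p i)) → ∀ j → s₁ k j ≡ f (ext d p j)
  loaded k v value d f p fd eq j with j <? m
  ... | no j≮ = trans (iter-before m loadB tt (≮⇒≥ j≮)) (sym (trans (cong f (ext-beyond d p (≮⇒≥ j≮))) fd))
  ... | yes j< with index j<
  ...   | i , refl = trans (iter-at m loadB tt j<) (trans (value (toℕ i) (iter (toℕ i) loadB blank)) (trans (eq i) (cong f (sym (ext-toℕ d p i)))))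

  drawn₁ : Drawn s₁
  drawn₁ = record
    { src≗ = loaded Src (λ j → inp (2 + 4 * j + 0)) (λ j s → upd-same (s Src) {j} refl) 0 id (toℕ ∘ G.src) refl (λ i → input≡ i 0F)
    ; tgt≗ = loaded Tgt (λ j → inp (2 + 4 * j + 1)) (λ j s → upd-same (s Tgt) {j} refl) 0 id (toℕ ∘ G.tgt) refl (λ i → input≡ i 1F) }

  act₁ : ∀ j → s₁ Act j ≡ ind (inW j)
  act₁ = loaded Act (λ j → inp (2 + 4 * j + 2)) (λ j s → upd-same (s Act) {j} refl) false ind (Vec.lookup W) refl (λ i → input≡ i 2F)

  col₁ : ∀ j → s₁ Col j ≡ C₀ j
  col₁ = loaded Col (λ j → inp (2 + 4 * j + 3)) (λ j s → upd-same (s Col) {j} refl) 0 id (code ∘ π.color) refl (λ i → input≡ i 3F)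

  drawn₂ : Drawn s₂
  drawn₂ = record { src≗ = λ j → trans (run-frame (eachE degreesB) tt) (Drawn.src≗ drawn₁ j) ; tgt≗ = λ j → trans (run-frame (eachE degreesB) tt) (Drawn.tgt≗ drawn₁ j) }

  drawn₃ : Drawn s₃
  drawn₃ = record { src≗ = λ j → trans (run-frame tabulate tt) (Drawn.src≗ drawn₂ j) ; tgt≗ = λ j → trans (run-frame tabulate tt) (Drawn.tgt≗ drawn₂ j) }

  table₃ : Table s₃ C₀
  table₃ = tabulate-spec drawn₂ (λ {j} _ → trans (run-frame (eachE degreesB) tt) (col₁ j)) C₀<

  act₃ : ∀ j → s₃ Act j ≡ ind (inW j)
  act₃ j = trans (run-frame (eachE degreesB ▷ tabulate) tt) (act₁ j)

  degs₃ : ∀ v → s₃ Deg v ≡ deg v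
  degs₃ v = trans (run-frame tabulate tt) (degrees-spec drawn₁ (λ v → run-frame (eachE loadB) tt) v)

  module Sit = Prelude.Siting net inp {s₃} {C₀} drawn₃ table₃ degs₃ C₀< proper₀ (deg≤8 Δ≤8)

-- One factor `loss` for each of the five stages.
rate : ℕ
rate = loss * (loss * (loss * (loss * loss)))

module Solve (G : Graph) (Δ≤8 : Graph.Δ G ≤ 8) (W : Subset (Graph.∣E∣ G)) (butterflies : ∀ {e} → e ∈ W → ButterflyLike G e)
             (indep : PairwiseIndependent G 4 W) (π : PartialColoring G 8) (π-colored : PartialColoring.colored π ≡ ∁ W) where
  open Instance G Δ≤8 W butterflies indep π π-colored
  open OfGraph G
  open Apart W indep
  open Stage net inp μ inW public

  was-active : ∀ {e} → e < m → μ Act e ≢ 0 → T (inW e) × Geometry (siteOf e) × (C₀ e ≡ 0 → Waiting (siteOf e) C₀)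
  was-active {e} e< nz = go (Sit.sound e< nz)
    where
    go : s₃ Act e ≢ 0 × Geometry (siteOf e) × (C₀ e ≡ 0 → Waiting (siteOf e) C₀) → T (inW e) × Geometry (siteOf e) × (C₀ e ≡ 0 → Waiting (siteOf e) C₀)
    go (a , g , w) = true-of (inW e) (a ∘ trans (act₃ e)) , g , w
      where
      true-of : ∀ b → ind b ≢ 0 → T b
      true-of true  _ = tt
      true-of false h = h refl

  left : ∀ {i u v} → G.Joins i u v → G.Incident i u
  left (inj₁ (p , q)) = inj₁ p
  left (inj₂ (p , q)) = inj₂ q

  right : ∀ {i u v} → G.Joins i u v → G.Incident i v
  right (inj₁ (p , q)) = inj₂ q
  right (inj₂ (p , q)) = inj₁ p

  reaches : ∀ {i v} → Geometry (siteOf (toℕ i)) → Corner (toℕ i) v → Reaches₁ i v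
  reaches {i} {v} g c = go (lower-joins {i} (Geometry.je g)) c
    where
    go : Σ[ x′ ∈ G.V ] Σ[ y′ ∈ G.V ] (G.Joins i x′ y′ × toℕ x′ ≡ μ Vx (toℕ i) × toℕ y′ ≡ μ Vy (toℕ i)) → Corner (toℕ i) v → Reaches₁ i v
    go (x′ , y′ , j , p , q) (inj₁ eq)        = x′ , x′ , left j , trans p (sym eq) , inj₁ refl
    go (x′ , y′ , j , p , q) (inj₂ (inj₁ eq)) = y′ , y′ , right j , trans q (sym eq) , inj₁ refl
    go (x′ , y′ , j , p , q) (inj₂ (inj₂ eq)) = spoke (index (Geometry.xz< g))
      where
      spoke : Σ[ k ∈ G.E ] toℕ k ≡ μ Exz (toℕ i) → Reaches₁ i v
      spoke (k , e≡) = end (lower-joins {k} (subst (λ e → Joins e (μ Vx (toℕ i)) (μ Vz (toℕ i))) (sym e≡) (Geometry.jxz g)))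
        where
        end : Σ[ x″ ∈ G.V ] Σ[ z″ ∈ G.V ] (G.Joins k x″ z″ × toℕ x″ ≡ μ Vx (toℕ i) × toℕ z″ ≡ μ Vz (toℕ i)) → Reaches₁ i v
        end (x″ , z″ , jz , p′ , q′) = x′ , z″ , left j , trans q′ (sym eq)
          , inj₂ (k , subst (λ u → G.Joins k u z″) (Fin.toℕ-injective (trans p′ (sym p))) jz)

  sound₀ : Sound μ C₀
  sound₀ = record
    { drawn = drawn-frame (eachE siteB) tt tt drawn₃
    ; sited = λ _ _ → refl
    ; col≗ = λ {f} _ → trans (run-frame (eachE degreesB ▷ tabulate ▷ eachE siteB) tt) (col₁ f)
    ; C< = C₀<
    ; proper = proper₀
    ; outside = coloured
    ; member = λ e< nz → proj₁ (was-active e< nz)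
    ; geometry = λ e< nz → proj₁ (proj₂ (was-active e< nz))
    ; waiting = λ e< nz → proj₂ (proj₂ (was-active e< nz)) (uncoloured e< (proj₁ (was-active e< nz)))
    ; apart = separate }
    where
    separate : ∀ {e f v} → e < m → f < m → μ Act e ≢ 0 → μ Act f ≢ 0 → Corner e v → Corner f v → e ≡ f
    separate {e} {f} {v} e< f< p q c c′ = go (index e<) (index f<)
      where
      go : Σ[ i ∈ G.E ] toℕ i ≡ e → Σ[ j ∈ G.E ] toℕ j ≡ f → e ≡ f
      go (i , refl) (j , refl) = cong toℕ (meet (inW⁻ (proj₁ (was-active e< p))) (inW⁻ (proj₁ (was-active f< q)))
        (reaches (proj₁ (proj₂ (was-active e< p))) c) (reaches (proj₁ (proj₂ (was-active f< q))) c′))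

  -- The edges xz, xs and zs differ from xy and are coloured: an uncoloured one would be a second
  -- edge of W at distance at most 1. So the search, which goes by colours, cannot miss the wedge.
  all-active : ∀ {e} → e < m → T (inW e) → μ Act e ≢ 0
  all-active {e} e< t = go (index e<)
    where
    go : Σ[ i ∈ G.E ] toℕ i ≡ e → μ Act e ≢ 0
    go (i , refl) = use (butterflies i∈)
      where
      i∈ : i ∈ W
      i∈ = inW⁻ t
      use : ButterflyLike G i → μ Act (toℕ i) ≢ 0
      use (x , y , j , b) = Sit.complete e< (λ z → 1+n≢0 (trans (sym (trans (act₃ (toℕ i)) (ind-true t))) z)) geo
        (tinted-edge exz (inj₁ (left jxz)) λ { refl → zy-distinct (same-other j jxz) })
        (tinted-edge exs (inj₁ (left jxs)) λ { refl → sy-distinct (same-other j jxs) })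
        (tinted-edge ezs (inj₂ (left jzs)) λ { refl → not-z (left jzs) })
        where
        open Wedge (wedge b) renaming (z to z′; s to s′)
        exz exs ezs : G.E
        exz = proj₁ xz
        exs = proj₁ xs
        ezs = proj₁ zs
        jxz : G.Joins exz x z′
        jxz = proj₂ xz
        jxs : G.Joins exs x s′
        jxs = proj₂ xs
        jzs : G.Joins ezs z′ s′
        jzs = proj₂ zs
        same-other : ∀ {k u v w} → G.Joins k u v → G.Joins k u w → v ≡ w
        same-other {k} (inj₁ (p , q)) (inj₁ (r , t)) = trans (sym q) t
        same-other {k} (inj₁ (p , q)) (inj₂ (r , t)) = ⊥-elim (G.loopless k (trans p (sym t)))
        same-other {k} (inj₂ (p , q)) (inj₁ (r , t)) = ⊥-elim (G.loopless k (trans r (sym q)))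
        same-other {k} (inj₂ (p , q)) (inj₂ (r , t)) = trans (sym p) r
        not-z : ¬ G.Incident i z′
        not-z = ends j
          where
          ends : G.Joins i x y → ¬ G.Incident i z′
          ends (inj₁ (p , q)) (inj₁ r) = zx-distinct (trans (sym p) r)
          ends (inj₁ (p , q)) (inj₂ r) = zy-distinct (trans (sym q) r)
          ends (inj₂ (p , q)) (inj₁ r) = zy-distinct (trans (sym p) r)
          ends (inj₂ (p , q)) (inj₂ r) = zx-distinct (trans (sym q) r)
        tinted-edge : ∀ k → G.Incident k x ⊎ G.Incident k z′ → i ≢ k → C₀ (toℕ k) ≢ 0
        tinted-edge k (inj₁ kx) ne z = no-walk i∈ (in-W z) ne 0 z≤n (left j) kx stop
        tinted-edge k (inj₂ kz) ne z = no-walk i∈ (in-W z) ne 1 (s≤s z≤n) (left j) kz (step xz stop)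
        geo : Geometry (site (toℕ i) (toℕ x) (toℕ y) (toℕ z′) (toℕ exz) (toℕ exs) (toℕ ezs) 0)
        geo = record
          { e< = e< ; xz< = Fin.toℕ<n exz ; xs< = Fin.toℕ<n exs ; zs< = Fin.toℕ<n ezs ; s = toℕ s′
          ; je = raise-joins j ; jxz = raise-joins jxz ; jxs = raise-joins jxs ; jzs = raise-joins jzs
          ; dy = ≤-trans (deg≤degree y) (≤-reflexive deg-y) ; dz = ≤-trans (deg≤degree z′) (≤-reflexive deg-z) }

  table₀ : Table μ C₀
  table₀ = table-cong (λ _ → run-frame (eachE siteB) tt) (λ _ → run-frame (eachE siteB) tt) table₃

  module First = Colouring {5} {μ} {C₀} sound₀ table₀ (λ {e} _ _ _ → rank (siteOf e) C₀)

  Outcome : Set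
  Outcome = Σ[ C ∈ (ℕ → ℕ) ] ((∀ {f} → f < m → run algorithm blank Col f ≡ C f) × (∀ {f} → f < m → C f < 9) × Proper C
              × (∀ {f} → f < m → ¬ T (inW f) → C f ≢ 0) × count inW m ≤ rate * solved C)

  -- No constructor of `Rank` has the index 0.
  nobody : ∀ {st C} → Inv 0 st C → active st ≤ 0
  nobody {st} iv = ≤-trans (sum≤ 0 m λ {e} e< → ≤-reflexive (ind-false λ t → none (Inv.ranked iv e< (posᵇ⁻ t)))) (≤-reflexive (*-zeroʳ m))
    where
    none : ∀ {σ C} → ¬ (∃[ r ] (r ≤ 0 × Rank σ C r))
    none (_ , z≤n , ())

  outcome : 0 < n → Outcome
  outcome 0<n = go₁ (stage-spec 0<n First.inv)
    where
    start : count inW m ≤ solved First.C′ + active First.st′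
    start = ≤-trans (≤-trans (count-mono m (λ e< t → posᵇ⁺ (all-active e< t))) (m≤n+m _ (solved C₀))) First.tally
    t₁ t₂ t₃ t₄ t₅ : St
    t₁ = run stage First.st′
    t₂ = run stage t₁
    t₃ = run stage t₂
    t₄ = run stage t₃
    t₅ = run stage t₄
    Next : ℕ → St → (ℕ → ℕ) → St → Set
    Next ρ st C st′ = Σ[ C′ ∈ (ℕ → ℕ) ] (Inv ρ st′ C′ × solved C + active st ≤ loss * (solved C′ + active st′))
    go₅ : ∀ {C} → count inW m ≤ loss * (loss * (loss * (loss * (solved C + active t₄)))) → Next 0 t₄ C t₅ → Outcome
    go₅ {C} le (C′ , iv , le′) = C′ , col≗ , C< , proper , outside , ≤-trans le (≤-trans (deep (deep (deep (deep le″)))) (≤-reflexive (sym rate*)))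
      where
      open Sound (Inv.sound iv)
      deep : ∀ {a b} → a ≤ b → loss * a ≤ loss * b
      deep = *-monoʳ-≤ loss
      le″ : solved C + active t₄ ≤ loss * solved C′
      le″ = ≤-trans le′ (deep (≤-trans (+-monoʳ-≤ (solved C′) (nobody iv)) (≤-reflexive (+-identityʳ _))))
      rate* : rate * solved C′ ≡ loss * (loss * (loss * (loss * (loss * solved C′))))
      rate* = trans (*-assoc loss _ _) (cong (loss *_) (trans (*-assoc loss _ _) (cong (loss *_)
        (trans (*-assoc loss _ _) (cong (loss *_) (*-assoc loss loss _))))))
    go₄ : ∀ {C} → count inW m ≤ loss * (loss * (loss * (solved C + active t₃))) → Next 1 t₃ C t₄ → Outcome
    go₄ le (C′ , iv , le′) = go₅ (≤-trans le (*-monoʳ-≤ loss (*-monoʳ-≤ loss (*-monoʳ-≤ loss le′)))) (stage-spec 0<n iv)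
    go₃ : ∀ {C} → count inW m ≤ loss * (loss * (solved C + active t₂)) → Next 2 t₂ C t₃ → Outcome
    go₃ le (C′ , iv , le′) = go₄ (≤-trans le (*-monoʳ-≤ loss (*-monoʳ-≤ loss le′))) (stage-spec 0<n iv)
    go₂ : ∀ {C} → count inW m ≤ loss * (solved C + active t₁) → Next 3 t₁ C t₂ → Outcome
    go₂ le (C′ , iv , le′) = go₃ (≤-trans le (*-monoʳ-≤ loss le′)) (stage-spec 0<n iv)
    go₁ : Next 4 First.st′ First.C′ t₁ → Outcome
    go₁ (C′ , iv , le′) = go₂ (≤-trans start le′) (stage-spec 0<n iv)

  -- An edge provides a vertex, hence 0 < n; without edges the initial colouring will do.
  result : Outcome
  result = go (m ≟ 0)
    where
    go : Dec (m ≡ 0) → Outcome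
    go (no m≢0) = outcome (≤-trans (s≤s z≤n) (Net.src< net (n≢0⇒n>0 m≢0)))
    go (yes m≡0) = C₀ , (λ f< → ⊥-elim (empty f<)) , (λ f< → ⊥-elim (empty f<)) , (λ e< → ⊥-elim (empty e<)) , (λ f< → ⊥-elim (empty f<))
      , ≤-trans (≤-reflexive (cong (count inW) m≡0)) z≤n
      where
      empty : ∀ {f} → ¬ f < m
      empty f< = n≮0 (subst (_ <_) m≡0 f<)

-- The rate as a rational number, and the constants for time and word size

scaled≤ : ∀ k {a b} → a ≤ k * b → (ℤ.+ 1 ℚ./ suc k) *ℚ ℕ→ℚ a ≤ℚ ℕ→ℚ b
scaled≤ k {a} {b} le = ℚ.toℚᵘ-cancel-≤ (begin
  ℚ.toℚᵘ ((ℤ.+ 1 ℚ./ suc k) *ℚ ℕ→ℚ a)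
    ≃⟨ ℚ.toℚᵘ-homo-* (ℤ.+ 1 ℚ./ suc k) (ℕ→ℚ a) ⟩
  ℚ.toℚᵘ (ℤ.+ 1 ℚ./ suc k) ℚᵘ.* ℚ.toℚᵘ (ℕ→ℚ a)
    ≃⟨ ℚᵘ.*-cong (ℚ.toℚᵘ-fromℚᵘ (ℚᵘ.mkℚᵘ (ℤ.+ 1) k)) (ℚ.toℚᵘ-fromℚᵘ (ℚᵘ.mkℚᵘ (ℤ.+ a) 0)) ⟩
  ℚᵘ.mkℚᵘ (ℤ.+ 1) k ℚᵘ.* ℚᵘ.mkℚᵘ (ℤ.+ a) 0
    ≤⟨ ℚᵘ.*≤* cross ⟩
  ℚᵘ.mkℚᵘ (ℤ.+ b) 0
    ≃⟨ ℚ.toℚᵘ-fromℚᵘ (ℚᵘ.mkℚᵘ (ℤ.+ b) 0) ⟨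
  ℚ.toℚᵘ (ℕ→ℚ b) ∎)
  where
  open ℚᵘ.≤-Reasoning
  cross : (ℤ.+ 1 ℤ.* ℤ.+ a) ℤ.* ℤ.+ 1 ℤ.≤ ℤ.+ b ℤ.* ℤ.+ (suc k * 1)
  cross = subst₂ ℤ._≤_ (sym (trans (ℤ.*-identityʳ (ℤ.+ 1 ℤ.* ℤ.+ a)) (ℤ.*-identityˡ (ℤ.+ a))))
    (trans (ℤ.pos-* b (suc k)) (cong (λ x → ℤ.+ b ℤ.* ℤ.+ x) (sym (*-identityʳ (suc k)))))
    -- The factor k is weakened to suc k, which is visibly a nonzero denominator.
    (ℤ.+≤+ (≤-trans le (≤-trans (*-monoˡ-≤ b (n≤1+n k)) (≤-reflexive (*-comm (suc k) b)))))

positive : ∀ k → 0ℚ <ℚ (ℤ.+ 1 ℚ./ suc k)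
positive k = ℚ.toℚᵘ-cancel-< (ℚᵘ.<-respʳ-≃ (ℚᵘ.≃-sym (ℚ.toℚᵘ-fromℚᵘ (ℚᵘ.mkℚᵘ (ℤ.+ 1) k))) (ℚᵘ.*<* (ℤ.+<+ (s≤s z≤n))))

-- The factors 9 outside `costP` and `growP` stem from n + m ≤ 9 * n, and the lone 9 from `widest`;
-- the first factor of `wordFactor` is `need`.
timeFactor wordFactor : Phase → ℕ
timeFactor p = 5 + 9 * (costP p + 3)
wordFactor p = (14 + slots * sizeP p + slots) * (9 + 9 * growP p)

k≤2^k : ∀ k → k ≤ 2 ^ k
k≤2^k zero    = z≤n
k≤2^k (suc k) = ≤-trans (+-mono-≤ (m^n>0 2 k) (k≤2^k k)) (≤-reflexive (cong (2 ^ k +_) (sym (+-identityʳ (2 ^ k)))))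

linear : ∀ k n {s} → s ≤ 9 * n → 5 + suc s * k ≤ (5 + 9 * k) * suc n
linear k n {s} s≤ = begin
  5 + suc s * k
    ≤⟨ +-mono-≤ (m≤m*n 5 (suc n)) (*-monoˡ-≤ k {suc s} {9 * suc n} (≤-trans (s≤s s≤) (≤-trans (m≤n+m (suc (9 * n)) 8) (≤-reflexive (sym (*-suc 9 n)))))) ⟩
  5 * suc n + 9 * suc n * k
    ≡⟨ cong (5 * suc n +_) (trans (*-assoc 9 (suc n) k) (trans (cong (9 *_) (*-comm (suc n) k)) (sym (*-assoc 9 k (suc n))))) ⟩
  5 * suc n + 9 * k * suc n
    ≡⟨ *-distribʳ-+ (suc n) 5 (9 * k) ⟨
  (5 + 9 * k) * suc n ∎
  where
  open ≤-Reasoning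

regroup : ∀ q g x → q * (9 * x + 9 * x * g) ≡ x * (q * (9 + 9 * g))
regroup q g x = begin
  q * (9 * x + 9 * x * g)
    ≡⟨ cong (q *_) (cong₂ _+_ (*-comm 9 x) (trans (cong (_* g) (*-comm 9 x)) (*-assoc x 9 g))) ⟩
  q * (x * 9 + x * (9 * g))
    ≡⟨ cong (q *_) (*-distribˡ-+ x 9 (9 * g)) ⟨
  q * (x * (9 + 9 * g))
    ≡⟨ trans (sym (*-assoc q x (9 + 9 * g))) (trans (cong (_* (9 + 9 * g)) (*-comm q x)) (*-assoc x q (9 + 9 * g))) ⟩
  x * (q * (9 + 9 * g)) ∎
  where
  open ≡-Reasoning

module Answer (G : Graph) (Δ≤8 : Graph.Δ G ≤ 8) (W : Subset (Graph.∣E∣ G)) (butterflies : ∀ {e} → e ∈ W → ButterflyLike G e)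
              (indep : PairwiseIndependent G 4 W) (π : PartialColoring G 8) (π-colored : PartialColoring.colored π ≡ ∁ W) where
  open Instance G Δ≤8 W butterflies indep π π-colored
  open OfGraph G
  module S = Solve G Δ≤8 W butterflies indep π π-colored

  C : ℕ → ℕ
  C = proj₁ S.result

  final : ∀ {f} → f < m → Meaning.run n m inp algorithm blank Col f ≡ C f
  final = proj₁ (proj₂ S.result)

  C< : ∀ {f} → f < m → C f < 9
  C< = proj₁ (proj₂ (proj₂ S.result))

  proper : Colourings.Proper net C
  proper = proj₁ (proj₂ (proj₂ (proj₂ S.result)))

  outside : ∀ {f} → f < m → ¬ T (inW f) → C f ≢ 0
  outside = proj₁ (proj₂ (proj₂ (proj₂ (proj₂ S.result))))

  enough : count inW m ≤ rate * S.solved C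
  enough = proj₂ (proj₂ (proj₂ (proj₂ (proj₂ S.result))))

  code≡ : ∀ i → code (decode (C (toℕ i))) ≡ C (toℕ i)
  code≡ i = code-decode (C< (Fin.toℕ<n i))

  σ : PartialColoring G 8
  σ = record
    { color = λ i → decode (C (toℕ i))
    -- Equal colours at a common end would make the value of C zero, whereas the code of `just a` is
    -- a successor.
    ; proper = λ {i} {j} {v} {a} {b} ne iv jv ca cb eq → 1+n≢0 (trans (sym (trans (sym (code≡ i)) (cong code ca)))
        (proper (Fin.toℕ<n i) (Fin.toℕ<n j) (ne ∘ Fin.toℕ-injective) (raise-inc iv) (raise-inc jv)
          (trans (sym (code≡ i)) (trans (cong code (trans ca (trans (cong just eq) (sym cb)))) (code≡ j))))) }

  W′ : Subset (Graph.∣E∣ G)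
  W′ = Vec.tabulate (λ i → S.solvedᵇ C (toℕ i))

  W′⊆W : W′ ⊆ W
  W′⊆W {i} i∈ = inW⁻ (proj₁ (S.solvedᵇ⁻ {C} (subst T (sym (trans (sym (Vec.lookup∘tabulate (λ i → S.solvedᵇ C (toℕ i)) i)) (Vec.[]=⇒lookup i∈))) tt)))

  colored≡ : PartialColoring.colored σ ≡ ∁ W ∪ W′
  colored≡ = lookup-extensional λ i → trans (Vec.lookup∘tabulate (λ i → is-just (decode (C (toℕ i)))) i)
    (trans (trans (is-just-posᵇ (decode (C (toℕ i)))) (cong posᵇ (code≡ i)))
    (trans (split (inW (toℕ i)) (C (toℕ i)) (outside (Fin.toℕ<n i)))
    (sym (trans (Vec.lookup-zipWith _∨_ i (∁ W) W′) (cong₂ _∨_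
      (trans (Vec.lookup-map i not W) (cong not (sym (ext-toℕ false (Vec.lookup W) i))))
      (Vec.lookup∘tabulate (λ i → S.solvedᵇ C (toℕ i)) i))))))
    where
    split : ∀ b c → (¬ T b → c ≢ 0) → posᵇ c ≡ not b ∨ (if b then posᵇ c else false)
    split true  c       _ = refl
    split false zero    h = ⊥-elim (h id refl)
    split false (suc c) _ = refl

  large : (ℤ.+ 1 ℚ./ suc rate) *ℚ ℕ→ℚ ∣ W ∣ ≤ℚ ℕ→ℚ ∣ W′ ∣
  large = scaled≤ rate (≤-trans (≤-reflexive (card W)) (≤-trans enough (*-monoʳ-≤ rate (≤-trans (count-mono m same) (≤-reflexive (sym (card W′)))))))
    where
    same : ∀ {e} → e < m → T (S.solvedᵇ C e) → T (ext false (Vec.lookup W′) e)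
    same e< t with index e<
    ... | i , refl = subst T (sym (trans (ext-toℕ false (Vec.lookup W′) i) (Vec.lookup∘tabulate (λ i → S.solvedᵇ C (toℕ i)) i))) t

  n+m≤ : n + m ≤ 9 * n
  n+m≤ = +-monoʳ-≤ n (edges≤ Δ≤8)

  -- Stated for any phase, so that the costs and sizes of the actual algorithm stay symbolic.
  module _ (p : Phase) (computes : ∀ {f} → f < m → Meaning.run n m inp p blank Col f ≡ C f) where

    D : ℕ
    D = suc (wordFactor p)

    module R = Simulation.Running n m inp ((2 + n) ^ D) widest (s≤s z≤n) n≤widest m≤widest inp≤

    room : R.need (sizeP p) * (widest + (n + m) * growP p) ≤ (2 + n) ^ D
    room = begin
      R.need (sizeP p) * (widest + (n + m) * g)
        ≤⟨ *-mono-≤ (≤-reflexive (R.need-def (sizeP p))) (+-mono-≤ wide (*-monoˡ-≤ g (≤-trans n+m≤ (*-monoʳ-≤ 9 (m≤n+m n 2))))) ⟩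
      q * (9 * (2 + n) + 9 * (2 + n) * g)
        ≡⟨ regroup q g (2 + n) ⟩
      (2 + n) * wordFactor p
        -- A constant factor k is absorbed into the exponent: k is at most 2 ^ k, hence at most (2 +
        -- n) ^ k.
        ≤⟨ *-monoʳ-≤ (2 + n) (≤-trans (k≤2^k (wordFactor p)) (^-monoˡ-≤ (wordFactor p) (m≤m+n 2 n))) ⟩
      (2 + n) ^ D ∎
      where
      open ≤-Reasoning
      g q : ℕ
      g = growP p
      q = 14 + slots * sizeP p + slots
      wide : widest ≤ 9 * (2 + n)
      wide = ≤-trans (+-mono-≤ (m≤m+n 9 9) (*-monoˡ-≤ n (n≤1+n 8))) (≤-reflexive (sym (*-distribˡ-+ 9 2 n)))

    finds : Finds (whole p) (timeFactor p) (suc (wordFactor p)) G W π σ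
    finds = conclude (R.runWhole refl refl (λ le → inp-beyond (≤-trans (≤-reflexive (sym (Simulation.base-def n m inp))) le)) p room)
      where
      conclude : Σ[ t ∈ ℕ ] Σ[ s ∈ State ] (Run ((2 + n) ^ D) (whole p) (state (λ _ → 0) inp) s t
                   × t ≤ 5 + suc (n + m) * (costP p + 3) × (∀ {e} → e < m → mem s e ≡ Meaning.run n m inp p R.empty Col e)) →
                 Finds (whole p) (timeFactor p) D G W π σ
      conclude (t , s , r , t≤ , out) = t , s , r , ≤-trans t≤ (linear (costP p + 3) n n+m≤) , λ i → trans (out (Fin.toℕ<n i)) (trans (computes (Fin.toℕ<n i)) (sym (code≡ i)))
theorem4 : Σ[ c ∈ ℚ ] (0ℚ <ℚ c × (Σ[ p ∈ Program ] Σ[ C ∈ ℕ ] Σ[ D ∈ ℕ ]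
    ((G : Graph) → Planar G → Δ G ≤ 8 →
    (W : Subset (∣E∣ G)) → (∀ {e} → e ∈ W → ButterflyLike G e) → PairwiseIndependent G 4 W →
    (π : PartialColoring G 8) → colored π ≡ ∁ W →
    Σ[ σ ∈ PartialColoring G 8 ]
    ( Finds p C D G W π σ
    × (Σ[ W′ ∈ Subset (∣E∣ G) ]
    ( W′ ⊆ W
    × colored σ ≡ ∁ W ∪ W′
    × c *ℚ ℕ→ℚ ∣ W ∣ ≤ℚ ℕ→ℚ ∣ W′ ∣ ))))))
theorem4 = ℤ.+ 1 ℚ./ suc rate , positive rate , whole algorithm , timeFactor algorithm , suc (wordFactor algorithm) ,
  λ G _ Δ≤8 W butterflies indep π π-colored →
    let open Answer G Δ≤8 W butterflies indep π π-colored in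
    σ , finds algorithm final , W′ , W′⊆W , colored≡ , large
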